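{- The generating functions $X(q,u,v)$, $Y(q,u,v)$, $Z(q,u,v)$ of the classes $\mathcal{X},\mathcal{Y},\mathcal{Z}$ of 4-sided prudent polygons ending at $(-1,0)$ in a counter-clockwise direction (defined in the context) satisfy the functional equations $$X(q,u,v)=\frac{qv}{1-q}[X(q,u,v)-X(q,qu,v)]+\frac{qv}{1-q}[Y(q,v,u)-Y(q,v,qu)]+\frac{quv}{1-q}[Z(q,u,v)-qZ(q,qu,v)],$$ $$Y(q,u,v)=quv+\frac{qv}{1-q}[Y(q,u,v)-Y(q,qu,v)]+\frac{qv^2}{1-q}[Z(q,v,u)-Z(q,v,qu)]+quv[X(q,qv,u)+Y(q,u,qv)+qvZ(q,qv,u)],$$ $$Z(q,u,v)=\frac{qv}{1-q}[Z(q,u,v)-Z(q,qu,v)]+qvY(q,qv,u)+quvZ(q,u,qv).$$ The area generating function of 4-sided prudent polygons is then given by $$PA^{(4)}(q)=8[X(q,1,1)+Y(q,1,1)+Z(q,1,1)]$$ $$=8q+16q^2+40q^3+96q^4+232q^5+560q^6+1336q^7+3176q^8+7480q^9+17528q^{10}+\cdots.$$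
   Context: All walks are on the square lattice $\mathbb{Z}^2$, start at $(0,0)$ and take unit steps north, south, east, west. A walk is prudent if it is self-avoiding and never takes a step towards an already occupied site: if a step goes from $p$ to $p+d$ (with $d$ a unit direction vector), then none of the points $p+kd$, $k\ge1$, has been visited before that step. "4-sided" means unrestricted: every prudent walk is 4-sided. A prudent polygon is a prudent walk, with more than one step, that ends at a lattice site adjacent to its starting point $(0,0)$; the polygon is the closed curve obtained by adding the edge joining the endpoint to $(0,0)$. Polygons are counted as walks, i.e. they are rooted at $(0,0)$ and oriented. The area is the number of unit cells enclosed, and $PA^{(4)}(q)=\sum_{n\ge1}PA^{(4)}_nq^n$ with $PA^{(4)}_n$ the number of 4-sided prudent polygons of area $n$. Width and height of a polygon are those of its bounding box (number of columns and of rows of cells). Consider the prudent polygons whose walk ends at $(-1,0)$ and which are traversed counter-clockwise. They are split into three classes, with trivariate generating functions (formal power series): $X(q,u,v)=\sum_{n,i,j\ge1}x_{n,i,j}q^nu^iv^j$ is the generating function of the class $\mathcal{X}$ of those polygons for which removing the top row (of cells) does not change the width or leave two or more disconnected pieces; $q$ measures area, $u$ width and $v$ height. $Y(q,u,v)=\sum_{n,i,j\ge1}y_{n,i,j}q^nu^iv^j$ is the generating function of the class $\mathcal{Y}$ consisting of the unit square plus those polygons not in $\mathcal{X}$ for which removing the rightmost column does not change the height or leave two or more disconnected pieces; $q$ measures area, $u$ height and $v$ width. $Z(q,u,v)=\sum_{n,i,j\ge1}z_{n,i,j}q^nu^iv^j$ is the generating function of the class $\mathcal{Z}$ of those polygons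 not in $\mathcal{X}$ or $\mathcal{Y}$; $q$ measures area, $u$ measures width minus $1$, and $v$ measures height. -}

module Defs where

open import Data.Bool.Base using (if_then_else_; _∧_)
open import Data.Integer.Base as ℤ using (ℤ; +_; 0ℤ; 1ℤ; -1ℤ)
import Data.Integer.Properties as ℤₚ
open import Data.List.Base using (List; []; _∷_; _++_; [_]; map; foldr; length; zip; drop)
open import Data.List.Membership.Propositional using (_∈_; _∉_)
open import Data.List.Relation.Unary.Unique.Propositional using (Unique)
open import Data.Nat.Base as ℕ using (ℕ; zero; suc; _∸_; _<_; _<ᵇ_; _≡ᵇ_)
open import Data.Product.Base using (Σ-syntax; ∃-syntax; _×_; _,_; proj₁; proj₂)
open import Data.Sum.Base using (_⊎_)

open import Function.Bundles using (_⇔_)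
open import Relation.Binary.Construct.Closure.ReflexiveTransitive using (Star)
open import Relation.Binary.PropositionalEquality.Core using (_≡_; _≢_)
open import Relation.Nullary.Decidable.Core using (does)
open import Relation.Nullary.Negation.Core using (¬_)

-- A list rather than a bijection with Fin n, so that proofs of P a are
-- irrelevant to the count.
HasCardinality : {A : Set} → (A → Set) → ℕ → Set
HasCardinality {A} P n =
  Σ[ xs ∈ List A ] Unique xs × (∀ a → a ∈ xs ⇔ P a) × length xs ≡ n

Point : Set
Point = ℤ × ℤ

origin : Point
origin = 0ℤ , 0ℤ

data Direction : Set where
  N S E W : Direction

vec : Direction → Point
vec N = 0ℤ , 1ℤ
vec S = 0ℤ , -1ℤ
vec E = 1ℤ , 0ℤ
vec W = -1ℤ , 0ℤ

infixl 6 _⊞_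
infixl 7 _⊡_

_⊞_ : Point → Point → Point
(x , y) ⊞ (x′ , y′) = x ℤ.+ x′ , y ℤ.+ y′

_⊡_ : ℕ → Point → Point
k ⊡ (x , y) = + k ℤ.* x , + k ℤ.* y

Adjacent : Point → Point → Set
Adjacent p p′ = Σ[ d ∈ Direction ] p′ ≡ p ⊞ vec d

Walk : Set
Walk = List Direction

endpointFrom : Point → Walk → Point
endpointFrom p []       = p
endpointFrom p (d ∷ ds) = endpointFrom (p ⊞ vec d) ds

sitesFrom : Point → Walk → List Point
sitesFrom p []       = [ p ]
sitesFrom p (d ∷ ds) = p ∷ sitesFrom (p ⊞ vec d) ds

endpoint : Walk → Point
endpoint = endpointFrom origin

sites : Walk → List Point
sites = sitesFrom origin

SelfAvoiding : Walk → Set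
SelfAvoiding w = Unique (sites w)

NeverTowardsOccupied : Walk → Set
NeverTowardsOccupied w =
  ∀ before d after → w ≡ before ++ d ∷ after →
  ∀ k → 1 ℕ.≤ k → endpoint before ⊞ k ⊡ vec d ∉ sites before

Prudent : Walk → Set
Prudent w = SelfAvoiding w × NeverTowardsOccupied w

PrudentPolygon : Walk → Set
PrudentPolygon w = Prudent w × 1 < length w × Adjacent origin (endpoint w)

-- The directed edges of the closed curve, the last one joining the endpoint
-- to the origin.
closedCurve : Walk → List (Point × Point)
closedCurve w = zip (sites w) (drop 1 (sites w) ++ [ origin ])

-- A cell is named by its south-west corner.
Cell : Set
Cell = Point

column row : Cell → ℤ
column = proj₁
row    = proj₂

-- Signed crossing of a directed edge with the ray going east from the centre
-- of the cell: +1 if the edge is traversed northwards, -1 if southwards.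
crossing : Cell → Point × Point → ℤ
crossing (x , y) ((a , b) , (_ , b′)) =
  if does (x ℤₚ.<? a) then
    (if does (b ℤₚ.≟ y) ∧ does (b′ ℤₚ.≟ ℤ.suc y) then 1ℤ
     else if does (b ℤₚ.≟ ℤ.suc y) ∧ does (b′ ℤₚ.≟ y) then -1ℤ
     else 0ℤ)
  else 0ℤ

windingNumber : Walk → Cell → ℤ
windingNumber w c = foldr ℤ._+_ 0ℤ (map (crossing c) (closedCurve w))

-- For a simple closed curve the winding number is 0 outside, and inside it is
-- +1 or -1 according to the orientation.
Enclosed : Walk → Cell → Set
Enclosed w c = windingNumber w c ≢ 0ℤ

CounterClockwise : Walk → Set
CounterClockwise w = ∀ c → Enclosed w c → windingNumber w c ≡ 1ℤ

Region : Set₁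
Region = Cell → Set

Area : Region → ℕ → Set
Area = HasCardinality

-- Side length of the bounding box of R along the given coordinate; an empty
-- region has none.
Extent : (Cell → ℤ) → Region → ℕ → Set
Extent coord R ℓ =
  Σ[ lo ∈ ℤ ] Σ[ hi ∈ ℤ ]
    (∀ c → R c → lo ℤ.≤ coord c × coord c ℤ.≤ hi) ×
    (∃[ c ] R c × coord c ≡ lo) ×
    (∃[ c ] R c × coord c ≡ hi) ×
    1ℤ ℤ.+ hi ≡ lo ℤ.+ + ℓ

Width Height : Region → ℕ → Set
Width  = Extent column
Height = Extent row

-- Cells sharing only a corner are not joined.
Connected : Region → Set
Connected R = ∀ c c′ → R c → R c′ →
  Star (λ a b → R a × R b × Adjacent a b) c c′

-- A cell is off the last row (column) iff some cell of R lies strictly beyond it.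
withoutLast : (Cell → ℤ) → Region → Region
withoutLast coord R c = R c × (∃[ c′ ] R c′ × coord c ℤ.< coord c′)

removeTopRow removeRightmostColumn : Region → Region
removeTopRow          = withoutLast row
removeRightmostColumn = withoutLast column

TopRowRemovable RightmostColumnRemovable : Region → Set
TopRowRemovable R =
  (∃[ k ] Width R k × Width (removeTopRow R) k) ×
  Connected (removeTopRow R)
RightmostColumnRemovable R =
  (∃[ k ] Height R k × Height (removeRightmostColumn R) k) ×
  Connected (removeRightmostColumn R)

WestPolygon : Walk → Set
WestPolygon w =
  PrudentPolygon w × endpoint w ≡ (-1ℤ , 0ℤ) × CounterClockwise w

Class𝒳 Class𝒴 Class𝒵 : Walk → Set
Class𝒳 w = WestPolygon w × TopRowRemovable (Enclosed w)
Class𝒴 w = WestPolygon w ×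
  (Area (Enclosed w) 1 ⊎
   ¬ Class𝒳 w × RightmostColumnRemovable (Enclosed w))
Class𝒵 w = WestPolygon w × ¬ Class𝒳 w × ¬ Class𝒴 w

-- In 𝒴 the first size index is the height; in 𝒵 it is the width minus one.
𝒳 𝒴 𝒵 : ℕ → ℕ → ℕ → Walk → Set
𝒳 n i j w = Class𝒳 w × Area (Enclosed w) n × Width (Enclosed w) i × Height (Enclosed w) j
𝒴 n i j w = Class𝒴 w × Area (Enclosed w) n × Height (Enclosed w) i × Width (Enclosed w) j
𝒵 n i j w = Class𝒵 w × Area (Enclosed w) n × Width (Enclosed w) (suc i) × Height (Enclosed w) j

𝒫 : ℕ → Walk → Set
𝒫 n w = PrudentPolygon w × Area (Enclosed w) n

-- F n i j is the coefficient of qⁿ uⁱ vʲ.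
Series : Set
Series = ℕ → ℕ → ℕ → ℤ

infix  4 _≈_
infixl 6 _⊕_ _⊖_
infixl 7 _⊗_

_≈_ : Series → Series → Set
F ≈ G = ∀ n i j → F n i j ≡ G n i j

_⊕_ _⊖_ _⊗_ : Series → Series → Series
(F ⊕ G) n i j = F n i j ℤ.+ G n i j
(F ⊖ G) n i j = F n i j ℤ.- G n i j

∑≤ : ℕ → (ℕ → ℤ) → ℤ
∑≤ zero    f = f 0
∑≤ (suc n) f = ∑≤ n f ℤ.+ f (suc n)

(F ⊗ G) n i j =
  ∑≤ n λ a → ∑≤ i λ b → ∑≤ j λ c → F a b c ℤ.* G (n ∸ a) (i ∸ b) (j ∸ c)

monomial : ℕ → ℕ → ℕ → Series
monomial a b c n i j =
  if (n ≡ᵇ a) ∧ (i ≡ᵇ b) ∧ (j ≡ᵇ c) then 1ℤ else 0ℤ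

q u v : Series
q = monomial 1 0 0
u = monomial 0 1 0
v = monomial 0 0 1

-- The geometric series ∑ qⁿ, inverse to 1 - q.
1/⟨1-q⟩ : Series
1/⟨1-q⟩ n i j = if (i ≡ᵇ 0) ∧ (j ≡ᵇ 0) then 1ℤ else 0ℤ

infix 8 _⟨q^_u,q^_v⟩ _⟨q^_v,q^_u⟩

-- F(q, qˢu, qᵗv)
_⟨q^_u,q^_v⟩ : Series → ℕ → ℕ → Series
(F ⟨q^ s u,q^ t v⟩) n i j =
  let k = s ℕ.* i ℕ.+ t ℕ.* j in
  if n <ᵇ k then 0ℤ else F (n ∸ k) i j

-- F(q, qˢv, qᵗu)
_⟨q^_v,q^_u⟩ : Series → ℕ → ℕ → Series
(F ⟨q^ s v,q^ t u⟩) n i j = (F ⟨q^ s u,q^ t v⟩) n j i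

-- f(q) = F(q,1,1), which requires each power of q to occur in only finitely
-- many terms.
SpecialisesAt11 : Series → (ℕ → ℤ) → Set
SpecialisesAt11 F f = ∀ n → Σ[ B ∈ ℕ ]
  (∀ i j → B < i ⊎ B < j → F n i j ≡ 0ℤ) ×
  f n ≡ ∑≤ B λ i → ∑≤ B λ j → F n i j

IsGF₁ : (ℕ → Walk → Set) → (ℕ → ℤ) → Set
IsGF₁ P f = ∀ n → ∃[ k ] HasCardinality (P n) k × f n ≡ + k

IsGF₃ : (ℕ → ℕ → ℕ → Walk → Set) → Series → Set
IsGF₃ P F = ∀ n i j → ∃[ k ] HasCardinality (P n i j) k × F n i j ≡ + k

{-# OPTIONS --safe #-}
module Submission where

-- After a step that enlarges the bounding box, a prudent walk can only slide
-- along the new side until the next such step; a walk is thus the same as the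
-- sequence of positions of its enlarging steps.  If the walk ends at (-1 , 0)
-- by a step south, its last enlarging step is the first one to leave the
-- half-plane x ≥ 0, at the top-left corner of the bounding box, and the walk
-- then descends to (-1 , 0).  Dropping the last enlarging step before the final
-- closure peels off the top row, the rightmost column or the bottom row of the
-- polygon, and the way this happens distinguishes the three classes;
-- the functional equations list the possible lengths of the piece.  Finally,
-- the symmetries of the square permute the eight possible pairs (endpoint,
-- direction of the last step) simply transitively.

open import Defs
open import Data.Integer.Base using (ℤ; +_; _+_; _*_)
open import Data.List.Base using ([]; _∷_; applyUpTo)
open import Data.Nat.Base using (ℕ; suc)
open import Data.Product.Base using (Σ-syntax; _×_)
open import Relation.Binary.PropositionalEquality.Core using (_≡_)

open import Data.Bool.Base using (true; false; if_then_else_; _∧_)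
open import Data.Empty using (⊥; ⊥-elim)
import Data.Integer.Base as ℤ
open import Data.Integer.Base using (0ℤ; 1ℤ; -1ℤ; _-_; -_; _≤_; _<_; ∣_∣; +≤+)
import Data.Integer.Properties as ℤₚ
open import Data.Integer.Properties using (drop‿+≤+)
open import Data.Integer.Tactic.RingSolver using (solve-∀)
open import Data.List.Base
  using (List; [_]; _++_; map; foldr; length; zip; drop; reverse; replicate; concat; applyDownFrom; _∷ʳ_)
import Data.List.Membership.DecPropositional as DecMembership
open import Data.List.Membership.Propositional using (_∈_; _∉_)
open import Data.List.Membership.Propositional.Properties
  using (∈-applyDownFrom⁺; ∈-applyDownFrom⁻; ∈-++⁺ˡ; ∈-++⁺ʳ; ∈-++⁻; ∈-map⁺; ∈-map⁻; ∈-concat⁺′; ∈-concat⁻′)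
open import Data.List.Membership.Propositional.Properties.WithK using (unique∧set⇒bag)
import Data.List.Properties as Listₚ
open import Data.List.Relation.Binary.BagAndSetEquality using (∼bag⇒↭)
open import Data.List.Relation.Binary.Permutation.Propositional.Properties using (↭-length)
open import Data.List.Relation.Unary.All as All using (All; []; _∷_)
open import Data.List.Relation.Unary.AllPairs using ([]; _∷_)
open import Data.List.Relation.Unary.Any using (here; there)
import Data.List.Relation.Unary.Any.Properties as Anyₚ
open import Data.List.Relation.Unary.Unique.DecPropositional using (unique?)
open import Data.List.Relation.Unary.Unique.Propositional using (Unique)
import Data.List.Relation.Unary.Unique.Propositional.Properties as Uniqueₚ
import Data.Nat.Base as ℕ
open import Data.Nat.Base using (zero; z≤n; s≤s; _∸_; _<ᵇ_)
import Data.Nat.Properties as ℕₚ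
open import Data.Product.Base using (∃-syntax; _,_; proj₁; proj₂)
open import Data.Product.Properties using (≡-dec)
open import Data.Sum.Base using (_⊎_; inj₁; inj₂; [_,_]′)
open import Data.Unit.Base using (⊤; tt)
open import Function.Base using (_∘_; id; case_of_)
open import Function.Bundles using (mk⇔; Equivalence)
open import Relation.Binary.Construct.Closure.ReflexiveTransitive as Star using (Star; ε; _◅_; _◅◅_)
open import Relation.Binary.Definitions using (DecidableEquality)
open import Relation.Binary.PropositionalEquality
  using (_≢_; refl; sym; trans; cong; cong₂; subst; subst₂; module ≡-Reasoning)
open import Relation.Nullary.Decidable
  using (Dec; yes; no; does; map′; from-yes; recompute; _→-dec_; _×-dec_; _⊎-dec_)
open import Relation.Nullary.Negation using (¬_; contradiction)

-- The bounding box makes the encoding rigid: direction and starting point of an inflating step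
-- determine the next box, so a polygon is a chain of `Turn`s. Five of the seven turns add cells and
-- give the terms of the functional equations; `en` and `se` add none. A strip whose length ranges
-- over 1, ..., k + 1 yields the factor q(1 - q^(k+1))/(1 - q). The enclosed region is defined by
-- winding numbers, which an unfinished walk does not have. Every shape is therefore imagined to be
-- closed along a fixed route: to the right below the box if it ends on the bottom side, then up its
-- right side, back to the left above it and down the line x = -1. A turn changes this route by the
-- boundary of one row or column of cells, or not at all; summing these changes lists the region
-- explicitly. Given the list, removability is a direct check. Its failure is the delicate half: a
-- separating set of cells (`shaft`, `keel`) must be carried through the whole construction. The
-- same recursive enumeration of shapes provides the finite lists that witness the cardinalities,
-- the recurrences of the coefficients, and the ten numerical values.

≤-by : ∀ {a b c d} → a ≤ b → d - c ≡ b - a → c ≤ d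
≤-by a≤b eq = ℤₚ.0≤i-j⇒j≤i (subst (0ℤ ≤_) (sym eq) (ℤₚ.i≤j⇒0≤j-i a≤b))

-- Together with `≤-by`, reduces a linear inequality to a known one and an identity of differences,
-- which the ring solver proves.
<-by : ∀ {a b c d} → a < b → d - c ≡ b - a → c < d
<-by {a} {b} {c} {d} a<b eq =
  ℤₚ.suc[i]≤j⇒i<j (≤-by (ℤₚ.i<j⇒suc[i]≤j a<b) (trans (shift d c) (trans (cong (_- 1ℤ) eq) (sym (shift b a)))))
  where
  shift : ∀ x y → x - (1ℤ + y) ≡ x - y - 1ℤ
  shift = solve-∀

0≤+ : ∀ k → 0ℤ ≤ + k
0≤+ k = +≤+ z≤n

-- Directions and coordinates along them

_≟ᵈ_ : DecidableEquality Direction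
N ≟ᵈ N = yes refl
N ≟ᵈ S = no λ ()
N ≟ᵈ E = no λ ()
N ≟ᵈ W = no λ ()
S ≟ᵈ N = no λ ()
S ≟ᵈ S = yes refl
S ≟ᵈ E = no λ ()
S ≟ᵈ W = no λ ()
E ≟ᵈ N = no λ ()
E ≟ᵈ S = no λ ()
E ≟ᵈ E = yes refl
E ≟ᵈ W = no λ ()
W ≟ᵈ N = no λ ()
W ≟ᵈ S = no λ ()
W ≟ᵈ E = no λ ()
W ≟ᵈ W = yes refl

open DecMembership _≟ᵈ_ using () renaming (_∈?_ to _∈ᵈ?_)

-- Finite facts about directions can thus be settled by evaluating a decision procedure; the lemmas
-- obtained in this way are `abstract`, so that the procedure is not unfolded later.
∀-direction? : {P : Direction → Set} → (∀ d → Dec (P d)) → Dec (∀ d → P d)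
∀-direction? {P} P? = map′ to from (P? N ×-dec P? S ×-dec P? E ×-dec P? W)
  where
  to : P N × P S × P E × P W → ∀ d → P d
  to (n , s , e , w) = λ { N → n ; S → s ; E → e ; W → w }
  from : (∀ d → P d) → P N × P S × P E × P W
  from f = f N , f S , f E , f W

opp : Direction → Direction
opp N = S
opp S = N
opp E = W
opp W = E

-- The inner product with `vec d`; it allows one argument for all four directions.
along : Direction → Point → ℤ
along N (x , y) = y
along S (x , y) = - y
along E (x , y) = x
along W (x , y) = - x

infix 4 _⟂_

_⟂_ : Direction → Direction → Set
c ⟂ d = along c (vec d) ≡ 0ℤ

_⟂?_ : ∀ c d → Dec (c ⟂ d)
c ⟂? d = along c (vec d) ℤₚ.≟ 0ℤ

abstract
  ⟂-sym : ∀ c d → c ⟂ d → d ⟂ c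
  ⟂-sym = from-yes (∀-direction? λ c → ∀-direction? λ d → (c ⟂? d) →-dec (d ⟂? c))

  ⟂-exists : ∀ d → ∃[ c ] c ⟂ d
  ⟂-exists N = E , refl
  ⟂-exists S = E , refl
  ⟂-exists E = N , refl
  ⟂-exists W = N , refl

  -- The order of the list is that of the later case distinctions: onwards, backwards, and the two
  -- ways along the side.
  ⟂-axes : ∀ c d → c ⟂ d → ∀ e → e ∈ d ∷ opp d ∷ c ∷ opp c ∷ []
  ⟂-axes = from-yes (∀-direction? λ c → ∀-direction? λ d → (c ⟂? d) →-dec
    ∀-direction? λ e → e ∈ᵈ? (d ∷ opp d ∷ c ∷ opp c ∷ []))

  ⟂-opp : ∀ c d → c ⟂ d → opp c ⟂ d
  ⟂-opp = from-yes (∀-direction? λ c → ∀-direction? λ d → (c ⟂? d) →-dec (opp c ⟂? d))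

  ⟂-oppʳ : ∀ c d → c ⟂ d → c ⟂ opp d
  ⟂-oppʳ = from-yes (∀-direction? λ c → ∀-direction? λ d → (c ⟂? d) →-dec (c ⟂? opp d))

  along-self : ∀ d → along d (vec d) ≡ 1ℤ
  along-self = from-yes (∀-direction? λ d → along d (vec d) ℤₚ.≟ 1ℤ)

  along-opp : ∀ d → along d (vec (opp d)) ≡ -1ℤ
  along-opp = from-yes (∀-direction? λ d → along d (vec (opp d)) ℤₚ.≟ -1ℤ)

  along-≥-1 : ∀ c d → -1ℤ ≤ along c (vec d)
  along-≥-1 = from-yes (∀-direction? λ c → ∀-direction? λ d → -1ℤ ℤₚ.≤? along c (vec d))

along-⊞ : ∀ d p r → along d (p ⊞ r) ≡ along d p + along d r
along-⊞ N p r = refl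
along-⊞ S p r = ℤₚ.neg-distrib-+ (proj₂ p) (proj₂ r)
along-⊞ E p r = refl
along-⊞ W p r = ℤₚ.neg-distrib-+ (proj₁ p) (proj₁ r)

along-⊡ : ∀ d k r → along d (k ⊡ r) ≡ + k * along d r
along-⊡ N k r = refl
along-⊡ S k r = ℤₚ.neg-distribʳ-* (+ k) (proj₂ r)
along-⊡ E k r = refl
along-⊡ W k r = ℤₚ.neg-distribʳ-* (+ k) (proj₁ r)

along-ray : ∀ c p k d → along c (p ⊞ k ⊡ vec d) ≡ along c p + + k * along c (vec d)
along-ray c p k d = trans (along-⊞ c p (k ⊡ vec d)) (cong (_+_ (along c p)) (along-⊡ c k (vec d)))

⟂-ext : ∀ c d → c ⟂ d → ∀ {p r} → along c p ≡ along c r → along d p ≡ along d r → p ≡ r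
⟂-ext N N () _ _
⟂-ext N S () _ _
⟂-ext S N () _ _
⟂-ext S S () _ _
⟂-ext E E () _ _
⟂-ext E W () _ _
⟂-ext W E () _ _
⟂-ext W W () _ _
⟂-ext N E _ y x = cong₂ _,_ x y
⟂-ext N W _ y x = cong₂ _,_ (ℤₚ.neg-injective x) y
⟂-ext S E _ y x = cong₂ _,_ x (ℤₚ.neg-injective y)
⟂-ext S W _ y x = cong₂ _,_ (ℤₚ.neg-injective x) (ℤₚ.neg-injective y)
⟂-ext E N _ x y = cong₂ _,_ x y
⟂-ext E S _ x y = cong₂ _,_ x (ℤₚ.neg-injective y)
⟂-ext W N _ x y = cong₂ _,_ (ℤₚ.neg-injective x) y
⟂-ext W S _ x y = cong₂ _,_ (ℤₚ.neg-injective x) (ℤₚ.neg-injective y)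

along-step : ∀ d p → along d (p ⊞ vec d) ≡ along d p + 1ℤ
along-step d p = trans (along-⊞ d p (vec d)) (cong (_+_ (along d p)) (along-self d))

along-step-⟂ : ∀ c d → c ⟂ d → ∀ p → along c (p ⊞ vec d) ≡ along c p
along-step-⟂ c d c⟂d p = trans (along-⊞ c p (vec d)) (trans (cong (_+_ (along c p)) c⟂d) (ℤₚ.+-identityʳ _))

along-ray-self : ∀ d p k → along d (p ⊞ k ⊡ vec d) ≡ along d p + + k
along-ray-self d p k = trans (along-ray d p k d)
  (cong (_+_ (along d p)) (trans (cong (+ k *_) (along-self d)) (ℤₚ.*-identityʳ (+ k))))

along-ray-⟂ : ∀ c d → c ⟂ d → ∀ p k → along c (p ⊞ k ⊡ vec d) ≡ along c p
along-ray-⟂ c d c⟂d p k = trans (along-ray c p k d)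
  (trans (cong (λ t → along c p + + k * t) c⟂d)
      (trans (cong (_+_ (along c p)) (ℤₚ.*-zeroʳ (+ k))) (ℤₚ.+-identityʳ _)))

-- Produces the violation of prudence by a step in direction `opp d`; the distance `k` is the
-- difference of the `d`-coordinates.
on-ray-behind : ∀ c d → c ⟂ d → ∀ p r → along c r ≡ along c p → along d r < along d p →
  ∃[ k ] 1 ℕ.≤ k × r ≡ p ⊞ k ⊡ vec (opp d)
on-ray-behind c d c⟂d p r same behind = k , 1≤k , ⟂-ext c d c⟂d
    (trans same (sym (along-ray-⟂ c (opp d) (⟂-oppʳ c d c⟂d) p k)))
    (sym (begin
      along d (p ⊞ k ⊡ vec (opp d))           ≡⟨ along-ray d p k (opp d) ⟩
      along d p + + k * along d (vec (opp d)) ≡⟨ cong₂ (λ s t → along d p + s * t) k≡ (along-opp d) ⟩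
      along d p + (along d p - along d r) * -1ℤ ≡⟨ cancel (along d p) (along d r) ⟩
      along d r                                ∎))
  where
  open ≡-Reasoning
  k = ∣ along d p - along d r ∣
  k≡ : + k ≡ along d p - along d r
  k≡ = ℤₚ.0≤i⇒+∣i∣≡i (ℤₚ.i≤j⇒0≤j-i (ℤₚ.<⇒≤ behind))
  1≤k : 1 ℕ.≤ k
  1≤k = drop‿+≤+ (subst (1ℤ ≤_) (sym k≡) (≤-by (ℤₚ.i<j⇒suc[i]≤j behind) (lem (along d p) (along d r))))
    where
    lem : ∀ a b → a - b - 1ℤ ≡ a - (1ℤ + b)
    lem = solve-∀
  cancel : ∀ a b → a + (a - b) * -1ℤ ≡ b
  cancel = solve-∀

-- Prudent trails

-- A trail is a walk listed from its last step to its first.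
Trail : Set
Trail = List Direction

pos : Trail → Point
pos []      = origin
pos (d ∷ w) = pos w ⊞ vec d

visited : Trail → List Point
visited []      = [ origin ]
visited (d ∷ w) = pos (d ∷ w) ∷ visited w

-- Self-avoidance is contained in the case `k` = 1, which says that the next site is new.
PrudentTrail : Trail → Set
PrudentTrail []      = ⊤
PrudentTrail (d ∷ w) = PrudentTrail w × (∀ k → 1 ℕ.≤ k → pos w ⊞ k ⊡ vec d ∉ visited w)

pos∈visited : ∀ w → pos w ∈ visited w
pos∈visited []      = here refl
pos∈visited (_ ∷ _) = here refl

origin∈visited : ∀ w → origin ∈ visited w
origin∈visited []      = here refl
origin∈visited (_ ∷ w) = there (origin∈visited w)

-- A step in direction d from the end of w enlarges the bounding box of w.
Inflates : Direction → Trail → Set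
Inflates d w = ∀ r → r ∈ visited w → along d r ≤ along d (pos w)

-- The negative answer carries a site strictly ahead, which later bounds the slide.
inflates? : ∀ d w → Inflates d w ⊎ (∃[ r ] r ∈ visited w × along d (pos w) < along d r)
inflates? d w = go (visited w)
  where
  go : ∀ rs → (∀ r → r ∈ rs → along d r ≤ along d (pos w)) ⊎ (∃[ r ] r ∈ rs × along d (pos w) < along d r)
  go []       = inj₁ λ _ ()
  go (r ∷ rs) with along d r ℤₚ.≤? along d (pos w) | go rs
  ... | no r≰ | _ = inj₂ (r , here refl , ℤₚ.≰⇒> r≰)
  ... | yes _ | inj₂ (r′ , r′∈ , lt) = inj₂ (r′ , there r′∈ , lt)
  ... | yes r≤ | inj₁ all = inj₁ λ { _ (here refl) → r≤ ; r′ (there r∈) → all r′ r∈ }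

pos-slide-⟂ : ∀ c d → c ⟂ d → ∀ i w → along c (pos (replicate i d ++ w)) ≡ along c (pos w)
pos-slide-⟂ c d c⟂d zero    w = refl
pos-slide-⟂ c d c⟂d (suc i) w = trans (along-step-⟂ c d c⟂d (pos (replicate i d ++ w))) (pos-slide-⟂ c d c⟂d i w)

pos-slide : ∀ c i w → along c (pos (replicate i c ++ w)) ≡ along c (pos w) + + i
pos-slide c zero    w = sym (ℤₚ.+-identityʳ _)
pos-slide c (suc i) w = trans (along-step c (pos (replicate i c ++ w)))
  (trans (cong (_+ 1ℤ) (pos-slide c i w)) (trans (ℤₚ.+-assoc (along c (pos w)) (+ i) 1ℤ)
    (cong (λ k → along c (pos w) + + k) (ℕₚ.+-comm i 1))))

i≤i+1 : ∀ i → i ≤ i + 1ℤ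
i≤i+1 i = ℤₚ.i≤i+j i 1ℤ

≤⇒<+1 : ∀ {i j} → i ≤ j → i < j + 1ℤ
≤⇒<+1 {i} {j} i≤j = ℤₚ.suc[i]≤j⇒i<j (≤-by i≤j (lem i j))
  where
  lem : ∀ i j → j + 1ℤ - (1ℤ + i) ≡ j - i
  lem = solve-∀

inflates-behind : ∀ c d → c ⟂ d → ∀ i w → Inflates d w → ∀ {r} → r ∈ visited w →
  along d r < along d (pos (replicate i c ++ d ∷ w))
inflates-behind c d c⟂d i w inf r∈ =
  subst (_ <_) (sym (trans (pos-slide-⟂ d c (⟂-sym c d c⟂d) i (d ∷ w)) (along-step d (pos w)))) (≤⇒<+1 (inf _ r∈))

-- The inflating step leaves all of `w` strictly behind, and the slide itself occupies only the new
-- line. A ray in the sliding direction then misses the old sites by its `d`-coordinate and the new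
-- ones by its `c`-coordinate.
slide-visited : ∀ c d → c ⟂ d → ∀ i w → Inflates d w → ∀ {r} → r ∈ visited (replicate i c ++ d ∷ w) →
  (r ∈ visited w × along d r < along d (pos (replicate i c ++ d ∷ w))) ⊎
  (along d r ≡ along d (pos (replicate i c ++ d ∷ w)) × along c r ≤ along c (pos (replicate i c ++ d ∷ w)))
slide-visited c d c⟂d zero    w inf (here refl) = inj₂ (refl , ℤₚ.≤-refl)
slide-visited c d c⟂d zero    w inf (there r∈)  = inj₁ (r∈ , inflates-behind c d c⟂d 0 w inf r∈)
slide-visited c d c⟂d (suc i) w inf (here refl) = inj₂ (refl , ℤₚ.≤-refl)
slide-visited c d c⟂d (suc i) w inf (there r∈)  with slide-visited c d c⟂d i w inf r∈
... | inj₁ (r∈w , lt) = inj₁ (r∈w , subst (_ <_)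
    (sym (along-step-⟂ d c (⟂-sym c d c⟂d) (pos (replicate i c ++ d ∷ w)))) lt)
... | inj₂ (eq , le) = inj₂
  ( trans eq (sym (along-step-⟂ d c (⟂-sym c d c⟂d) (pos (replicate i c ++ d ∷ w))))
  , ℤₚ.≤-trans le (subst (along c (pos (replicate i c ++ d ∷ w)) ≤_)
      (sym (along-step c (pos (replicate i c ++ d ∷ w)))) (ℤₚ.i≤i+j _ 1ℤ)))

i+j≰i : ∀ {a b} k → 1 ℕ.≤ k → b ≡ a + + k → ¬ b ≤ a
i+j≰i {a} (suc k) _ eq b≤a = contradiction (≤-by {c = + suc k} {d = 0ℤ} b≤a
    (trans (lem a (+ suc k)) (cong (_-_ a) (sym eq)))) λ { (+≤+ ()) }
  where
  lem : ∀ a k → 0ℤ - k ≡ a - (a + k)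
  lem = solve-∀

slide-prudent : ∀ c d → c ⟂ d → ∀ i w → PrudentTrail w → Inflates d w → PrudentTrail (replicate i c ++ d ∷ w)
slide-prudent c d c⟂d zero w pw inf = pw , λ k 1≤k r∈ →
  i+j≰i k 1≤k (along-ray-self d (pos w) k) (inf _ r∈)
slide-prudent c d c⟂d (suc i) w pw inf = slide-prudent c d c⟂d i w pw inf , λ k 1≤k r∈ →
    case slide-visited c d c⟂d i w inf r∈ of λ
  { (inj₁ (_ , lt)) → ℤₚ.<⇒≢ lt (along-ray-⟂ d c (⟂-sym c d c⟂d) _ k)
  ; (inj₂ (_ , le)) → i+j≰i k 1≤k (along-ray-self c (pos (replicate i c ++ d ∷ w)) k) le }

-- A discrete intermediate value theorem, followed backwards in time: a step lowers the coordinate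
-- by at most one, so undoing it raises the coordinate by at most one and no value is skipped.
visited-between : ∀ c w {r} m → r ∈ visited w → along c (pos w) ≤ m → m ≤ along c r →
  ∃[ s ] s ∈ visited w × along c s ≡ m
visited-between c w {r} m r∈ lo hi with along c (pos w) ℤₚ.≟ m
... | yes eq = pos w , pos∈visited w , eq
visited-between c [] m (here refl) lo hi | no neq = contradiction (ℤₚ.≤-antisym lo hi) neq
visited-between c (d ∷ w) m (here refl) lo hi | no neq = contradiction (ℤₚ.≤-antisym lo hi) neq
visited-between c (d ∷ w) m (there r∈) lo hi | no neq
  with visited-between c w m r∈ lo′ hi
  where
  lo′ : along c (pos w) ≤ m
  lo′ = ≤-by (ℤₚ.+-mono-≤ (ℤₚ.i<j⇒suc[i]≤j (ℤₚ.≤∧≢⇒< lo neq)) (along-≥-1 c d))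
    (trans (lem m (along c (pos w)) (along c (vec d)))
        (cong (λ t → m + along c (vec d) - (1ℤ + t + -1ℤ)) (sym (along-⊞ c (pos w) (vec d)))))
    where
    lem : ∀ m a t → m - a ≡ m + t - (1ℤ + (a + t) + -1ℤ)
    lem = solve-∀
... | s , s∈ , eq = s , there s∈ , eq

-- The site `farther` certifies that the slide has not left the bounding box of `before`: a step
-- leaving it would be inflating and would start a new decomposition. The same bound makes the
-- decomposition unique.
record Decomposition (w : Trail) : Set where
  constructor decomposition
  field
    count          : ℕ
    sliding last   : Direction
    before         : Trail
    splits         : w ≡ replicate count sliding ++ last ∷ before
    perpendicular  : sliding ⟂ last
    prudent-before : PrudentTrail before
    inflates       : Inflates last before
    farther        : Point
    farther∈       : farther ∈ visited before
    bounded        : along sliding (pos w) ≤ along sliding farther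

visited-++ : ∀ ds {w r} → r ∈ visited w → r ∈ visited (ds ++ w)
visited-++ []       r∈ = r∈
visited-++ (_ ∷ ds) r∈ = there (visited-++ ds r∈)

step-back : ∀ c d → c ⟂ d → ∀ p → p ⊞ vec c ⊞ 1 ⊡ vec (opp c) ≡ p
step-back c d c⟂d p = ⟂-ext c d c⟂d
  (trans (along-ray c (p ⊞ vec c) 1 (opp c)) (trans (cong₂ (λ s t → s + 1ℤ * t) (along-step c p) (along-opp c))
      (lem (along c p))))
  (trans (along-ray-⟂ d (opp c) (⟂-oppʳ d c (⟂-sym c d c⟂d)) (p ⊞ vec c) 1) (along-step-⟂ d c (⟂-sym c d c⟂d) p))
  where
  lem : ∀ a → a + 1ℤ + 1ℤ * -1ℤ ≡ a
  lem = solve-∀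

advance : ∀ c w {r} → along c (pos w) < along c r → along c (pos (c ∷ w)) ≤ along c r
advance c w ahead = subst (_≤ _) (trans (ℤₚ.+-comm 1ℤ (along c (pos w))) (sym (along-step c (pos w))))
    (ℤₚ.i<j⇒suc[i]≤j ahead)

-- Immediately after an inflating step the rest of the walk lies strictly
-- behind, so a non-inflating step can only slide along the new side of the
-- bounding box: every line pointing backwards meets the walk.
decompose-step : ∀ e w → PrudentTrail (e ∷ w) → Decomposition w → Decomposition (e ∷ w)
decompose-step e w (pw , free) D with inflates? e w
... | inj₁ inf = let c , c⟂e = ⟂-exists e in
  decomposition 0 c e w refl c⟂e pw inf (pos w) (pos∈visited w)
    (ℤₚ.≤-reflexive (along-step-⟂ c e c⟂e (pos w)))
decompose-step e w (pw , free) (decomposition i c d b refl c⟂d pb inf f f∈ f≥) | inj₂ (r , r∈ , ahead)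
  with ⟂-axes c d c⟂d e | slide-visited c d c⟂d i b inf r∈
... | here refl | inj₁ (_ , lt) = contradiction (ℤₚ.<-trans ahead lt) (ℤₚ.<-irrefl refl)
... | here refl | inj₂ (same , _) = contradiction (sym same) (ℤₚ.<⇒≢ ahead)
... | there (here refl) | _ = ray-blocked
  where
  lo : along c (pos b) ≤ along c (pos w)
  lo = subst₂ _≤_ (along-step-⟂ c d c⟂d (pos b)) (sym (pos-slide c i (d ∷ b)))
      (ℤₚ.i≤i+j (along c (pos (d ∷ b))) (+ i))
  -- Before the inflating step the walk had sites on both sides of the line through `pos w` in
  -- direction `d`, or on it: its end, where the slide began, and `farther`. Hence it has a site on
  -- that line.
  across = visited-between c b (along c (pos w)) f∈ lo f≥
  s = proj₁ across
  s∈b = proj₁ (proj₂ across)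
  ray = on-ray-behind c d c⟂d (pos w) s (proj₂ (proj₂ across)) (inflates-behind c d c⟂d i b inf s∈b)
  ray-blocked : Decomposition (opp d ∷ w)
  ray-blocked = ⊥-elim (free (proj₁ ray) (proj₁ (proj₂ ray))
    (subst (_∈ visited w) (proj₂ (proj₂ ray)) (visited-++ (replicate i c) (there s∈b))))
... | there (there (here refl)) | inj₁ (r∈b , _) =
  decomposition (suc i) c d b refl c⟂d pb inf r r∈b (advance c w ahead)
... | there (there (here refl)) | inj₂ (_ , le) = contradiction (ℤₚ.<-≤-trans ahead le) (ℤₚ.<-irrefl refl)
-- As long as the slide is empty, the choice between `c` and `opp c` is still open.
decompose-step e w (pw , free) (decomposition zero c d b refl c⟂d pb inf f f∈ f≥) | inj₂ (r , r∈ , ahead)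
  | there (there (there (here refl))) | inj₁ (r∈b , _) =
  decomposition 1 (opp c) d b refl (⟂-opp c d c⟂d) pb inf r r∈b (advance (opp c) w ahead)
decompose-step e w (pw , free) (decomposition zero c d b refl c⟂d pb inf f f∈ f≥) | inj₂ (r , here refl , ahead)
  | there (there (there (here refl))) | inj₂ _ = contradiction ahead (ℤₚ.<-irrefl refl)
decompose-step e w (pw , free) (decomposition zero c d b refl c⟂d pb inf f f∈ f≥) | inj₂ (r , there r∈b , ahead)
  | there (there (there (here refl))) | inj₂ _ =
  decomposition 1 (opp c) d b refl (⟂-opp c d c⟂d) pb inf r r∈b (advance (opp c) w ahead)
-- Once the slide has begun, reversing it would return to the preceding site.
decompose-step e w (pw , free) (decomposition (suc i) c d b refl c⟂d pb inf f f∈ f≥) | inj₂ (r , r∈ , ahead)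
  | there (there (there (here refl))) | _ =
  contradiction (there (subst (_∈ visited w′) (sym (step-back c d c⟂d (pos w′))) (pos∈visited w′))) (free 1 ℕₚ.≤-refl)
  where w′ = replicate i c ++ d ∷ b

decompose : ∀ d w → PrudentTrail (d ∷ w) → Decomposition (d ∷ w)
decompose d [] _ = let c , c⟂d = ⟂-exists d in
  decomposition 0 c d [] refl c⟂d tt (λ { _ (here refl) → ℤₚ.≤-refl }) origin (here refl)
    (ℤₚ.≤-reflexive (along-step-⟂ c d c⟂d origin))
decompose e (d ∷ w) p = decompose-step e (d ∷ w) p (decompose d w (proj₁ p))

-- Shapes of prudent walks in the half-plane x ≥ 0

-- The bounding box of a trail in the half-plane x ≥ 0 is
-- [0 , R] × [H − h , H].  Its sides carry positions numbered in the direction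
-- fwd: rightwards along the top N, downwards along E and W, leftwards along S.
fwd bwd : Direction → Direction
fwd N = E
fwd S = W
fwd E = S
fwd W = S
bwd d = opp (fwd d)

place : Direction → (R h H : ℕ) → ℕ → Point
place N R h H k = + k , + H
place S R h H k = + R - + k , + H - + h
place E R h H k = + R , + H - + k
place W R h H k = 0ℤ , + H - + k

side-length : Direction → ℕ → ℕ → ℕ
side-length N R h = R
side-length S R h = R
side-length E R h = h
side-length W R h = h

-- The maximum of `along d` over the bounding box. For `W` it is constantly 0, since the walk starts
-- on the boundary of the half-plane and never leaves it.
extent : Direction → (R h H : ℕ) → ℤ
extent N R h H = + H
extent S R h H = - (+ H - + h)
extent E R h H = + R
extent W R h H = 0ℤ

+suc : ∀ k → + suc k ≡ + k + 1ℤ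
+suc k = cong +_ (ℕₚ.+-comm 1 k)

fwd-⟂ : ∀ d → fwd d ⟂ d
fwd-⟂ N = refl
fwd-⟂ S = refl
fwd-⟂ E = refl
fwd-⟂ W = refl

minus-suc : ∀ m n → + m - + suc n ≡ + m - + n + -1ℤ
minus-suc m n = trans (cong (_-_ (+ m)) (+suc n)) (lem (+ m) (+ n))
  where
  lem : ∀ x y → x - (y + 1ℤ) ≡ x - y + -1ℤ
  lem = solve-∀

place-fwd : ∀ d R h H k → place d R h H (suc k) ≡ place d R h H k ⊞ vec (fwd d)
place-fwd N R h H k = cong₂ _,_ (+suc k) (sym (ℤₚ.+-identityʳ (+ H)))
place-fwd S R h H k = cong₂ _,_ (minus-suc R k) (sym (ℤₚ.+-identityʳ (+ H - + h)))
place-fwd E R h H k = cong₂ _,_ (sym (ℤₚ.+-identityʳ (+ R))) (minus-suc H k)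
place-fwd W R h H k = cong₂ _,_ refl (minus-suc H k)

⊞-opp : ∀ d p → p ⊞ vec d ⊞ vec (opp d) ≡ p
⊞-opp N p = cong₂ _,_ (trans (ℤₚ.+-identityʳ _) (ℤₚ.+-identityʳ _))
    (trans (ℤₚ.+-assoc (proj₂ p) 1ℤ -1ℤ) (ℤₚ.+-identityʳ _))
⊞-opp S p = cong₂ _,_ (trans (ℤₚ.+-identityʳ _) (ℤₚ.+-identityʳ _))
    (trans (ℤₚ.+-assoc (proj₂ p) -1ℤ 1ℤ) (ℤₚ.+-identityʳ _))
⊞-opp E p = cong₂ _,_ (trans (ℤₚ.+-assoc (proj₁ p) 1ℤ -1ℤ) (ℤₚ.+-identityʳ _))
    (trans (ℤₚ.+-identityʳ _) (ℤₚ.+-identityʳ _))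
⊞-opp W p = cong₂ _,_ (trans (ℤₚ.+-assoc (proj₁ p) -1ℤ 1ℤ) (ℤₚ.+-identityʳ _))
    (trans (ℤₚ.+-identityʳ _) (ℤₚ.+-identityʳ _))

place-bwd : ∀ d R h H k → place d R h H k ≡ place d R h H (suc k) ⊞ vec (bwd d)
place-bwd d R h H k = sym (trans (cong (_⊞ vec (bwd d)) (place-fwd d R h H k)) (⊞-opp (fwd d) (place d R h H k)))

-- Moves from position `e` to position `k` of a side: cancelling the common part of the two numbers
-- leaves the number of steps, and shows whether they go forwards or backwards.
slide : (f b : Direction) → ℕ → ℕ → Trail → Trail
slide f b (suc e) (suc k) w = slide f b e k w
slide f b zero    k       w = replicate k f ++ w
slide f b (suc e) zero    w = replicate (suc e) b ++ w

slide-fwd : ∀ f b e i w → slide f b e (e ℕ.+ i) w ≡ replicate i f ++ w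
slide-fwd f b zero    i w = refl
slide-fwd f b (suc e) i w = slide-fwd f b e i w

slide-bwd : ∀ f b i k w → slide f b (i ℕ.+ k) k w ≡ replicate i b ++ w
slide-bwd f b zero    zero    w = refl
slide-bwd f b zero    (suc k) w = slide-bwd f b zero k w
slide-bwd f b (suc i) zero    w = cong (λ e → replicate (suc e) b ++ w) (ℕₚ.+-identityʳ i)
slide-bwd f b (suc i) (suc k) w = trans (cong (λ e → slide f b e k w) (ℕₚ.+-suc i k)) (slide-bwd f b (suc i) k w)

data Slide (f b : Direction) (e k : ℕ) : Trail → Trail → Set where
  forth : ∀ i w → k ≡ e ℕ.+ i → Slide f b e k w (replicate i f ++ w)
  back  : ∀ i w → e ≡ i ℕ.+ k → Slide f b e k w (replicate i b ++ w)

slide-view : ∀ f b e k w → Slide f b e k w (slide f b e k w)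
slide-view f b e k w with ℕₚ.≤-total e k
... | inj₁ e≤k with ℕₚ.m≤n⇒∃[o]m+o≡n e≤k
...   | i , refl = subst (Slide f b e (e ℕ.+ i) w) (sym (slide-fwd f b e i w)) (forth i w refl)
slide-view f b e k w | inj₂ k≤e with ℕₚ.m≤n⇒∃[o]m+o≡n k≤e
...   | i , refl rewrite ℕₚ.+-comm k i = subst (Slide f b (i ℕ.+ k) k w) (sym (slide-bwd f b i k w)) (back i w refl)

-- A turn leaves side d at position x by a step d′, which becomes the new side,
-- entered at position y.
data Turn : (d : Direction) (R h x : ℕ) (d′ : Direction) (R′ h′ y : ℕ) → Set where
  nn : ∀ {R h k} → .(k ℕ.≤ R) → Turn N R h k N R (suc h) k
  en : ∀ {R h}   →               Turn E R h 0 N R (suc h) R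
  ne : ∀ {R h}   →               Turn N R h R E (suc R) h 0
  ee : ∀ {R h k} → .(k ℕ.≤ h) → Turn E R h k E (suc R) h k
  se : ∀ {R h}   →               Turn S R h 0 E (suc R) h h
  es : ∀ {R h}   →               Turn E R h h S R (suc h) 0
  ss : ∀ {R h k} → .(k ℕ.≤ R) → Turn S R h k S R (suc h) k

infixl 5 _▸_

-- The origin alone counts as a right side.
data Shape : Direction → ℕ → ℕ → Set where
  start : Shape E 0 0
  _▸_   : ∀ {d R h x d′ R′ h′ y} → Shape d R h → Turn d R h x d′ R′ h′ y → Shape d′ R′ h′

rise : Direction → ℕ → ℕ
rise N H = suc H
rise S H = H
rise E H = H
rise W H = H

-- The ordinate of the top side relative to the origin. It is not an index of `Shape`, since the
-- series record only width and height.
top : ∀ {d R h} → Shape d R h → ℕ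
top start              = 0
top (_▸_ {d′ = d′} s t) = rise d′ (top s)

entry : ∀ {d R h} → Shape d R h → ℕ
entry start           = 0
entry (_▸_ {y = y} s t) = y

-- `base` ends right after the last inflating step, `at` adds the slide to position `k`; both have
-- the same bounding box.
base : ∀ {d R h} → Shape d R h → Trail
at   : ∀ {d R h} → Shape d R h → ℕ → Trail
base start                     = []
base (_▸_ {x = x} {d′ = d′} s t) = d′ ∷ at s x
at {d} s k = slide (fwd d) (bwd d) (entry s) k (base s)

-- The bounds stored in turns are irrelevant, so that equality of shapes does not involve them;
-- being decidable, they can be recovered where a proof is required.
recompute-≤ : ∀ {m n} → .(m ℕ.≤ n) → m ℕ.≤ n
recompute-≤ {m} {n} m≤n = recompute (m ℕₚ.≤? n) m≤n

neg-≤ : ∀ {m n} → m ℕ.≤ n → - + n ≤ - + m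
neg-≤ m≤n = ℤₚ.neg-mono-≤ (+≤+ m≤n)

widen heighten : Direction → ℕ → ℕ
widen N R = R
widen S R = R
widen E R = suc R
widen W R = R
heighten N h = suc h
heighten S h = suc h
heighten E h = h
heighten W h = h

suc-cancel : ∀ m n → + suc m - + suc n ≡ + m - + n
suc-cancel m n = trans (cong₂ _-_ (+suc m) (+suc n)) (lem (+ m) (+ n))
  where
  lem : ∀ a b → a + 1ℤ - (b + 1ℤ) ≡ a - b
  lem = solve-∀

extent-⟂ : ∀ d c → c ⟂ d → ∀ R h H → extent c (widen d R) (heighten d h) (rise d H) ≡ extent c R h H
extent-⟂ N N ()
extent-⟂ N S ()
extent-⟂ N E _ R h H = refl
extent-⟂ N W _ R h H = refl
extent-⟂ S N ()
extent-⟂ S S ()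
extent-⟂ S E _ R h H = refl
extent-⟂ S W _ R h H = refl
extent-⟂ E N _ R h H = refl
extent-⟂ E S _ R h H = refl
extent-⟂ E E ()
extent-⟂ E W ()
extent-⟂ W N _ R h H = refl
extent-⟂ W S _ R h H = refl
extent-⟂ W E ()
extent-⟂ W W ()

extent-opp : ∀ d R h H → extent (opp d) (widen d R) (heighten d h) (rise d H) ≡ extent (opp d) R h H
extent-opp N R h H = cong -_ (suc-cancel H h)
extent-opp S R h H = refl
extent-opp E R h H = refl
extent-opp W R h H = refl

extent-self : ∀ d R h H → d ≢ W → extent d (widen d R) (heighten d h) (rise d H) ≡ extent d R h H + 1ℤ
extent-self N R h H _ = +suc H
extent-self S R h H _ = trans (cong (λ t → - (+ H - t)) (+suc h)) (lem (+ H) (+ h))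
  where
  lem : ∀ a b → - (a - (b + 1ℤ)) ≡ - (a - b) + 1ℤ
  lem = solve-∀
extent-self E R h H _ = +suc R
extent-self W R h H d≢W = contradiction refl d≢W

module _ {d d′ : Direction} {R h x R′ h′ y : ℕ} where

  exit≤ : Turn d R h x d′ R′ h′ y → x ℕ.≤ side-length d R h
  exit≤ (nn k≤R) = recompute-≤ k≤R
  exit≤ en       = z≤n
  exit≤ ne       = ℕₚ.≤-refl
  exit≤ (ee k≤h) = recompute-≤ k≤h
  exit≤ se       = z≤n
  exit≤ es       = ℕₚ.≤-refl
  exit≤ (ss k≤R) = recompute-≤ k≤R

  entry≤ : Turn d R h x d′ R′ h′ y → y ℕ.≤ side-length d′ R′ h′
  entry≤ (nn k≤R) = recompute-≤ k≤R
  entry≤ en       = ℕₚ.≤-refl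
  entry≤ ne       = z≤n
  entry≤ (ee k≤h) = recompute-≤ k≤h
  entry≤ se       = ℕₚ.≤-refl
  entry≤ es       = z≤n
  entry≤ (ss k≤R) = recompute-≤ k≤R

  turn-place : ∀ H → Turn d R h x d′ R′ h′ y → place d′ R′ h′ (rise d′ H) y ≡ place d R h H x ⊞ vec d′
  turn-place H (nn _) = cong₂ _,_ (sym (ℤₚ.+-identityʳ (+ x))) (+suc H)
  turn-place H en     = cong₂ _,_ (sym (ℤₚ.+-identityʳ (+ R)))
      (trans (+suc H) (cong (_+ 1ℤ) (sym (ℤₚ.+-identityʳ (+ H)))))
  turn-place H ne     = cong₂ _,_ (+suc R) refl
  turn-place H (ee _) = cong₂ _,_ (+suc R) (sym (ℤₚ.+-identityʳ (+ H - + x)))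
  turn-place H se     = cong₂ _,_ (trans (+suc R) (cong (_+ 1ℤ) (sym (ℤₚ.+-identityʳ (+ R)))))
      (sym (ℤₚ.+-identityʳ (+ H - + h)))
  turn-place H es     = cong₂ _,_ refl (minus-suc H h)
  turn-place H (ss _) = cong₂ _,_ (sym (ℤₚ.+-identityʳ (+ R - + x))) (minus-suc H h)

  turn-extreme : ∀ H → Turn d R h x d′ R′ h′ y → extent d′ R h H ≡ along d′ (place d R h H x)
  turn-extreme H (nn _) = refl
  turn-extreme H en     = sym (ℤₚ.+-identityʳ _)
  turn-extreme H ne     = refl
  turn-extreme H (ee _) = refl
  turn-extreme H se     = sym (ℤₚ.+-identityʳ _)
  turn-extreme H es     = refl
  turn-extreme H (ss _) = refl

  turn-grows : Turn d R h x d′ R′ h′ y → R′ ≡ widen d′ R × h′ ≡ heighten d′ h × d′ ≢ W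
  turn-grows (nn _) = refl , refl , λ ()
  turn-grows en     = refl , refl , λ ()
  turn-grows ne     = refl , refl , λ ()
  turn-grows (ee _) = refl , refl , λ ()
  turn-grows se     = refl , refl , λ ()
  turn-grows es     = refl , refl , λ ()
  turn-grows (ss _) = refl , refl , λ ()

  extent-grows : ∀ H → Turn d R h x d′ R′ h′ y → ∀ c → extent c R h H ≤ extent c R′ h′ (rise d′ H)
  extent-grows H t c with turn-grows t
  ... | refl , refl , d′≢W with fwd-⟂ d′
  ... | f⟂d with ⟂-axes (fwd d′) d′ f⟂d c
  ... | here refl                         = subst (extent d′ R h H ≤_) (sym (extent-self d′ R h H d′≢W))
      (i≤i+1 (extent d′ R h H))
  ... | there (here refl)                 = ℤₚ.≤-reflexive (sym (extent-opp d′ R h H))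
  ... | there (there (here refl))         = ℤₚ.≤-reflexive (sym (extent-⟂ d′ (fwd d′) f⟂d R h H))
  ... | there (there (there (here refl))) = ℤₚ.≤-reflexive (sym (extent-⟂ d′ (bwd d′) (⟂-opp (fwd d′) d′ f⟂d) R h H))

pos-forth : ∀ d R h H e i w → pos w ≡ place d R h H e → pos (replicate i (fwd d) ++ w) ≡ place d R h H (e ℕ.+ i)
pos-forth d R h H e zero    w at-e = trans at-e (cong (place d R h H) (sym (ℕₚ.+-identityʳ e)))
pos-forth d R h H e (suc i) w at-e = trans (cong (_⊞ vec (fwd d)) (pos-forth d R h H e i w at-e))
  (trans (sym (place-fwd d R h H (e ℕ.+ i))) (cong (place d R h H) (sym (ℕₚ.+-suc e i))))

pos-back : ∀ d R h H k i w → pos w ≡ place d R h H (i ℕ.+ k) → pos (replicate i (bwd d) ++ w) ≡ place d R h H k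
pos-back d R h H k zero    w at-e = at-e
pos-back d R h H k (suc i) w at-e =
  trans (cong (_⊞ vec (bwd d)) (pos-back d R h H (suc k) i w
      (trans at-e (cong (place d R h H) (sym (ℕₚ.+-suc i k))))))
    (sym (place-bwd d R h H k))

visited-forth : ∀ d R h H e i w {L} → pos w ≡ place d R h H e → e ℕ.+ i ℕ.≤ L →
  ∀ {r} → r ∈ visited (replicate i (fwd d) ++ w) → r ∈ visited w ⊎ (∃[ j ] j ℕ.≤ L × r ≡ place d R h H j)
visited-forth d R h H e zero    w at-e ≤L r∈          = inj₁ r∈
visited-forth d R h H e (suc i) w at-e ≤L (here refl) = inj₂ (e ℕ.+ suc i , ≤L , pos-forth d R h H e (suc i) w at-e)
visited-forth d R h H e (suc i) w at-e ≤L (there r∈)  =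
  visited-forth d R h H e i w at-e (ℕₚ.≤-trans (ℕₚ.+-monoʳ-≤ e (ℕₚ.n≤1+n i)) ≤L) r∈

visited-back : ∀ d R h H k i w {L} → pos w ≡ place d R h H (i ℕ.+ k) → i ℕ.+ k ℕ.≤ L →
  ∀ {r} → r ∈ visited (replicate i (bwd d) ++ w) → r ∈ visited w ⊎ (∃[ j ] j ℕ.≤ L × r ≡ place d R h H j)
visited-back d R h H k zero    w at-e ≤L r∈          = inj₁ r∈
visited-back d R h H k (suc i) w at-e ≤L (here refl) =
  inj₂ (k , ℕₚ.≤-trans (ℕₚ.m≤n+m k (suc i)) ≤L , pos-back d R h H k (suc i) w at-e)
visited-back d R h H k (suc i) w {L} at-e ≤L (there r∈)  =
  visited-back d R h H (suc k) i w (trans at-e (cong (place d R h H) (sym (ℕₚ.+-suc i k))))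
      (subst (ℕ._≤ L) (sym (ℕₚ.+-suc i k)) ≤L) r∈

pos-slide-place : ∀ d R h H e k w → pos w ≡ place d R h H e → pos (slide (fwd d) (bwd d) e k w) ≡ place d R h H k
pos-slide-place d R h H e k w at-e with slide (fwd d) (bwd d) e k w | slide-view (fwd d) (bwd d) e k w
... | _ | forth i w refl = pos-forth d R h H e i w at-e
... | _ | back i w refl  = pos-back d R h H k i w at-e

visited-slide : ∀ d R h H e k w {L} → pos w ≡ place d R h H e → e ℕ.≤ L → k ℕ.≤ L →
  ∀ {r} → r ∈ visited (slide (fwd d) (bwd d) e k w) → r ∈ visited w ⊎ (∃[ j ] j ℕ.≤ L × r ≡ place d R h H j)
visited-slide d R h H e k w at-e e≤L k≤L r∈ with slide (fwd d) (bwd d) e k w | slide-view (fwd d) (bwd d) e k w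
... | _ | forth i w refl = visited-forth d R h H e i w at-e k≤L r∈
... | _ | back i w refl  = visited-back d R h H k i w at-e e≤L r∈

visited-slide⁺ : ∀ f b e k w {r} → r ∈ visited w → r ∈ visited (slide f b e k w)
visited-slide⁺ f b e k w r∈ with slide f b e k w | slide-view f b e k w
... | _ | forth i w refl = visited-++ (replicate i f) r∈
... | _ | back i w refl  = visited-++ (replicate i b) r∈

pos-base : ∀ {d R h} (s : Shape d R h) → pos (base s) ≡ place d R h (top s) (entry s)
pos-at   : ∀ {d R h} (s : Shape d R h) k → pos (at s k) ≡ place d R h (top s) k
pos-base start           = refl
pos-base (_▸_ {x = x} {d′} s t) = trans (cong (_⊞ vec d′) (pos-at s x)) (sym (turn-place (top s) t))
pos-at {d} {R} {h} s k = pos-slide-place d R h (top s) (entry s) k (base s) (pos-base s)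

0≤m-n : ∀ {m n} → n ℕ.≤ m → 0ℤ ≤ + m - + n
0≤m-n n≤m = ℤₚ.i≤j⇒0≤j-i (+≤+ n≤m)

m-n≤m : ∀ m n → + m - + n ≤ + m
m-n≤m m n = ℤₚ.i-j≤i (+ m) (+ n)

m-n≤m-k : ∀ m {n k} → k ℕ.≤ n → + m - + n ≤ + m - + k
m-n≤m-k m k≤n = ℤₚ.+-monoʳ-≤ (+ m) (neg-≤ k≤n)

place-bounded : ∀ c d R h H k → k ℕ.≤ side-length d R h → along c (place d R h H k) ≤ extent c R h H
place-bounded N N R h H k k≤ = ℤₚ.≤-refl
place-bounded S N R h H k k≤ = ℤₚ.neg-mono-≤ (m-n≤m H h)
place-bounded E N R h H k k≤ = +≤+ k≤
place-bounded W N R h H k k≤ = ℤₚ.neg-mono-≤ (0≤+ k)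
place-bounded N S R h H k k≤ = m-n≤m H h
place-bounded S S R h H k k≤ = ℤₚ.≤-refl
place-bounded E S R h H k k≤ = m-n≤m R k
place-bounded W S R h H k k≤ = ℤₚ.neg-mono-≤ (0≤m-n k≤)
place-bounded N E R h H k k≤ = m-n≤m H k
place-bounded S E R h H k k≤ = ℤₚ.neg-mono-≤ (m-n≤m-k H k≤)
place-bounded E E R h H k k≤ = ℤₚ.≤-refl
place-bounded W E R h H k k≤ = ℤₚ.neg-mono-≤ (0≤+ R)
place-bounded N W R h H k k≤ = m-n≤m H k
place-bounded S W R h H k k≤ = ℤₚ.neg-mono-≤ (m-n≤m-k H k≤)
place-bounded E W R h H k k≤ = 0≤+ R
place-bounded W W R h H k k≤ = ℤₚ.≤-refl

place-on-side : ∀ d R h H k → along d (place d R h H k) ≡ extent d R h H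
place-on-side N R h H k = refl
place-on-side S R h H k = refl
place-on-side E R h H k = refl
place-on-side W R h H k = refl

entry≤-shape : ∀ {d R h} (s : Shape d R h) → entry s ℕ.≤ side-length d R h
entry≤-shape start   = z≤n
entry≤-shape (s ▸ t) = entry≤ t

bounded-base : ∀ {d R h} (s : Shape d R h) c {r} → r ∈ visited (base s) → along c r ≤ extent c R h (top s)
bounded-at   : ∀ {d R h} (s : Shape d R h) {k} → k ℕ.≤ side-length d R h → ∀ c {r} →
  r ∈ visited (at s k) → along c r ≤ extent c R h (top s)
bounded-base start   N (here refl) = ℤₚ.≤-refl
bounded-base start   S (here refl) = ℤₚ.≤-refl
bounded-base start   E (here refl) = ℤₚ.≤-refl
bounded-base start   W (here refl) = ℤₚ.≤-refl
bounded-base {R = R} {h} (_▸_ {d′ = d′} {y = y} s t) c (here refl) =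
  subst (λ p → along c p ≤ extent c R h (rise d′ (top s))) (sym (pos-base (s ▸ t)))
      (place-bounded c d′ R h (rise d′ (top s)) y (entry≤ t))
bounded-base (s ▸ t) c (there r∈)  = ℤₚ.≤-trans (bounded-at s (exit≤ t) c r∈) (extent-grows (top s) t c)
bounded-at {d} {R} {h} s {k} k≤ c r∈
  with visited-slide d R h (top s) (entry s) k (base s) (pos-base s) (entry≤-shape s) k≤ r∈
... | inj₁ r∈base = bounded-base s c r∈base
... | inj₂ (j , j≤ , refl) = place-bounded c d R h (top s) j j≤

turn-extent-⟂ : ∀ {d R h x d′ R′ h′ y} H → Turn d R h x d′ R′ h′ y → ∀ c → c ⟂ d′ → extent c R′ h′ (rise d′ H) ≡
    extent c R h H
turn-extent-⟂ {R = R} {h} {d′ = d′} H t c c⟂d with turn-grows t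
... | refl , refl , _ = extent-⟂ d′ c c⟂d R h H

turn-extent-opp : ∀ {d R h x d′ R′ h′ y} H → Turn d R h x d′ R′ h′ y → extent (opp d′) R′ h′ (rise d′ H) ≡
    extent (opp d′) R h H
turn-extent-opp {R = R} {h} {d′ = d′} H t with turn-grows t
... | refl , refl , _ = extent-opp d′ R h H

base⊆at : ∀ {d R h} (s : Shape d R h) k {r} → r ∈ visited (base s) → r ∈ visited (at s k)
base⊆at {d} s k = visited-slide⁺ (fwd d) (bwd d) (entry s) k (base s)

-- All four sides of the box are already touched before the final slide: the new one by the
-- inflating step, the others by induction. The box is therefore the same for all positions on the
-- side.
attained : ∀ {d R h} (s : Shape d R h) c → ∃[ r ] r ∈ visited (base s) × along c r ≡ extent c R h (top s)
attained start N = origin , here refl , refl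
attained start S = origin , here refl , refl
attained start E = origin , here refl , refl
attained start W = origin , here refl , refl
attained {R = R} {h} (_▸_ {x = x} {d′ = d′} {y = y} s t) c with ⟂-axes (fwd d′) d′ (fwd-⟂ d′) c
... | here refl = pos (base (s ▸ t)) , here refl ,
  trans (cong (along d′) (pos-base (s ▸ t))) (place-on-side d′ R h (rise d′ (top s)) y)
... | there (here refl) = let r , r∈ , eq = attained s c in
  r , there (base⊆at s x r∈) , trans eq (sym (turn-extent-opp (top s) t))
... | there (there (here refl)) = let r , r∈ , eq = attained s c in
  r , there (base⊆at s x r∈) , trans eq (sym (turn-extent-⟂ (top s) t c (fwd-⟂ d′)))
... | there (there (there (here refl))) = let r , r∈ , eq = attained s c in
  r , there (base⊆at s x r∈) , trans eq (sym (turn-extent-⟂ (top s) t c (⟂-opp (fwd d′) d′ (fwd-⟂ d′))))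

inflates-at : ∀ {d R h} (s : Shape d R h) {k} → k ℕ.≤ side-length d R h → ∀ c →
  extent c R h (top s) ≤ along c (place d R h (top s) k) → Inflates c (at s k)
inflates-at s {k} k≤ c le _ r∈ = ℤₚ.≤-trans (bounded-at s k≤ c r∈) (subst (λ p → _ ≤ along c p) (sym (pos-at s k)) le)

inflates-turn : ∀ {d R h x d′ R′ h′ y} (s : Shape d R h) (t : Turn d R h x d′ R′ h′ y) → Inflates d′ (at s x)
inflates-turn {d′ = d′} s t = inflates-at s (exit≤ t) d′ (ℤₚ.≤-reflexive (turn-extreme (top s) t))

prudent-at : ∀ {d R h} (s : Shape d R h) {k} → k ℕ.≤ side-length d R h → PrudentTrail (at s k)
prudent-at start z≤n = tt
prudent-at (_▸_ {x = x} {d′ = d} {y = y} s t) {k} _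
  with slide (fwd d) (bwd d) y k (d ∷ at s x) | slide-view (fwd d) (bwd d) y k (d ∷ at s x)
... | _ | forth i _ _ = slide-prudent (fwd d) d (fwd-⟂ d) i (at s x) (prudent-at s (exit≤ t)) (inflates-turn s t)
... | _ | back i _ _  = slide-prudent (bwd d) d (⟂-opp (fwd d) d (fwd-⟂ d)) i (at s x) (prudent-at s (exit≤ t))
    (inflates-turn s t)

slid-not-inflating : ∀ c i d b {f} → f ∈ visited b →
  along c (pos (replicate (suc i) c ++ d ∷ b)) ≤ along c f → ¬ Inflates c (replicate i c ++ d ∷ b)
slid-not-inflating c i d b {f} f∈ bound inf =
  i+j≰i 1 ℕₚ.≤-refl (along-step c (pos (replicate i c ++ d ∷ b)))
    (ℤₚ.≤-trans bound (inf f (visited-++ (replicate i c) (there f∈))))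

-- A bounded slide contains no inflating step, so the last inflating step can be recognised from the
-- trail alone. When both slides are nonempty their last steps agree and are removed together;
-- `shrink` preserves the bound.
decomposition-unique : ∀ i i′ c c′ d d′ b b′ {f f′} → replicate i c ++ d ∷ b ≡ replicate i′ c′ ++ d′ ∷ b′ →
  Inflates d b → Inflates d′ b′ →
  f ∈ visited b → along c (pos (replicate i c ++ d ∷ b)) ≤ along c f →
  f′ ∈ visited b′ → along c′ (pos (replicate i′ c′ ++ d′ ∷ b′)) ≤ along c′ f′ →
  d ≡ d′ × b ≡ b′
decomposition-unique zero zero c c′ d d′ b b′ refl _ _ _ _ _ _ = refl , refl
decomposition-unique zero (suc i′) c c′ d d′ b b′ refl inf _ _ _ f′∈ bound′ =
  contradiction inf (slid-not-inflating d i′ d′ b′ f′∈ bound′)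
decomposition-unique (suc i) zero c c′ d d′ b b′ refl _ inf′ f∈ bound _ _ =
  contradiction inf′ (slid-not-inflating d′ i d b f∈ bound)
decomposition-unique (suc i) (suc i′) c c′ d d′ b b′ eq inf inf′ f∈ bound f′∈ bound′ with Listₚ.∷-injective eq
... | refl , eq′ = decomposition-unique i i′ c c′ d d′ b b′ eq′ inf inf′ f∈ (shrink i d b bound) f′∈
    (shrink i′ d′ b′ bound′)
  where
  shrink : ∀ i d b {f} → along c (pos (replicate (suc i) c ++ d ∷ b)) ≤ along c f →
      along c (pos (replicate i c ++ d ∷ b)) ≤ along c f
  shrink i d b = ℤₚ.≤-trans (subst (along c (pos (replicate i c ++ d ∷ b)) ≤_)
      (sym (along-step c (pos (replicate i c ++ d ∷ b)))) (i≤i+1 (along c (pos (replicate i c ++ d ∷ b)))))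

record SlideForm (d : Direction) (b w : Trail) : Set where
  constructor slide-form
  field
    {count}   : ℕ
    {sliding} : Direction
    splits    : w ≡ replicate count sliding ++ d ∷ b
    farther   : Point
    farther∈  : farther ∈ visited b
    bounded   : along sliding (pos w) ≤ along sliding farther

at-form : ∀ {d R h x d′ R′ h′ y} (s : Shape d R h) (t : Turn d R h x d′ R′ h′ y) {k} → k ℕ.≤ side-length d′ R′ h′ →
  SlideForm d′ (at s x) (at (s ▸ t) k)
at-form {R = R} {h} {x = x} {d′} {R′} {h′} {y = y} s t {k} k≤ =
    from-view (slide-view (fwd d′) (bwd d′) y k (d′ ∷ at s x)) refl
  where
  bound : ∀ c → c ⟂ d′ → ∃[ f ] f ∈ visited (at s x) × along c (pos (at (s ▸ t) k)) ≤ along c f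
  bound c c⟂ = let f , f∈ , eq = attained s c in f , base⊆at s x f∈ ,
    subst₂ _≤_ (cong (along c) (sym (pos-at (s ▸ t) k))) (trans (turn-extent-⟂ (top s) t c c⟂) (sym eq))
      (place-bounded c d′ R′ h′ (rise d′ (top s)) k k≤)
  from-view : ∀ {w} → Slide (fwd d′) (bwd d′) y k (d′ ∷ at s x) w → at (s ▸ t) k ≡ w →
      SlideForm d′ (at s x) (at (s ▸ t) k)
  from-view (forth i _ _) eq = let f , f∈ , le = bound (fwd d′) (fwd-⟂ d′) in slide-form eq f f∈ le
  from-view (back i _ _)  eq = let f , f∈ , le = bound (bwd d′) (⟂-opp (fwd d′) d′ (fwd-⟂ d′)) in slide-form eq f f∈ le

-- Packs the indices away, so that shapes with different sides and boxes can be compared by an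
-- ordinary equality.
data Marked : Set where
  marked : ∀ {d R h} → Shape d R h → ℕ → Marked

minus-cancel : ∀ a {b c} → a - b ≡ a - c → b ≡ c
minus-cancel a {b} {c} eq = trans (sym (lem a b)) (trans (cong (_-_ a) eq) (lem a c))
  where
  lem : ∀ a b → a - (a - b) ≡ b
  lem = solve-∀

place-injective : ∀ d R h H {j k} → place d R h H j ≡ place d R h H k → j ≡ k
place-injective N R h H eq = ℤₚ.+-injective (cong proj₁ eq)
place-injective S R h H eq = ℤₚ.+-injective (minus-cancel (+ R) (cong proj₁ eq))
place-injective E R h H eq = ℤₚ.+-injective (minus-cancel (+ H) (cong proj₂ eq))
place-injective W R h H eq = ℤₚ.+-injective (minus-cancel (+ H) (cong proj₂ eq))

turn-unique : ∀ {d R h x d′ R₁ h₁ y₁ R₂ h₂ y₂} (s : Shape d R h) (t₁ : Turn d R h x d′ R₁ h₁ y₁)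
    (t₂ : Turn d R h x d′ R₂ h₂ y₂) k →
  marked (s ▸ t₁) k ≡ marked (s ▸ t₂) k
turn-unique s (nn _) (nn _) k = refl
turn-unique s en en k = refl
turn-unique s ne ne k = refl
turn-unique s (ee _) (ee _) k = refl
turn-unique s se se k = refl
turn-unique s es es k = refl
turn-unique s (ss _) (ss _) k = refl

at-nonempty : ∀ {d R h x d′ R′ h′ y} (s : Shape d R h) (t : Turn d R h x d′ R′ h′ y) k → at (s ▸ t) k ≢ []
at-nonempty {x = x} {d′} {y = y} s t k eq
  with slide (fwd d′) (bwd d′) y k (d′ ∷ at s x) | slide-view (fwd d′) (bwd d′) y k (d′ ∷ at s x) 
at-nonempty s t k () | _ | forth zero _ _
at-nonempty s t k () | _ | forth (suc _) _ _
at-nonempty s t k () | _ | back zero _ _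
at-nonempty s t k () | _ | back (suc _) _ _

-- The trail determines its last inflating step and what precedes it; by induction that gives the
-- earlier shape and the exit position, which with the direction determine the turn. The endpoint
-- then gives the position.
at-injective : ∀ {d R h d′ R′ h′} (s : Shape d R h) (s′ : Shape d′ R′ h′) {k k′} →
  k ℕ.≤ side-length d R h → k′ ℕ.≤ side-length d′ R′ h′ → at s k ≡ at s′ k′ → marked s k ≡ marked s′ k′
at-injective start start z≤n z≤n eq = refl
at-injective start (s ▸ t) {k′ = k′} z≤n _ eq = contradiction (sym eq) (at-nonempty s t k′)
at-injective (s ▸ t) start {k} _ z≤n eq = contradiction eq (at-nonempty s t k)
at-injective (_▸_ {x = x} {d′} s₁ t₁) (_▸_ {x = x′} {d″} s₂ t₂) {k} {k′} k≤ k′≤ eq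
  with at-form s₁ t₁ k≤ | at-form s₂ t₂ k′≤
... | slide-form {i} {c} eq₁ f₁ f₁∈ b₁ | slide-form {i′} {c′} eq₂ f₂ f₂∈ b₂
  with decomposition-unique i i′ c c′ d′ d″ (at s₁ x) (at s₂ x′) (trans (sym eq₁) (trans eq eq₂))
         (inflates-turn s₁ t₁) (inflates-turn s₂ t₂)
         f₁∈ (subst (λ w → along c (pos w) ≤ along c f₁) eq₁ b₁)
         f₂∈ (subst (λ w → along c′ (pos w) ≤ along c′ f₂) eq₂ b₂)
... | refl , eqᵇ with at-injective s₁ s₂ (exit≤ t₁) (exit≤ t₂) eqᵇ
... | refl with turn-grows t₁ | turn-grows t₂
... | refl , refl , _ | refl , refl , _
  with place-injective d′ _ _ (rise d′ (top s₁))
      (trans (sym (pos-at (s₁ ▸ t₁) k)) (trans (cong pos eq) (pos-at (s₂ ▸ t₂) k′)))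
... | refl = turn-unique s₁ t₁ t₂ k

abstract
  ⟂-fwd-bwd : ∀ c d → c ⟂ d → c ≡ fwd d ⊎ c ≡ bwd d
  ⟂-fwd-bwd = from-yes (∀-direction? λ c → ∀-direction? λ d → (c ⟂? d) →-dec ((c ≟ᵈ fwd d) ⊎-dec (c ≟ᵈ bwd d)))

m≤m-n⇒n≡0 : ∀ m n → + m ≤ + m - + n → n ≡ 0
m≤m-n⇒n≡0 m n le = ℕₚ.n≤0⇒n≡0 (drop‿+≤+ (≤-by le (lem (+ m) (+ n))))
  where
  lem : ∀ a b → 0ℤ - b ≡ a - b - a
  lem = solve-∀

k-m≤k-n⇒m≤n : ∀ k m n → - (k - + m) ≤ - (k - + n) → m ℕ.≤ n
k-m≤k-n⇒m≤n k m n le = drop‿+≤+ (≤-by le (lem k (+ m) (+ n)))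
  where
  lem : ∀ k a b → b - a ≡ - (k - b) - - (k - a)
  lem = solve-∀

-- Separates top from bottom, so that no step can lead outwards through the opposite side.
shape-height : ∀ {d R h} → Shape d R h → d ⟂ E → h ≢ 0
shape-height start ()
shape-height (s ▸ nn _) _ ()
shape-height (s ▸ en)   _ ()
shape-height (s ▸ ne)   ()
shape-height (s ▸ ee _) ()
shape-height (s ▸ se)   ()
shape-height (s ▸ es)   _ ()
shape-height (s ▸ ss _) _ ()

no-left-shape : ∀ {R h} → ¬ Shape W R h
no-left-shape (_ ▸ ())

TurnTo : Direction → (R h x : ℕ) → Direction → Set
TurnTo d R h x d′ = ∃[ R′ ] ∃[ h′ ] ∃[ y ] Turn d R h x d′ R′ h′ y

-- An inflating step starts on the side it points to. This leaves every position if the side is the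
-- current one, a corner if it is a neighbouring one, and nothing if it is the opposite one, as the
-- height is positive.
turn-exists : ∀ {d R h} → Shape d R h → ∀ H x → x ℕ.≤ side-length d R h → ∀ d′ → d′ ≢ W →
  extent d′ R h H ≤ along d′ (place d R h H x) → TurnTo d R h x d′
turn-exists {W} s H x x≤ d′ _ le = contradiction s no-left-shape
turn-exists s H x x≤ W d′≢W le = contradiction refl d′≢W
turn-exists {N} s H x x≤ N _ le = _ , _ , _ , nn x≤
turn-exists {N} {h = h} s H x x≤ S _ le = contradiction (ℕₚ.n≤0⇒n≡0 (k-m≤k-n⇒m≤n (+ H) h 0
  (subst (λ t → - (+ H - + h) ≤ - t) (sym (ℤₚ.+-identityʳ (+ H))) le))) (shape-height s refl)
turn-exists {N} s H x x≤ E _ le with ℕₚ.≤-antisym x≤ (drop‿+≤+ le)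
... | refl = _ , _ , _ , ne
turn-exists {S} {h = h} s H x x≤ N _ le = contradiction (m≤m-n⇒n≡0 H h le) (shape-height s refl)
turn-exists {S} s H x x≤ S _ le = _ , _ , _ , ss x≤
turn-exists {S} {R} s H x x≤ E _ le with m≤m-n⇒n≡0 R x le
... | refl = _ , _ , _ , se
turn-exists {E} s H x x≤ N _ le with m≤m-n⇒n≡0 H x le
... | refl = _ , _ , _ , en
turn-exists {E} {h = h} s H x x≤ S _ le with ℕₚ.≤-antisym x≤ (k-m≤k-n⇒m≤n (+ H) h x le)
... | refl = _ , _ , _ , es
turn-exists {E} s H x x≤ E _ le = _ , _ , _ , ee x≤

fwd-bound : ∀ d R h H j → along (fwd d) (place d R h H j) ≤ extent (fwd d) R h H → j ℕ.≤ side-length d R h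
fwd-bound N R h H j le = drop‿+≤+ le
fwd-bound S R h H j le = drop‿+≤+ (≤-by le (lem (+ R) (+ j)))
  where
  lem : ∀ a b → a - b ≡ 0ℤ - - (a - b)
  lem = solve-∀
fwd-bound E R h H j le = drop‿+≤+ (≤-by le (lem (+ H) (+ h) (+ j)))
  where
  lem : ∀ H a b → a - b ≡ - (H - a) - - (H - b)
  lem = solve-∀
fwd-bound W R h H j le = drop‿+≤+ (≤-by le (lem (+ H) (+ h) (+ j)))
  where
  lem : ∀ H a b → a - b ≡ - (H - a) - - (H - b)
  lem = solve-∀

m-n+k≤m : ∀ m n k → + m - + n + + k ≤ + m → k ℕ.≤ n
m-n+k≤m m n k le = drop‿+≤+ (≤-by le (lem (+ m) (+ n) (+ k)))
  where
  lem : ∀ m n k → n - k ≡ m - (m - n + k)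
  lem = solve-∀

bwd-bound : ∀ d R h H y i → along (bwd d) (place d R h H y) + + i ≤ extent (bwd d) R h H → i ℕ.≤ y
bwd-bound N R h H y i le = drop‿+≤+ (≤-by le (lem (+ y) (+ i)))
  where
  lem : ∀ y i → y - i ≡ 0ℤ - (- y + i)
  lem = solve-∀
bwd-bound S R h H y i le = m-n+k≤m R y i le
bwd-bound E R h H y i le = m-n+k≤m H y i le
bwd-bound W R h H y i le = m-n+k≤m H y i le

record Shaped (w : Trail) : Set where
  constructor shaped
  field
    {side}         : Direction
    {right height} : ℕ
    shape          : Shape side right height
    position       : ℕ
    position≤      : position ℕ.≤ side-length side right height
    trail≡         : w ≡ at shape position

RightHalfPlane : Trail → Set
RightHalfPlane w = ∀ r → r ∈ visited w → 0ℤ ≤ proj₁ r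

slide-shaped : ∀ {d R h x d′ R′ h′ y} (s : Shape d R h) (t : Turn d R h x d′ R′ h′ y) c i → c ⟂ d′ →
  along c (pos (replicate i c ++ d′ ∷ at s x)) ≤ extent c R h (top s) → Shaped (replicate i c ++ d′ ∷ at s x)
slide-shaped {R = R} {h} {x = x} {d′} {R′} {h′} {y} s t c i c⟂ le with ⟂-fwd-bwd c d′ c⟂
... | inj₁ refl = shaped (s ▸ t) (y ℕ.+ i)
  (fwd-bound d′ R′ h′ (rise d′ (top s)) (y ℕ.+ i)
    (subst₂ _≤_ (cong (along c) (pos-forth d′ R′ h′ (rise d′ (top s)) y i (d′ ∷ at s x) (pos-base (s ▸ t))))
      (sym (turn-extent-⟂ (top s) t c c⟂)) le))
  (sym (slide-fwd (fwd d′) (bwd d′) y i (d′ ∷ at s x)))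
... | inj₂ refl = shaped (s ▸ t) (y ∸ i) (ℕₚ.≤-trans (ℕₚ.m∸n≤m y i) (entry≤ t))
  (trans (sym (slide-bwd (fwd d′) (bwd d′) i (y ∸ i) (d′ ∷ at s x)))
    (cong (λ e → slide (fwd d′) (bwd d′) e (y ∸ i) (d′ ∷ at s x)) (ℕₚ.m+[n∸m]≡n i≤y)))
  where
  i≤y : i ℕ.≤ y
  i≤y = bwd-bound d′ R′ h′ (rise d′ (top s)) y i
    (subst₂ _≤_ (trans (pos-slide c i (d′ ∷ at s x)) (cong (λ p → along c p + + i) (pos-base (s ▸ t))))
      (sym (turn-extent-⟂ (top s) t c c⟂)) le)

inflates-W-pos : ∀ b → Inflates W b → proj₁ (pos b) ≤ 0ℤ
inflates-W-pos b inf = ℤₚ.neg-cancel-≤ (inf origin (origin∈visited b))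

inflates-extent : ∀ {d R h} (s : Shape d R h) x c → Inflates c (at s x) →
    extent c R h (top s) ≤ along c (place d R h (top s) x)
inflates-extent s x c inf = let r , r∈ , eq = attained s c in
  subst₂ _≤_ eq (cong (along c) (pos-at s x)) (inf r (base⊆at s x r∈))

decomposition-shaped : ∀ {w} (D : Decomposition w) → RightHalfPlane w →
  (RightHalfPlane (Decomposition.before D) → Shaped (Decomposition.before D)) → Shaped w
decomposition-shaped (decomposition i c d b refl c⟂d pb inf f f∈ f≥) half before-shaped
  with before-shaped (λ r r∈ → half r (visited-++ (replicate i c) (there r∈)))
... | shaped s x x≤ refl with turn-exists s (top s) x x≤ d d≢W (inflates-extent s x d inf)
  where
  -- Since the origin has been visited, a west-inflating step starts at abscissa at most 0 and would
  -- leave the half-plane.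
  d≢W : d ≢ W
  d≢W refl = contradiction (ℤₚ.≤-trans (half (pos (W ∷ b)) (visited-++ (replicate i c) (here refl)))
    (ℤₚ.+-monoˡ-≤ -1ℤ (inflates-W-pos b inf))) λ ()
... | R′ , h′ , y , t = slide-shaped s t c i c⟂d (ℤₚ.≤-trans f≥ (bounded-at s x≤ c f∈))

-- The bound `n` on the length drives the recursion, because `before` is not a structural part of
-- the trail.
prudent-shaped : ∀ n w → length w ℕ.≤ n → PrudentTrail w → RightHalfPlane w → Shaped w
prudent-shaped n       []      _         _ _    = shaped start 0 z≤n refl
prudent-shaped (suc n) (e ∷ w) (s≤s len) p half = decomposition-shaped D half
  (prudent-shaped n before (ℕₚ.≤-trans shorter len) prudent-before)
  where
  D = decompose e w p
  open Decomposition D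
  shorter : length before ℕ.≤ length w
  shorter = ℕₚ.≤-pred (subst (suc (length before) ℕ.≤_)
      (sym (trans (cong length splits) (Listₚ.length-++ (replicate count sliding))))
    (ℕₚ.m≤n+m (suc (length before)) (length (replicate count sliding))))

-- The last run of a polygon descends the line x = -1.
close : ∀ {R h} → Shape N R h → Trail
close s = replicate (top s) S ++ W ∷ at s 0

close-inflates : ∀ {R h} (s : Shape N R h) → Inflates W (at s 0)
close-inflates s = inflates-at s z≤n W ℤₚ.≤-refl

close-prudent : ∀ {R h} (s : Shape N R h) → PrudentTrail (close s)
close-prudent s = slide-prudent S W refl (top s) (at s 0) (prudent-at s z≤n) (close-inflates s)

pos-close : ∀ {R h} (s : Shape N R h) → pos (close s) ≡ (-1ℤ , 0ℤ)
pos-close s = cong₂ _,_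
  (trans (pos-slide-⟂ E S refl (top s) (W ∷ at s 0)) (cong (λ p → proj₁ p + -1ℤ) (pos-at s 0)))
  (ℤₚ.neg-injective (trans (pos-slide S (top s) (W ∷ at s 0))
    (trans (cong (λ p → - (proj₂ p + 0ℤ) + + top s) (pos-at s 0)) (lem (+ top s)))))
  where
  lem : ∀ a → - (a + 0ℤ) + a ≡ - 0ℤ
  lem = solve-∀

west-inflation : ∀ d → 1ℤ ≤ along d (-1ℤ , 0ℤ) → d ≡ W
west-inflation N (+≤+ ())
west-inflation S (+≤+ ())
west-inflation E ()
west-inflation W _ = refl

ClosedShape : Trail → Set
ClosedShape w = ∃[ R ] ∃[ h ] Σ[ s ∈ Shape N R h ] w ≡ close s

-- Only the top-left corner is possible: the right side has positive abscissa unless it is the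
-- origin itself, and the bottom side is not above the origin, so that no further descent from it
-- ends at ordinate 0.
shape-closed : ∀ {d R h x} (s : Shape d R h) i → x ℕ.≤ side-length d R h →
  proj₁ (place d R h (top s) x) ≡ 0ℤ → - proj₂ (place d R h (top s) x) + + suc i ≡ 0ℤ →
  ClosedShape (replicate (suc i) S ++ W ∷ at s x)
shape-closed {N} {R} {h} s i x≤ x≡0 y≡0 with ℤₚ.+-injective x≡0
... | refl = R , h , s , cong (λ n → replicate n S ++ W ∷ at s 0)
    (ℤₚ.+-injective (trans (lem (+ top s) (+ suc i)) (trans (cong (_+_ (+ top s)) y≡0) (ℤₚ.+-identityʳ (+ top s)))))
  where
  lem : ∀ a b → b ≡ a + (- a + b)
  lem = solve-∀
shape-closed start i z≤n _ ()
shape-closed {E} (s ▸ t) i x≤ x≡0 y≡0 with turn-grows t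
shape-closed {E} (s ▸ t) i x≤ () y≡0 | refl , refl , _
shape-closed {S} s i x≤ x≡0 y≡0 = contradiction
  (subst (1ℤ ≤_) y≡0 (ℤₚ.+-mono-≤ (bounded-base s S (origin∈visited (base s))) (+≤+ (s≤s (z≤n {i})))))
  λ { (+≤+ ()) }
shape-closed {W} s _ _ _ _ = contradiction s no-left-shape

-- The last inflating step goes beyond the origin, so (-1 , 0) lies at distance at least 1 in its
-- direction, which must be `W`. The final step south then belongs to the slide.
decomposition-closed : ∀ {w′} → Decomposition w′ → pos w′ ≡ (-1ℤ , 0ℤ) → ∀ w → w′ ≡ S ∷ w → ClosedShape w′
decomposition-closed (decomposition i c d b refl c⟂d pb inf f f∈ f≥) end w eq with west-inflation d (subst (1ℤ ≤_)
    (trans (sym (trans (pos-slide-⟂ d c (⟂-sym c d c⟂d) i (d ∷ b)) (along-step d (pos b)))) (cong (along d) end))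
    (ℤₚ.+-monoˡ-≤ 1ℤ (subst (_≤ along d (pos b)) (along-origin d) (inf origin (origin∈visited b)))))
  where
  along-origin : ∀ d → along d origin ≡ 0ℤ
  along-origin N = refl
  along-origin S = refl
  along-origin E = refl
  along-origin W = refl
decomposition-closed (decomposition zero c _ b refl c⟂d pb inf f f∈ f≥) end w () | refl
decomposition-closed (decomposition (suc i) c _ b refl c⟂d pb inf f f∈ f≥) end w eq | refl
  with refl ← Listₚ.∷-injectiveˡ eq = from-shape (prudent-shaped (length b) b ℕₚ.≤-refl pb half)
  where
  x≡0 : proj₁ (pos b) ≡ 0ℤ
  x≡0 = trans (lem (proj₁ (pos b))) (cong (_+ 1ℤ)
      (trans (sym (pos-slide-⟂ E S refl (suc i) (W ∷ b))) (cong proj₁ end)))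
    where
    lem : ∀ x → x ≡ x + -1ℤ + 1ℤ
    lem = solve-∀
  y≡0 : - proj₂ (pos b) + + suc i ≡ 0ℤ
  y≡0 = trans (cong (λ y → - y + + suc i) (sym (ℤₚ.+-identityʳ (proj₂ (pos b)))))
    (trans (sym (pos-slide S (suc i) (W ∷ b))) (cong (along S) end))
  -- As `W` inflates, the least abscissa in `b` is that of its end, namely 0.
  half : RightHalfPlane b
  half r r∈ = ℤₚ.neg-cancel-≤ (subst (λ x → - proj₁ r ≤ - x) x≡0 (inf r r∈))
  from-shape : Shaped b → ClosedShape (replicate (suc i) S ++ W ∷ b)
  from-shape (shaped s x x≤ refl) = shape-closed s i x≤
    (trans (cong proj₁ (sym (pos-at s x))) x≡0)
    (trans (cong (λ p → - proj₂ p + + suc i) (sym (pos-at s x))) y≡0)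

west-closed : ∀ w → PrudentTrail (S ∷ w) → pos (S ∷ w) ≡ (-1ℤ , 0ℤ) → ClosedShape (S ∷ w)
west-closed w p end = decomposition-closed (decompose S w p) end w refl

-- Winding numbers and enclosed cells

-- The crossing number of the edge from (a , b) to (a , b + 1).
upward : ℤ → ℤ → Cell → ℤ
upward a b (x , y) = if does (x ℤₚ.<? a) then (if does (b ℤₚ.≟ y) then 1ℤ else 0ℤ) else 0ℤ

pred-suc : ∀ i → i + -1ℤ + 1ℤ ≡ i
pred-suc = solve-∀

suc≢ : ∀ i → i ≢ 1ℤ + i
suc≢ i eq = ℤₚ.<⇒≢ (ℤₚ.suc[i]≤j⇒i<j {i} {1ℤ + i} ℤₚ.≤-refl) eq

crossing-N : ∀ c p → crossing c (p , p ⊞ vec N) ≡ upward (proj₁ p) (proj₂ p) c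
crossing-N (x , y) (a , b) with x ℤₚ.<? a
... | no _ = refl
... | yes _ with b ℤₚ.≟ y | b + 1ℤ ℤₚ.≟ ℤ.suc y | b ℤₚ.≟ ℤ.suc y | b + 1ℤ ℤₚ.≟ y
... | yes _    | yes _ | _       | _        = refl
... | yes refl | no ≢  | _       | _        = contradiction (ℤₚ.+-comm b 1ℤ) ≢
... | no _     | _     | no _    | _        = refl
... | no _     | _     | yes _   | no _     = refl
... | no _     | _     | yes b≡  | yes refl = contradiction (trans b≡ (lem b)) (ℤₚ.<⇒≢ (lt b))
  where
  lem : ∀ b → 1ℤ + (b + 1ℤ) ≡ b + + 2
  lem = solve-∀
  lt : ∀ b → b < b + + 2
  lt b = <-by {0ℤ} {+ 2} (ℤ.+<+ (s≤s z≤n)) (lem′ b)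
    where
    lem′ : ∀ b → b + + 2 - b ≡ + 2 - 0ℤ
    lem′ = solve-∀

crossing-reverse : ∀ c a b a′ b′ → crossing c ((a , b′) , (a′ , b)) ≡ - crossing c ((a , b) , (a′ , b′))
crossing-reverse (x , y) a b a′ b′ with x ℤₚ.<? a
... | no _ = refl
... | yes _ with b ℤₚ.≟ y | b ℤₚ.≟ ℤ.suc y | b′ ℤₚ.≟ y | b′ ℤₚ.≟ ℤ.suc y
... | yes refl | yes b≡ | _        | _      = contradiction b≡ (suc≢ b)
... | _        | _      | yes refl | yes b≡ = contradiction b≡ (suc≢ b′)
... | yes _    | no _   | yes _    | no _   = refl
... | yes _    | no _   | no _     | yes _  = refl
... | yes _    | no _   | no _     | no _   = refl
... | no _     | yes _  | yes _    | no _   = refl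
... | no _     | yes _  | no _     | yes _  = refl
... | no _     | yes _  | no _     | no _   = refl
... | no _     | no _   | yes _    | no _   = refl
... | no _     | no _   | no _     | yes _  = refl
... | no _     | no _   | no _     | no _   = refl

crossing-S : ∀ c p → crossing c (p , p ⊞ vec S) ≡ - upward (proj₁ p) (proj₂ p + -1ℤ) c
crossing-S c (a , b) = trans (crossing-reverse c a (b + -1ℤ) a b)
  (cong -_ (trans (cong (λ b′ → crossing c ((a , b + -1ℤ) , (a , b′))) (sym (pred-suc b)))
      (crossing-N c (a , b + -1ℤ))))

crossing-level : ∀ c a b a′ b′ → b′ ≡ b → crossing c ((a , b) , (a′ , b′)) ≡ 0ℤ
crossing-level (x , y) a b a′ b′ refl with x ℤₚ.<? a
... | no _ = refl
... | yes _ with b ℤₚ.≟ y | b ℤₚ.≟ ℤ.suc y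
... | yes refl | yes b≡ = contradiction b≡ (suc≢ b)
... | yes _    | no _  = refl
... | no _     | yes _ = refl
... | no _     | no _  = refl

δ : Cell → Cell → ℤ
δ (a , b) (x , y) = if does (a ℤₚ.≟ x) ∧ does (b ℤₚ.≟ y) then 1ℤ else 0ℤ

-- A discrete Green's formula for a single edge: moving it one unit east sweeps the cell between its
-- two positions. All areas below are sums of such contributions.
upward-step : ∀ a b c → upward (a + 1ℤ) b c ≡ upward a b c + δ (a , b) c
upward-step a b (x , y) with x ℤₚ.<? a + 1ℤ | x ℤₚ.<? a | a ℤₚ.≟ x
... | yes _ | yes x<a | yes refl = contradiction x<a (ℤₚ.<-irrefl refl)
... | yes _ | yes _   | no _     = sym (ℤₚ.+-identityʳ _)
... | yes _ | no _    | yes _    = sym (ℤₚ.+-identityˡ _)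
... | yes x<a+1 | no x≮a | no a≢x = contradiction (ℤₚ.≤-antisym (ℤₚ.≮⇒≥ x≮a) x≤a) a≢x
  where
  x≤a : x ≤ a
  x≤a = ≤-by (ℤₚ.i<j⇒suc[i]≤j x<a+1) (lem a x)
    where
    lem : ∀ a x → a - x ≡ a + 1ℤ - (1ℤ + x)
    lem = solve-∀
... | no ≮ | yes x<a | _ = contradiction (≤⇒<+1 (ℤₚ.<⇒≤ x<a)) ≮
... | no ≮ | no _ | yes refl = contradiction (≤⇒<+1 ℤₚ.≤-refl) ≮
... | no _ | no _ | no _ = refl

multiplicity : List Cell → Cell → ℤ
multiplicity []       c = 0ℤ
multiplicity (a ∷ as) c = δ a c + multiplicity as c

multiplicity-++ : ∀ as bs c → multiplicity (as ++ bs) c ≡ multiplicity as c + multiplicity bs c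
multiplicity-++ []       bs c = sym (ℤₚ.+-identityˡ _)
multiplicity-++ (a ∷ as) bs c = trans (cong (_+_ (δ a c)) (multiplicity-++ as bs c))
    (sym (ℤₚ.+-assoc (δ a c) (multiplicity as c) (multiplicity bs c)))

δ-self : ∀ c → δ c c ≡ 1ℤ
δ-self (x , y) with x ℤₚ.≟ x | y ℤₚ.≟ y
... | yes _ | yes _ = refl
... | no ≢  | _     = contradiction refl ≢
... | yes _ | no ≢  = contradiction refl ≢

δ-≢ : ∀ a c → a ≢ c → δ a c ≡ 0ℤ
δ-≢ (a , b) (x , y) a≢c with a ℤₚ.≟ x | b ℤₚ.≟ y
... | yes refl | yes refl = contradiction refl a≢c
... | yes _    | no _     = refl
... | no _     | yes _    = refl
... | no _     | no _     = refl

multiplicity-∉ : ∀ as c → c ∉ as → multiplicity as c ≡ 0ℤ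
multiplicity-∉ []       c c∉ = refl
multiplicity-∉ (a ∷ as) c c∉ = cong₂ _+_ (δ-≢ a c λ eq → c∉ (here (sym eq))) (multiplicity-∉ as c (c∉ ∘ there))

multiplicity-∈ : ∀ {as c} → Unique as → c ∈ as → multiplicity as c ≡ 1ℤ
multiplicity-∈ {a ∷ as} (a∉ ∷ _) (here refl) = cong₂ _+_ (δ-self a) (multiplicity-∉ as a λ a∈ → All.lookup a∉ a∈ refl)
multiplicity-∈ {a ∷ as} {c} (a∉ ∷ unique) (there c∈) =
    cong₂ _+_ (δ-≢ a c (All.lookup a∉ c∈)) (multiplicity-∈ unique c∈)

horizontal vertical : ℤ → ℤ → ℕ → List Cell
horizontal x y = applyDownFrom (λ t → x + + t , y)
vertical   x y = applyDownFrom (λ t → x , y - + t)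

horizontal-unique : ∀ x y m → Unique (horizontal x y m)
horizontal-unique x y m = Uniqueₚ.applyDownFrom⁺₁ _ m λ j<i _ eq →
  ℕₚ.<⇒≢ j<i (sym (ℤₚ.+-injective (plus-cancel x (cong proj₁ eq))))
  where
  plus-cancel : ∀ a {b c} → a + b ≡ a + c → b ≡ c
  plus-cancel a {b} {c} eq = trans (lem a b) (trans (cong (_- a) eq) (sym (lem a c)))
    where
    lem : ∀ a b → b ≡ a + b - a
    lem = solve-∀

vertical-unique : ∀ x y m → Unique (vertical x y m)
vertical-unique x y m = Uniqueₚ.applyDownFrom⁺₁ _ m λ j<i _ eq →
  ℕₚ.<⇒≢ j<i (sym (ℤₚ.+-injective (minus-cancel y (cong proj₂ eq))))

upward-horizontal : ∀ x y m c → upward (x + + m) y c ≡ upward x y c + multiplicity (horizontal x y m) c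
upward-horizontal x y zero    c = trans (cong (λ t → upward t y c) (ℤₚ.+-identityʳ x)) (sym (ℤₚ.+-identityʳ _))
upward-horizontal x y (suc m) c = begin
  upward (x + + suc m) y c                             ≡⟨ cong (λ t → upward t y c)
      (trans (cong (_+_ x) (+suc m)) (sym (ℤₚ.+-assoc x (+ m) 1ℤ))) ⟩
  upward (x + + m + 1ℤ) y c                            ≡⟨ upward-step (x + + m) y c ⟩
  upward (x + + m) y c + δ (x + + m , y) c             ≡⟨ cong (_+ δ (x + + m , y) c) (upward-horizontal x y m c) ⟩
  upward x y c + multiplicity (horizontal x y m) c + δ (x + + m , y) c ≡⟨ lem (upward x y c) _ _ ⟩
  upward x y c + (δ (x + + m , y) c + multiplicity (horizontal x y m) c) ∎
  where
  open ≡-Reasoning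
  lem : ∀ a b d → a + b + d ≡ a + (d + b)
  lem = solve-∀

-- The crossing number of an ascent of `m` steps along the line of abscissa `a`, whose topmost edge
-- starts at ordinate `y`.
climb : ℤ → ℤ → ℕ → Cell → ℤ
climb a y zero    c = 0ℤ
climb a y (suc m) c = upward a (y - + m) c + climb a y m c

climb-vertical : ∀ a y m c → climb (a + 1ℤ) y m c ≡ climb a y m c + multiplicity (vertical a y m) c
climb-vertical a y zero    c = refl
climb-vertical a y (suc m) c = trans (cong₂ _+_ (upward-step a (y - + m) c) (climb-vertical a y m c))
  (lem (upward a (y - + m) c) (δ (a , y - + m) c) (climb a y m c) (multiplicity (vertical a y m) c))
  where
  lem : ∀ p d k m → p + d + (k + m) ≡ p + k + (d + m)
  lem = solve-∀

winding : Trail → Cell → ℤ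
winding []      c = 0ℤ
winding (d ∷ w) c = winding w c + crossing c (pos w , pos w ⊞ vec d)

-- Minus the crossing number of the final descent from (-1 , H) to (-1 , 0).
descend : ℕ → Cell → ℤ
descend zero    c = 0ℤ
descend (suc H) c = descend H c + upward -1ℤ (+ H) c

-- The top, right side and height of the bounding box once the walk is closed.
closed-top closed-right closed-height : Direction → ℕ → ℕ
closed-top N H    = H
closed-top _ H    = suc H
closed-right S R  = suc R
closed-right _ R  = R
closed-height N h = h
closed-height _ h = suc h

-- The cells gained by a turn, when the polygon is closed up afterwards by
-- the shortest admissible walk.
added : ∀ {d R h x d′ R′ h′ y} → Turn d R h x d′ R′ h′ y → ℕ → List Cell
added (nn {k = k} _)         H = horizontal -1ℤ (+ H) (suc k)
added en                     H = []
added (ne {R})               H = horizontal -1ℤ (+ H) (suc (suc R))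
added (ee {R} {k = k} _)     H = vertical (+ R) (+ H) (suc k)
added se                     H = []
added (es {R} {h})           H = vertical (+ R) (+ H) (suc (suc h))
added (ss {R} {h} {k} _)     H = horizontal (+ R - + k) (+ H - + suc h) (suc k)

cells : ∀ {d R h} → Shape d R h → List Cell
cells start   = [ -1ℤ , 0ℤ ]
cells (s ▸ t) = added t (top s) ++ cells s

-- The contribution of the part of the boundary following a trail at position
-- k of its last side, up to the final descent.
completion : Direction → (R h H k : ℕ) → Cell → ℤ
completion N R h H k c = 0ℤ
completion S R h H k c = climb (+ R + 1ℤ) (+ H) (suc h) c
completion E R h H k c = climb (+ R) (+ H) (suc k) c
completion W R h H k c = 0ℤ

-- The crossing number of the walk continued by its closing route up to the final descent. It does
-- not depend on `k`: each vertical sliding step changes the walk and the route by opposite amounts,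
-- and horizontal ones contribute nothing.
potential : ∀ {d R h} → Shape d R h → ℕ → Cell → ℤ
potential {d} {R} {h} s k c = winding (at s k) c + completion d R h (top s) k c

crossing-⟂ : ∀ d → d ⟂ N → ∀ c p → crossing c (p , p ⊞ vec d) ≡ 0ℤ
crossing-⟂ E _ c p = crossing-level c (proj₁ p) (proj₂ p) (proj₁ p + 1ℤ) (proj₂ p + 0ℤ) (ℤₚ.+-identityʳ (proj₂ p))
crossing-⟂ W _ c p = crossing-level c (proj₁ p) (proj₂ p) (proj₁ p + -1ℤ) (proj₂ p + 0ℤ) (ℤₚ.+-identityʳ (proj₂ p))
crossing-⟂ N ()
crossing-⟂ S ()

winding-level : ∀ d → d ⟂ N → ∀ w c → winding (d ∷ w) c ≡ winding w c
winding-level d d⟂N w c = trans (cong (_+_ (winding w c)) (crossing-⟂ d d⟂N c (pos w))) (ℤₚ.+-identityʳ (winding w c))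

winding-N : ∀ w c {a b} → pos w ≡ (a , b) → winding (N ∷ w) c ≡ winding w c + upward a b c
winding-N w c refl = cong (_+_ (winding w c)) (crossing-N c (pos w))

winding-S : ∀ w c {a b} → pos w ≡ (a , b) → winding (S ∷ w) c ≡ winding w c - upward a (b + -1ℤ) c
winding-S w c refl = cong (_+_ (winding w c)) (crossing-S c (pos w))

potential-fwd : ∀ d R h H k w c → d ≢ W → pos w ≡ place d R h H k →
  winding (fwd d ∷ w) c + completion d R h H (suc k) c ≡ winding w c + completion d R h H k c
potential-fwd N R h H k w c _ at-k = cong (_+ 0ℤ) (winding-level E refl w c)
potential-fwd S R h H k w c _ at-k = cong (_+ completion S R h H k c) (winding-level W refl w c)
potential-fwd E R h H k w c _ at-k = begin
  winding (S ∷ w) c + (upward (+ R) (+ H - + suc k) c + climb (+ R) (+ H) (suc k) c)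
    ≡⟨ cong₂ (λ s t → s + (upward (+ R) t c + climb (+ R) (+ H) (suc k) c)) (winding-S w c at-k) (minus-suc H k) ⟩
  winding w c - upward (+ R) (+ H - + k + -1ℤ) c + (upward (+ R) (+ H - + k + -1ℤ) c + climb (+ R) (+ H) (suc k) c)
    ≡⟨ lem (winding w c) (upward (+ R) (+ H - + k + -1ℤ) c) (climb (+ R) (+ H) (suc k) c) ⟩
  winding w c + climb (+ R) (+ H) (suc k) c ∎
  where
  open ≡-Reasoning
  lem : ∀ w u k → w - u + (u + k) ≡ w + k
  lem = solve-∀
potential-fwd W R h H k w c d≢W _ = contradiction refl d≢W

potential-bwd : ∀ d R h H k w c → d ≢ W → pos w ≡ place d R h H (suc k) →
  winding (bwd d ∷ w) c + completion d R h H k c ≡ winding w c + completion d R h H (suc k) c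
potential-bwd N R h H k w c _ at-k = cong (_+ 0ℤ) (winding-level W refl w c)
potential-bwd S R h H k w c _ at-k = cong (_+ completion S R h H k c) (winding-level E refl w c)
potential-bwd E R h H k w c _ at-k = trans (cong (_+ climb (+ R) (+ H) (suc k) c) (winding-N w c at-k))
  (ℤₚ.+-assoc (winding w c) (upward (+ R) (+ H - + suc k) c) (climb (+ R) (+ H) (suc k) c))
potential-bwd W R h H k w c d≢W _ = contradiction refl d≢W

potential-forth : ∀ d R h H e i w c → d ≢ W → pos w ≡ place d R h H e →
  winding (replicate i (fwd d) ++ w) c + completion d R h H (e ℕ.+ i) c ≡ winding w c + completion d R h H e c
potential-forth d R h H e zero w c d≢W at-e = cong (λ k → winding w c + completion d R h H k c) (ℕₚ.+-identityʳ e)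
potential-forth d R h H e (suc i) w c d≢W at-e =
  trans (cong (λ k → winding (replicate (suc i) (fwd d) ++ w) c + completion d R h H k c) (ℕₚ.+-suc e i))
    (trans (potential-fwd d R h H (e ℕ.+ i) (replicate i (fwd d) ++ w) c d≢W (pos-forth d R h H e i w at-e))
      (potential-forth d R h H e i w c d≢W at-e))

potential-back : ∀ d R h H k i w c → d ≢ W → pos w ≡ place d R h H (i ℕ.+ k) →
  winding (replicate i (bwd d) ++ w) c + completion d R h H k c ≡ winding w c + completion d R h H (i ℕ.+ k) c
potential-back d R h H k zero    w c d≢W at-e = refl
potential-back d R h H k (suc i) w c d≢W at-e =
  trans (potential-bwd d R h H k (replicate i (bwd d) ++ w) c d≢W (pos-back d R h H (suc k) i w at-e′))
    (trans (potential-back d R h H (suc k) i w c d≢W at-e′)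
      (cong (λ k → winding w c + completion d R h H k c) (ℕₚ.+-suc i k)))
  where
  at-e′ = trans at-e (cong (place d R h H) (sym (ℕₚ.+-suc i k)))

shape-side : ∀ {d R h} → Shape d R h → d ≢ W
shape-side s refl = no-left-shape s

potential-at : ∀ {d R h} (s : Shape d R h) k c →
  potential s k c ≡ winding (base s) c + completion d R h (top s) (entry s) c
potential-at {d} {R} {h} s k c with at s k | slide-view (fwd d) (bwd d) (entry s) k (base s)
... | _ | forth i _ refl = potential-forth d R h (top s) (entry s) i (base s) c (shape-side s) (pos-base s)
... | _ | back i _ eq = trans (potential-back d R h (top s) k i (base s) c (shape-side s)
    (trans (pos-base s) (cong (place d R h (top s)) eq)))
  (cong (λ k → winding (base s) c + completion d R h (top s) k c) (sym eq))

row-step : ∀ x y m c {a} → a ≡ x + + m → upward a y c ≡ upward x y c + multiplicity (horizontal x y m) c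
row-step x y m c refl = upward-horizontal x y m c

-- The old and the new closing route differ by the boundary of the cells in `added`. The two
-- `descend` terms, written crosswise to avoid subtraction, account for the change of height at
-- which the final descent begins.
potential-turn : ∀ {d R h x d′ R′ h′ y} (s : Shape d R h) (t : Turn d R h x d′ R′ h′ y) c →
  winding (base (s ▸ t)) c + completion d′ R′ h′ (rise d′ (top s)) y c + descend (closed-top d (top s)) c
  ≡ potential s x c + descend (closed-top d′ (rise d′ (top s))) c + multiplicity (added t (top s)) c
potential-turn {R = R} {h} {x} s (nn _) c = trans
  (cong (λ z → z + 0ℤ + D) (trans (winding-N (at s x) c (pos-at s x))
      (cong (_+_ w) (row-step -1ℤ (+ H) (suc x) c refl))))
  (lem w (upward -1ℤ (+ H) c) (multiplicity (horizontal -1ℤ (+ H) (suc x)) c) D)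
  where
  H = top s
  w = winding (at s x) c
  D = descend H c
  lem : ∀ w u m D → w + (u + m) + 0ℤ + D ≡ w + 0ℤ + (D + u) + m
  lem = solve-∀
potential-turn {R = R} {h} {x} s en c = trans
  (cong (λ z → z + 0ℤ + D) (winding-N (at s x) c (pos-at s x)))
  (lem (winding (at s x) c) (upward (+ R) (+ top s - + 0) c) D)
  where
  D = descend (suc (top s)) c
  lem : ∀ w u D → w + u + 0ℤ + D ≡ w + (u + 0ℤ) + D + 0ℤ
  lem = solve-∀
potential-turn {R = R} {h} {x} s ne c = trans
  (cong₂ (λ z z′ → z + (z′ + 0ℤ) + D) (winding-level E refl (at s x) c)
    (trans (cong (λ y → upward (+ suc R) y c) (ℤₚ.+-identityʳ (+ H))) (row-step -1ℤ (+ H) (suc (suc R)) c refl)))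
  (lem (winding (at s x) c) (upward -1ℤ (+ H) c) (multiplicity (horizontal -1ℤ (+ H) (suc (suc R))) c) D)
  where
  H = top s
  D = descend H c
  lem : ∀ w u m D → w + (u + m + 0ℤ) + D ≡ w + 0ℤ + (D + u) + m
  lem = solve-∀
potential-turn {R = R} {h} {x} s (ee _) c = trans
  (cong₂ (λ z z′ → z + z′ + D) (winding-level E refl (at s x) c)
    (trans (cong (λ a → climb a (+ top s) (suc x) c) (+suc R)) (climb-vertical (+ R) (+ top s) (suc x) c)))
  (lem (winding (at s x) c) (climb (+ R) (+ top s) (suc x) c) (multiplicity (vertical (+ R) (+ top s) (suc x)) c) D)
  where
  D = descend (suc (top s)) c
  lem : ∀ w k m D → w + (k + m) + D ≡ w + k + D + m
  lem = solve-∀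
potential-turn {R = R} {h} {x} s se c = trans
  (cong₂ (λ z z′ → z + z′ + D) (winding-level E refl (at s x) c) (cong (λ a → climb a (+ top s) (suc h) c) (+suc R)))
  (sym (ℤₚ.+-identityʳ _))
  where
  D = descend (suc (top s)) c
potential-turn {R = R} {h} {x} s es c = trans
  (cong₂ (λ z z′ → z + z′ + D) (winding-S (at s x) c (pos-at s x))
    (trans (climb-vertical (+ R) (+ H) (suc (suc h)) c)
      (cong (λ y → upward (+ R) y c + climb (+ R) (+ H) (suc h) c + M) (minus-suc H h))))
  (lem (winding (at s x) c) (upward (+ R) (+ H - + h + -1ℤ) c) (climb (+ R) (+ H) (suc h) c) M D)
  where
  H = top s
  D = descend (suc H) c
  M = multiplicity (vertical (+ R) (+ H) (suc (suc h))) c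
  lem : ∀ w u k m D → w - u + (u + k + m) + D ≡ w + k + D + m
  lem = solve-∀
potential-turn {R = R} {h} {x} s (ss _) c = trans
  (cong₂ (λ z z′ → z + (z′ + climb (+ R + 1ℤ) (+ H) (suc h) c) + D) (winding-S (at s x) c (pos-at s x))
    (trans (row-step (+ R - + x) (+ H - + suc h) (suc x) c corner)
      (cong (λ y → upward (+ R - + x) y c + M) (minus-suc H h))))
  (lem (winding (at s x) c) (upward (+ R - + x) (+ H - + h + -1ℤ) c) (climb (+ R + 1ℤ) (+ H) (suc h) c) M D)
  where
  H = top s
  D = descend (suc H) c
  M = multiplicity (horizontal (+ R - + x) (+ H - + suc h) (suc x)) c
  lem : ∀ w u k m D → w - u + (u + m + k) + D ≡ w + k + D + m
  lem = solve-∀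
  corner : + R + 1ℤ ≡ + R - + x + + suc x
  corner = trans (lem′ (+ R) (+ x)) (cong (_+_ (+ R - + x)) (sym (+suc x)))
    where
    lem′ : ∀ R x → R + 1ℤ ≡ R - x + (x + 1ℤ)
    lem′ = solve-∀

potential-cells : ∀ {d R h} (s : Shape d R h) k c →
  potential s k c ≡ descend (closed-top d (top s)) c + multiplicity (cells s) c
potential-cells start k c = trans (potential-at start k c) (start-cell c)
  where
  start-cell : ∀ c → 0ℤ + (upward 0ℤ (0ℤ - 0ℤ) c + 0ℤ) ≡ 0ℤ + upward -1ℤ 0ℤ c + (δ (-1ℤ , 0ℤ) c + 0ℤ)
  start-cell c = trans (cong (λ z → 0ℤ + (z + 0ℤ)) (upward-step -1ℤ 0ℤ c)) (lem (upward -1ℤ 0ℤ c) (δ (-1ℤ , 0ℤ) c))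
    where
    lem : ∀ u d → 0ℤ + (u + d + 0ℤ) ≡ 0ℤ + u + (d + 0ℤ)
    lem = solve-∀
potential-cells {d} (_▸_ {d = d₀} {x = x} s t) k c =
  trans (potential-at (s ▸ t) k c)
    (trans (cancel _ D₀ D₁ M (multiplicity (cells s) c)
        (trans (potential-turn s t c) (cong (λ z → z + D₁ + M) (potential-cells s x c))))
      (cong (_+_ D₁) (sym (multiplicity-++ (added t (top s)) (cells s) c))))
  where
  D₀ = descend (closed-top d₀ (top s)) c
  D₁ = descend (closed-top d (rise d (top s))) c
  M  = multiplicity (added t (top s)) c
  cancel : ∀ p D₀ D₁ m n → p + D₀ ≡ D₀ + n + D₁ + m → p ≡ D₁ + (m + n)
  cancel p D₀ D₁ m n eq = trans (lem p D₀) (trans (cong (_- D₀) eq) (lem′ D₀ D₁ m n))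
    where
    lem : ∀ p D → p ≡ p + D - D
    lem = solve-∀
    lem′ : ∀ D₀ D₁ m n → D₀ + n + D₁ + m - D₀ ≡ D₁ + (m + n)
    lem′ = solve-∀

replicate-suc : ∀ {A : Set} n {x : A} {ys} → replicate (suc n) x ++ ys ≡ replicate n x ++ x ∷ ys
replicate-suc zero    = refl
replicate-suc (suc n) = cong (_ ∷_) (replicate-suc n)

winding-descent : ∀ H w c → pos w ≡ (-1ℤ , + H) → winding (replicate H S ++ w) c ≡ winding w c - descend H c
winding-descent zero    w c _    = sym (ℤₚ.+-identityʳ (winding w c))
winding-descent (suc H) w c at-H = begin
  winding (replicate (suc H) S ++ w) c                 ≡⟨ cong (λ w → winding w c) (replicate-suc H) ⟩
  winding (replicate H S ++ S ∷ w) c                   ≡⟨ winding-descent H (S ∷ w) c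
      (trans (cong (_⊞ vec S) at-H) (cong (_,_ -1ℤ) below)) ⟩
  winding (S ∷ w) c - descend H c                      ≡⟨ cong (_- descend H c) (winding-S w c at-H) ⟩
  winding w c - upward -1ℤ (+ suc H + -1ℤ) c - descend H c ≡⟨ cong (λ y → winding w c - upward -1ℤ y c - descend H c)
      below ⟩
  winding w c - upward -1ℤ (+ H) c - descend H c       ≡⟨ lem (winding w c) (upward -1ℤ (+ H) c) (descend H c) ⟩
  winding w c - (descend H c + upward -1ℤ (+ H) c)     ∎
  where
  open ≡-Reasoning
  lem : ∀ w u D → w - u - D ≡ w - (D + u)
  lem = solve-∀
  lem′ : ∀ h → h + 1ℤ + -1ℤ ≡ h
  lem′ = solve-∀
  below : + suc H + -1ℤ ≡ + H
  below = trans (cong (_+ -1ℤ) (+suc H)) (lem′ (+ H))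

winding-close : ∀ {R h} (s : Shape N R h) c →
  winding (close s) c + crossing c (pos (close s) , origin) ≡ multiplicity (cells s) c
winding-close s c = begin
  winding (close s) c + crossing c (pos (close s) , origin)
    ≡⟨ cong₂ _+_ (winding-descent (top s) (W ∷ at s 0) c corner)
         (crossing-level c (proj₁ (pos (close s))) (proj₂ (pos (close s))) 0ℤ 0ℤ (sym (cong proj₂ (pos-close s)))) ⟩
  winding (W ∷ at s 0) c - descend (top s) c + 0ℤ
    ≡⟨ cong (λ w → w - descend (top s) c + 0ℤ) (winding-level W refl (at s 0) c) ⟩
  winding (at s 0) c - descend (top s) c + 0ℤ
    ≡⟨ lem (winding (at s 0) c) (descend (top s) c) ⟩
  winding (at s 0) c + 0ℤ - descend (top s) c
    ≡⟨ cong (_- descend (top s) c) (potential-cells s 0 c) ⟩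
  descend (top s) c + multiplicity (cells s) c - descend (top s) c
    ≡⟨ lem′ (descend (top s) c) (multiplicity (cells s) c) ⟩
  multiplicity (cells s) c ∎
  where
  open ≡-Reasoning
  corner : pos (W ∷ at s 0) ≡ (-1ℤ , + top s)
  corner = trans (cong (_⊞ vec W) (pos-at s 0)) (cong (_,_ -1ℤ) (ℤₚ.+-identityʳ (+ top s)))
  lem : ∀ w D → w - D + 0ℤ ≡ w + 0ℤ - D
  lem = solve-∀
  lem′ : ∀ D m → D + m - D ≡ m
  lem′ = solve-∀

-- Column -1 lies between the final descent and the box of the walk; cells being named by south-west
-- corners, the upper bounds are strict.
record InBox (R h H : ℕ) (c : Cell) : Set where
  constructor in-box
  field
    left  : -1ℤ ≤ column c
    right : column c < + R
    below : + H - + h ≤ row c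
    above : row c < + H

ClosedBox : (d : Direction) (R h H : ℕ) → Cell → Set
ClosedBox d R h H = InBox (closed-right d R) (closed-height d h) (closed-top d H)

∈-horizontal : ∀ x y m {c} → c ∈ horizontal x y m → ∃[ t ] t ℕ.< m × c ≡ (x + + t , y)
∈-horizontal x y m = ∈-applyDownFrom⁻ (λ t → x + + t , y)

∈-vertical : ∀ x y m {c} → c ∈ vertical x y m → ∃[ t ] t ℕ.< m × c ≡ (x , y - + t)
∈-vertical x y m = ∈-applyDownFrom⁻ (λ t → x , y - + t)

n<suc : ∀ n → + n < + suc n
n<suc n = ℤ.+<+ (ℕₚ.n<1+n n)

lower-suc : ∀ H h → + H - + suc h ≤ + H - + h
lower-suc H h = m-n≤m-k H (ℕₚ.n≤1+n h)

box-grows : ∀ {d R h x d′ R′ h′ y} (t : Turn d R h x d′ R′ h′ y) H {c} → ClosedBox d R h H c →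
    ClosedBox d′ R′ h′ (rise d′ H) c
box-grows (nn {h = h} _) H (in-box l r b a) =
    in-box l r (subst (_≤ _) (sym (suc-cancel H h)) b) (ℤₚ.<-trans a (n<suc H))
box-grows en H box = box
box-grows (ne {R} {h}) H (in-box l r b a) = in-box l (ℤₚ.<-trans r (n<suc R)) (subst (_≤ _) (sym (suc-cancel H h)) b)
    (ℤₚ.<-trans a (n<suc H))
box-grows (ee {R} _) H (in-box l r b a) = in-box l (ℤₚ.<-trans r (n<suc R)) b a
box-grows se H box = box
box-grows (es {R} {h}) H (in-box l r b a) = in-box l (ℤₚ.<-trans r (n<suc R))
    (ℤₚ.≤-trans (lower-suc (suc H) (suc h)) b) a
box-grows (ss {R} {h} _) H (in-box l r b a) = in-box l r (ℤₚ.≤-trans (lower-suc (suc H) (suc h)) b) a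

-- Every added strip lies in a row or column that the closed box did not have before; this is why
-- cells are never counted twice.
outside : ∀ {d R h x d′ R′ h′ y} (t : Turn d R h x d′ R′ h′ y) H {c} → c ∈ added t H → ¬ ClosedBox d R h H c
outside (nn {k = k} _) H c∈ (in-box _ _ _ a) with ∈-horizontal -1ℤ (+ H) (suc k) c∈
... | _ , _ , refl = ℤₚ.<-irrefl refl a
outside (ne {R}) H c∈ (in-box _ _ _ a) with ∈-horizontal -1ℤ (+ H) (suc (suc R)) c∈
... | _ , _ , refl = ℤₚ.<-irrefl refl a
outside (ee {R} {k = k} _) H c∈ (in-box _ r _ _) with ∈-vertical (+ R) (+ H) (suc k) c∈
... | _ , _ , refl = ℤₚ.<-irrefl refl r
outside (es {R} {h}) H c∈ (in-box _ r _ _) with ∈-vertical (+ R) (+ H) (suc (suc h)) c∈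
... | _ , _ , refl = ℤₚ.<-irrefl refl r
outside (ss {R} {h} {k} _) H c∈ (in-box _ _ b _) with ∈-horizontal (+ R - + k) (+ H - + suc h) (suc k) c∈
... | _ , _ , refl = ℤₚ.<-irrefl refl (ℤₚ.<-≤-trans (lower h) (subst (_≤ + H - + suc h) (suc-cancel H h) b))
  where
  lower : ∀ h → + H - + suc h < + H - + h
  lower h = <-by (n<suc h) (lem (+ H) (+ h) (+ suc h))
    where
    lem : ∀ H h h′ → H - h - (H - h′) ≡ h′ - h
    lem = solve-∀

-1≤+ : ∀ n → -1ℤ ≤ + n
-1≤+ n = ℤ.-≤+

m-n<suc : ∀ m n → + m - + n < + suc m
m-n<suc m n = ℤₚ.≤-<-trans (m-n≤m m n) (n<suc m)

-1≤-1+ : ∀ n → -1ℤ ≤ -1ℤ + + n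
-1≤-1+ n = ℤₚ.i≤i+j -1ℤ (+ n)

-1+< : ∀ {m n} → m ℕ.≤ n → -1ℤ + + m < + n
-1+< {m} {n} m≤n = ℤₚ.suc[i]≤j⇒i<j (≤-by (+≤+ m≤n) (lem (+ m) (+ n)))
  where
  lem : ∀ a b → b - (1ℤ + (-1ℤ + a)) ≡ b - a
  lem = solve-∀

added-in-box : ∀ {d R h x d′ R′ h′ y} (t : Turn d R h x d′ R′ h′ y) H → ∀ {c} → c ∈ added t H →
    ClosedBox d′ R′ h′ (rise d′ H) c
added-in-box (nn {R} {h} {k} k≤R) H c∈ with ∈-horizontal -1ℤ (+ H) (suc k) c∈
... | t , s≤s t≤k , refl = in-box (-1≤-1+ t) (-1+< (ℕₚ.≤-trans t≤k (recompute-≤ k≤R)))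
  (subst (_≤ + H) (sym (suc-cancel H h)) (m-n≤m H h)) (n<suc H)
added-in-box (ne {R} {h}) H c∈ with ∈-horizontal -1ℤ (+ H) (suc (suc R)) c∈
... | t , s≤s t≤ , refl = in-box (-1≤-1+ t) (-1+< t≤) (subst (_≤ + H) (sym (suc-cancel H h)) (m-n≤m H h)) (n<suc H)
added-in-box (ee {R} {h} {k} k≤h) H c∈ with ∈-vertical (+ R) (+ H) (suc k) c∈
... | t , s≤s t≤k , refl = in-box (-1≤+ R) (n<suc R)
  (subst (_≤ + H - + t) (sym (suc-cancel H h)) (m-n≤m-k H (ℕₚ.≤-trans t≤k (recompute-≤ k≤h)))) (m-n<suc H t)
added-in-box (es {R} {h}) H c∈ with ∈-vertical (+ R) (+ H) (suc (suc h)) c∈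
... | t , s≤s t≤ , refl = in-box (-1≤+ R) (n<suc R)
  (subst (_≤ + H - + t) (sym (suc-cancel H (suc h))) (m-n≤m-k H t≤)) (m-n<suc H t)
added-in-box (ss {R} {h} {k} k≤R) H c∈ with ∈-horizontal (+ R - + k) (+ H - + suc h) (suc k) c∈
... | t , s≤s t≤k , refl = in-box
  (ℤₚ.≤-trans (-1≤+ 0) (ℤₚ.+-mono-≤ (0≤m-n (recompute-≤ k≤R)) (0≤+ t)))
  (ℤₚ.≤-<-trans (≤-by (+≤+ t≤k) (lem (+ R) (+ k) (+ t))) (n<suc R))
  (ℤₚ.≤-reflexive (suc-cancel H (suc h))) (m-n<suc H (suc h))
  where
  lem : ∀ R k t → R - (R - k + t) ≡ k - t
  lem = solve-∀

cells-in-box : ∀ {d R h} (s : Shape d R h) {c} → c ∈ cells s → ClosedBox d R h (top s) c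
cells-in-box start (here refl) = in-box ℤₚ.≤-refl ℤ.-<+ ℤₚ.≤-refl (ℤ.+<+ (s≤s z≤n))
cells-in-box (s ▸ t) c∈ with ∈-++⁻ (added t (top s)) c∈
... | inj₁ c∈added = added-in-box t (top s) c∈added
... | inj₂ c∈cells = box-grows t (top s) (cells-in-box s c∈cells)

added-unique : ∀ {d R h x d′ R′ h′ y} (t : Turn d R h x d′ R′ h′ y) H → Unique (added t H)
added-unique (nn _) H = horizontal-unique -1ℤ (+ H) _
added-unique en     H = []
added-unique ne     H = horizontal-unique -1ℤ (+ H) _
added-unique (ee {R} _) H = vertical-unique (+ R) (+ H) _
added-unique se     H = []
added-unique (es {R}) H = vertical-unique (+ R) (+ H) _
added-unique (ss {R} {h} {k} _) H = horizontal-unique (+ R - + k) (+ H - + suc h) _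

cells-unique : ∀ {d R h} (s : Shape d R h) → Unique (cells s)
cells-unique start = [] ∷ []
cells-unique (s ▸ t) = Uniqueₚ.++⁺ (added-unique t (top s)) (cells-unique s)
  λ (c∈added , c∈cells) → outside t (top s) c∈added (cells-in-box s c∈cells)

length-horizontal : ∀ x y m → length (horizontal x y m) ≡ m
length-horizontal x y = Listₚ.length-applyDownFrom (λ t → x + + t , y)

length-vertical : ∀ x y m → length (vertical x y m) ≡ m
length-vertical x y = Listₚ.length-applyDownFrom (λ t → x , y - + t)

-- `en` and `se` only follow the route by which the polygon was to be closed anyway. `ne` and `es`
-- add a whole row or column of the new closed box, hence the double successors.
cost : ∀ {d R h x d′ R′ h′ y} → Turn d R h x d′ R′ h′ y → ℕ
cost (nn {k = k} _) = suc k
cost en             = 0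
cost (ne {R})       = suc (suc R)
cost (ee {k = k} _) = suc k
cost se             = 0
cost (es {h = h})   = suc (suc h)
cost (ss {k = k} _) = suc k

area : ∀ {d R h} → Shape d R h → ℕ
area start   = 1
area (s ▸ t) = cost t ℕ.+ area s

length-added : ∀ {d R h x d′ R′ h′ y} (t : Turn d R h x d′ R′ h′ y) H → length (added t H) ≡ cost t
length-added (nn {k = k} _) H = length-horizontal -1ℤ (+ H) (suc k)
length-added en H = refl
length-added (ne {R}) H = length-horizontal -1ℤ (+ H) (suc (suc R))
length-added (ee {R} {k = k} _) H = length-vertical (+ R) (+ H) (suc k)
length-added se H = refl
length-added (es {R} {h}) H = length-vertical (+ R) (+ H) (suc (suc h))
length-added (ss {R} {h} {k} _) H = length-horizontal (+ R - + k) (+ H - + suc h) (suc k)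

length-cells : ∀ {d R h} (s : Shape d R h) → length (cells s) ≡ area s
length-cells start   = refl
length-cells (s ▸ t) = trans (Listₚ.length-++ (added t (top s)))
    (cong₂ ℕ._+_ (length-added t (top s)) (length-cells s))

-- Removing rows and columns

infix 4 _≐_ _⊆ᴿ_

_⊆ᴿ_ _≐_ : Region → Region → Set
A ⊆ᴿ B = ∀ c → A c → B c
A ≐ B = (A ⊆ᴿ B) × (B ⊆ᴿ A)

≐-sym : ∀ {A B} → A ≐ B → B ≐ A
≐-sym (to , from) = from , to

Extent-resp : ∀ coord {A B k} → A ≐ B → Extent coord A k → Extent coord B k
Extent-resp coord (to , from) (lo , hi , bounds , (a , Aa , a≡) , (b , Ab , b≡) , ℓ) =
  lo , hi , (λ c Bc → bounds c (from c Bc)) , (a , to a Aa , a≡) , (b , to b Ab , b≡) , ℓ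

Connected-resp : ∀ {A B} → A ≐ B → Connected A → Connected B
Connected-resp (to , from) conn c c′ Bc Bc′ =
  Star.map (λ {a} {b} (Aa , Ab , adj) → to a Aa , to b Ab , adj) (conn c c′ (from c Bc) (from c′ Bc′))

withoutLast-resp : ∀ coord {A B} → A ≐ B → withoutLast coord A ≐ withoutLast coord B
withoutLast-resp coord (to , from) =
  (λ c (Ac , c′ , Ac′ , lt) → to c Ac , c′ , to c′ Ac′ , lt) ,
  (λ c (Bc , c′ , Bc′ , lt) → from c Bc , c′ , from c′ Bc′ , lt)

TopRowRemovable-resp : ∀ {A B} → A ≐ B → TopRowRemovable A → TopRowRemovable B
TopRowRemovable-resp A≐B ((k , w , w′) , conn) =
  (k , Extent-resp column A≐B w , Extent-resp column A′≐B′ w′) , Connected-resp A′≐B′ conn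
  where A′≐B′ = withoutLast-resp row A≐B

RightmostColumnRemovable-resp : ∀ {A B} → A ≐ B → RightmostColumnRemovable A → RightmostColumnRemovable B
RightmostColumnRemovable-resp A≐B ((k , h , h′) , conn) =
  (k , Extent-resp row A≐B h , Extent-resp row A′≐B′ h′) , Connected-resp A′≐B′ conn
  where A′≐B′ = withoutLast-resp column A≐B

Extent-unique : ∀ coord {A k k′} → Extent coord A k → Extent coord A k′ → k ≡ k′
Extent-unique coord {k = k} {k′} (lo , hi , bounds , (a , Aa , refl) , (b , Ab , refl) , ℓ)
    (lo′ , hi′ , bounds′ , (a′ , Aa′ , refl) , (b′ , Ab′ , refl) , ℓ′) =
  ℤₚ.+-injective (trans (isolate (coord a) (coord b) (+ k) ℓ)
      (trans (cong₂ (λ l h → 1ℤ + h - l) lo≡ hi≡) (sym (isolate (coord a′) (coord b′) (+ k′) ℓ′))))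
  where
  lo≡ : coord a ≡ coord a′
  lo≡ = ℤₚ.≤-antisym (proj₁ (bounds a′ Aa′)) (proj₁ (bounds′ a Aa))
  hi≡ : coord b ≡ coord b′
  hi≡ = ℤₚ.≤-antisym (proj₂ (bounds′ b Ab)) (proj₂ (bounds b′ Ab′))
  isolate : ∀ lo hi ℓ → 1ℤ + hi ≡ lo + ℓ → ℓ ≡ 1ℤ + hi - lo
  isolate lo hi ℓ eq = trans (lem lo ℓ) (cong (_- lo) (sym eq))
    where
    lem : ∀ lo ℓ → ℓ ≡ lo + ℓ - lo
    lem = solve-∀

-- With equal side lengths the lower and the upper ends of the two ranges differ by the same amount;
-- inclusion bounds it from both sides, so the ranges coincide.
subregion-reaches : ∀ coord {A B k} → B ⊆ᴿ A → Extent coord A k → Extent coord B k → ∀ {l r} → A l → A r →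
  (∃[ a ] B a × coord a ≤ coord l) × (∃[ b ] B b × coord r ≤ coord b)
subregion-reaches coord {k = k} B⊆A (lo , hi , bounds , _ , _ , ℓ)
    (lo′ , hi′ , bounds′ , (a , Ba , refl) , (b , Bb , refl) , ℓ′) {l} {r} Al Ar =
  (a , Ba , ℤₚ.≤-trans (≤-by hi′≤hi (lem lo (coord a) hi (coord b) (+ k) ℓ ℓ′)) (proj₁ (bounds l Al))) ,
  (b , Bb , ℤₚ.≤-trans (proj₂ (bounds r Ar)) (≤-by lo≤lo′ (lem′ lo (coord a) hi (coord b) (+ k) ℓ ℓ′)))
  where
  hi′≤hi : coord b ≤ hi
  hi′≤hi = proj₂ (bounds b (B⊆A b Bb))
  lo≤lo′ : lo ≤ coord a
  lo≤lo′ = proj₁ (bounds a (B⊆A a Ba))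
  top≡ : ∀ lo hi k → 1ℤ + hi ≡ lo + k → hi ≡ lo + k - 1ℤ
  top≡ lo hi k eq = trans (p hi) (cong (_- 1ℤ) eq)
    where
    p : ∀ hi → hi ≡ 1ℤ + hi - 1ℤ
    p = solve-∀
  lem : ∀ lo lo′ hi hi′ k → 1ℤ + hi ≡ lo + k → 1ℤ + hi′ ≡ lo′ + k → lo - lo′ ≡ hi - hi′
  lem lo lo′ hi hi′ k e e′ = trans (p lo lo′ k) (sym (cong₂ _-_ (top≡ lo hi k e) (top≡ lo′ hi′ k e′)))
    where
    p : ∀ lo lo′ k → lo - lo′ ≡ lo + k - 1ℤ - (lo′ + k - 1ℤ)
    p = solve-∀
  lem′ : ∀ lo lo′ hi hi′ k → 1ℤ + hi ≡ lo + k → 1ℤ + hi′ ≡ lo′ + k → hi′ - hi ≡ lo′ - lo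
  lem′ lo lo′ hi hi′ k e e′ = trans (cong₂ _-_ (top≡ lo′ hi′ k e′) (top≡ lo hi k e)) (p lo lo′ k)
    where
    p : ∀ lo lo′ k → lo′ + k - 1ℤ - (lo + k - 1ℤ) ≡ lo′ - lo
    p = solve-∀

CellsOf : List Cell → Region
CellsOf as = _∈ as

withoutLast-++ : ∀ coord as bs {m} → (∀ {a} → a ∈ as → coord a ≡ m) → (∀ {b} → b ∈ bs → coord b < m) → ∃[ a ] a ∈ as →
  withoutLast coord (CellsOf (as ++ bs)) ≐ CellsOf bs
withoutLast-++ coord as bs {m} last before (a , a∈) = to , from
  where
  ≤m : ∀ {c} → c ∈ as ++ bs → coord c ≤ m
  ≤m c∈ with ∈-++⁻ as c∈
  ... | inj₁ c∈as = ℤₚ.≤-reflexive (last c∈as)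
  ... | inj₂ c∈bs = ℤₚ.<⇒≤ (before c∈bs)
  to : withoutLast coord (CellsOf (as ++ bs)) ⊆ᴿ CellsOf bs
  to c (c∈ , c′ , c′∈ , lt) with ∈-++⁻ as c∈
  ... | inj₁ c∈as = contradiction (ℤₚ.<-≤-trans lt (≤m c′∈)) (ℤₚ.<-irrefl (last c∈as))
  ... | inj₂ c∈bs = c∈bs
  from : CellsOf bs ⊆ᴿ withoutLast coord (CellsOf (as ++ bs))
  from c c∈ = ∈-++⁺ʳ as c∈ , a , ∈-++⁺ˡ a∈ , subst (coord c <_) (sym (last a∈)) (before c∈)

Adjacent-sym : ∀ {a b} → Adjacent a b → Adjacent b a
Adjacent-sym {a} (d , refl) = opp d , sym (⊞-opp d a)

connected-++ : ∀ as bs {a b} → Connected (CellsOf as) → Connected (CellsOf bs) → a ∈ as → b ∈ bs → Adjacent a b →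
  Connected (CellsOf (as ++ bs))
connected-++ as bs {a} {b} conn₁ conn₂ a∈ b∈ adj c c′ c∈ c′∈ with ∈-++⁻ as c∈ | ∈-++⁻ as c′∈
... | inj₁ c∈as | inj₁ c′∈as = left (conn₁ c c′ c∈as c′∈as)
  where left = Star.map λ (p , q , r) → ∈-++⁺ˡ p , ∈-++⁺ˡ q , r
... | inj₂ c∈bs | inj₂ c′∈bs = right (conn₂ c c′ c∈bs c′∈bs)
  where right = Star.map λ (p , q , r) → ∈-++⁺ʳ as p , ∈-++⁺ʳ as q , r
... | inj₁ c∈as | inj₂ c′∈bs = left (conn₁ c a c∈as a∈) ◅◅ (∈-++⁺ˡ a∈ , ∈-++⁺ʳ as b∈ , adj) ◅ right
    (conn₂ b c′ b∈ c′∈bs)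
  where
  left = Star.map λ (p , q , r) → ∈-++⁺ˡ p , ∈-++⁺ˡ q , r
  right = Star.map λ (p , q , r) → ∈-++⁺ʳ as p , ∈-++⁺ʳ as q , r
... | inj₂ c∈bs | inj₁ c′∈as = right (conn₂ c b c∈bs b∈) ◅◅ (∈-++⁺ʳ as b∈ , ∈-++⁺ˡ a∈ , Adjacent-sym adj) ◅ left
    (conn₁ a c′ a∈ c′∈as)
  where
  left = Star.map λ (p , q , r) → ∈-++⁺ˡ p , ∈-++⁺ˡ q , r
  right = Star.map λ (p , q , r) → ∈-++⁺ʳ as p , ∈-++⁺ʳ as q , r

singleton-connected : ∀ a → Connected (CellsOf [ a ])
singleton-connected a _ _ (here refl) (here refl) = ε

horizontal-connected : ∀ x y m → Connected (CellsOf (horizontal x y m))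
horizontal-connected x y zero    _ _ ()
horizontal-connected x y (suc zero) = singleton-connected _
horizontal-connected x y (suc (suc m)) = connected-++ [ x + + suc m , y ] (horizontal x y (suc m))
  (singleton-connected _) (horizontal-connected x y (suc m)) (here refl) (here refl)
  (W , cong₂ _,_ (trans (lem x (+ m)) (cong (λ t → x + t + -1ℤ) (sym (+suc m)))) (sym (ℤₚ.+-identityʳ y)))
  where
  lem : ∀ x m → x + m ≡ x + (m + 1ℤ) + -1ℤ
  lem = solve-∀

vertical-connected : ∀ x y m → Connected (CellsOf (vertical x y m))
vertical-connected x y zero    _ _ ()
vertical-connected x y (suc zero) = singleton-connected _
vertical-connected x y (suc (suc m)) = connected-++ [ x , y - + suc m ] (vertical x y (suc m))
  (singleton-connected _) (vertical-connected x y (suc m)) (here refl) (here refl)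
  (N , cong₂ _,_ (sym (ℤₚ.+-identityʳ x)) (trans (lem y (+ m)) (cong (λ t → y - t + 1ℤ) (sym (+suc m)))))
  where
  lem : ∀ y m → y - m ≡ y - (m + 1ℤ) + 1ℤ
  lem = solve-∀

-- Cells are named by their south-west corners, whence the shift by one.
top-left∈ : ∀ {d R h} (s : Shape d R h) → (-1ℤ , + closed-top d (top s) + -1ℤ) ∈ cells s
top-left∈ start        = here refl
top-left∈ (s ▸ nn {k = k} _) = ∈-++⁺ˡ (∈-applyDownFrom⁺ (λ t → -1ℤ + + t , + top s) {0} {suc k} (s≤s z≤n))
top-left∈ (s ▸ en)     = top-left∈ s
top-left∈ (s ▸ ne {R}) = ∈-++⁺ˡ (∈-applyDownFrom⁺ (λ t → -1ℤ + + t , + top s) {0} {suc (suc R)} (s≤s z≤n))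
top-left∈ (s ▸ t@(ee _)) = ∈-++⁺ʳ (added t (top s)) (top-left∈ s)
top-left∈ (s ▸ se)     = top-left∈ s
top-left∈ (s ▸ t@es)   = ∈-++⁺ʳ (added t (top s)) (top-left∈ s)
top-left∈ (s ▸ t@(ss _)) = ∈-++⁺ʳ (added t (top s)) (top-left∈ s)

vertical-top∈ : ∀ x y m → (x , y) ∈ vertical x y (suc m)
vertical-top∈ x y m = subst (λ z → (x , z) ∈ vertical x y (suc m)) (ℤₚ.+-identityʳ y)
  (∈-applyDownFrom⁺ (λ t → x , y - + t) {0} {suc m} (s≤s z≤n))

-- Off the top side, the closing route runs one unit above the box, so that the row of index `top s`
-- is the highest one and extends to the right edge.
top-right∈ : ∀ {d R h} (s : Shape d R h) → d ≢ N → (+ closed-right d R + -1ℤ , + top s) ∈ cells s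
top-right∈ start _ = here refl
top-right∈ (s ▸ nn _)   d≢N = contradiction refl d≢N
top-right∈ (s ▸ en)     d≢N = contradiction refl d≢N
top-right∈ (s ▸ ne)     _ = here refl
top-right∈ (s ▸ ee {R} {k = k} _) _ = ∈-++⁺ˡ (vertical-top∈ (+ R) (+ top s) k)
top-right∈ (s ▸ se)     _ = top-right∈ s λ ()
top-right∈ (s ▸ es {R} {h}) _ = ∈-++⁺ˡ (vertical-top∈ (+ R) (+ top s) (suc h))
top-right∈ (s ▸ t@(ss _)) _ = ∈-++⁺ʳ (added t (top s)) (top-right∈ s λ ())

horizontal-end∈ : ∀ R k y → (+ R , y) ∈ horizontal (+ R - + k) y (suc k)
horizontal-end∈ R k y = here (cong (_, y) (lem (+ R) (+ k)))
  where
  lem : ∀ R k → R ≡ R - k + k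
  lem = solve-∀

bottom-right∈ : ∀ {R h} (s : Shape S R h) → (+ R , + top s - + h) ∈ cells s
bottom-right∈ (s ▸ es)             = here refl
bottom-right∈ (s ▸ ss {R} {h} {k} _) = ∈-++⁺ˡ (horizontal-end∈ R k (+ top s - + suc h))

rightmost∈ : ∀ {d R h} (s : Shape d R h) → ∃[ c ] c ∈ cells s × column c ≡ + closed-right d R + -1ℤ
rightmost∈ (s ▸ t@(nn _)) = let c , c∈ , eq = rightmost∈ s in c , ∈-++⁺ʳ (added t (top s)) c∈ , eq
rightmost∈ (s ▸ en)       = rightmost∈ s
rightmost∈ start           = _ , top-right∈ start (λ ()) , refl
rightmost∈ (s ▸ ne)       = _ , top-right∈ (s ▸ ne) (λ ()) , refl
rightmost∈ (s ▸ ee k≤)    = _ , top-right∈ (s ▸ ee k≤) (λ ()) , refl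
rightmost∈ (s ▸ se)       = _ , top-right∈ (s ▸ se) (λ ()) , refl
rightmost∈ (s ▸ es)       = _ , top-right∈ (s ▸ es) (λ ()) , refl
rightmost∈ (s ▸ ss k≤)    = _ , top-right∈ (s ▸ ss k≤) (λ ()) , refl

lowest∈ : ∀ {d R h} (s : Shape d R h) → ∃[ c ] c ∈ cells s × row c ≡ + top s - + h
lowest∈ start         = _ , here refl , refl
lowest∈ (s ▸ t@(nn {h = h} _)) = let c , c∈ , eq = lowest∈ s in c , ∈-++⁺ʳ (added t (top s)) c∈ , trans eq (sym (suc-cancel (top s) h))
lowest∈ (s ▸ en {h = h})       = let c , c∈ , eq = lowest∈ s in c , c∈ , trans eq (sym (suc-cancel (top s) h))
lowest∈ (s ▸ t@ne)       = let c , c∈ , eq = lowest∈ s in c , ∈-++⁺ʳ (added t (top s)) c∈ , eq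
lowest∈ (s ▸ t@(ee _))       = let c , c∈ , eq = lowest∈ s in c , ∈-++⁺ʳ (added t (top s)) c∈ , eq
lowest∈ (s ▸ se)       = lowest∈ s
lowest∈ (s ▸ es)       = _ , bottom-right∈ (s ▸ es) , refl
lowest∈ (s ▸ ss k≤)    = _ , bottom-right∈ (s ▸ ss k≤) , refl

suc≤⇒≤-1 : ∀ {i j} → i < j → i ≤ j + -1ℤ
suc≤⇒≤-1 {i} {j} lt = ≤-by (ℤₚ.i<j⇒suc[i]≤j lt) (lem i j)
  where
  lem : ∀ i j → j + -1ℤ - i ≡ j - (1ℤ + i)
  lem = solve-∀

width-cells : ∀ {R h} (s : Shape N R h) → Width (CellsOf (cells s)) (suc R)
width-cells {R} s = -1ℤ , + R + -1ℤ ,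
  (λ c c∈ → let open InBox (cells-in-box s c∈) in left , suc≤⇒≤-1 right) ,
  (_ , top-left∈ s , refl) , rightmost∈ s , trans (lem (+ R)) (cong (_+_ -1ℤ) (sym (+suc R)))
  where
  lem : ∀ R → 1ℤ + (R + -1ℤ) ≡ -1ℤ + (R + 1ℤ)
  lem = solve-∀

height-cells : ∀ {R h} (s : Shape N R h) → Height (CellsOf (cells s)) h
height-cells {R} {h} s = + top s - + h , + top s + -1ℤ ,
  (λ c c∈ → let open InBox (cells-in-box s c∈) in below , suc≤⇒≤-1 above) ,
  lowest∈ s , (_ , top-left∈ s , refl) , lem (+ top s) (+ h)
  where
  lem : ∀ H h → 1ℤ + (H + -1ℤ) ≡ H - h + h
  lem = solve-∀

cells-connected : ∀ {d R h} (s : Shape d R h) → Connected (CellsOf (cells s))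
cells-connected start = singleton-connected _
cells-connected (s ▸ t@(nn {k = k} _)) = connected-++ (added t (top s)) (cells s)
    (horizontal-connected -1ℤ (+ top s) (suc k)) (cells-connected s)
  (∈-applyDownFrom⁺ (λ t → -1ℤ + + t , + top s) {0} {suc k} (s≤s z≤n)) (top-left∈ s) (S , refl)
cells-connected (s ▸ en) = cells-connected s
cells-connected (s ▸ t@(ne {R})) = connected-++ (added t (top s)) (cells s)
    (horizontal-connected -1ℤ (+ top s) (suc (suc R))) (cells-connected s)
  (∈-applyDownFrom⁺ (λ t → -1ℤ + + t , + top s) {0} {suc (suc R)} (s≤s z≤n)) (top-left∈ s) (S , refl)
cells-connected (s ▸ t@(ee {R} {k = k} _)) = connected-++ (added t (top s)) (cells s)
    (vertical-connected (+ R) (+ top s) (suc k)) (cells-connected s)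
  (vertical-top∈ (+ R) (+ top s) k) (top-right∈ s λ ()) (W , cong (_,_ (+ R + -1ℤ)) (sym (ℤₚ.+-identityʳ (+ top s))))
cells-connected (s ▸ se) = cells-connected s
cells-connected (s ▸ t@(es {R} {h})) = connected-++ (added t (top s)) (cells s)
    (vertical-connected (+ R) (+ top s) (suc (suc h))) (cells-connected s)
  (vertical-top∈ (+ R) (+ top s) (suc h)) (top-right∈ s λ ())
      (W , cong (_,_ (+ R + -1ℤ)) (sym (ℤₚ.+-identityʳ (+ top s))))
cells-connected (s ▸ t@(ss {R} {h} {k} _)) = connected-++ (added t (top s)) (cells s)
    (horizontal-connected (+ R - + k) (+ top s - + suc h) (suc k)) (cells-connected s)
  (horizontal-end∈ R k (+ top s - + suc h)) (bottom-right∈ s)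
  (N , cong₂ _,_ (sym (ℤₚ.+-identityʳ (+ R)))
      (trans (lem (+ top s) (+ h)) (cong (λ t → + top s - t + 1ℤ) (sym (+suc h)))))
  where
  lem : ∀ H h → H - h ≡ H - (h + 1ℤ) + 1ℤ
  lem = solve-∀

nn-removable : ∀ {R h k} (s : Shape N R h) .(k≤R : k ℕ.≤ R) → TopRowRemovable (CellsOf (cells (s ▸ nn k≤R)))
nn-removable {R} {k = k} s k≤R =
  (suc R , width-cells (s ▸ nn k≤R) , Extent-resp column (≐-sym rest) (width-cells s)) ,
  Connected-resp (≐-sym rest) (cells-connected s)
  where
  H = top s
  new = horizontal -1ℤ (+ H) (suc k)
  last : ∀ {a} → a ∈ new → row a ≡ + H
  last a∈ with ∈-horizontal -1ℤ (+ H) (suc k) a∈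
  ... | _ , _ , refl = refl
  rest : withoutLast row (CellsOf (new ++ cells s)) ≐ CellsOf (cells s)
  rest = withoutLast-++ row new (cells s) last (λ b∈ → InBox.above (cells-in-box s b∈)) (_ , here refl)

ne-removable : ∀ {R h} (s : Shape N R h) → RightmostColumnRemovable (CellsOf (cells (s ▸ ne ▸ en)))
ne-removable {R} {h} s =
  (suc h , height-cells (s ▸ ne ▸ en) , Extent-resp row (≐-sym rest) (height-cells s′)) ,
  Connected-resp (≐-sym rest) (cells-connected s′)
  where
  -- The row of R + 2 cells added by `ne` loses its last cell and becomes the row that `nn` adds
  -- when leaving from the right end.
  s′ = s ▸ nn {k = R} ℕₚ.≤-refl
  rest : withoutLast column (CellsOf ([ + R , + top s ] ++ cells s′)) ≐ CellsOf (cells s′)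
  rest = withoutLast-++ column [ + R , + top s ] (cells s′) (λ { (here refl) → refl })
      (λ b∈ → InBox.right (cells-in-box s′ b∈)) (_ , here refl)

ee-removable : ∀ {R h k} (s : Shape E R h) .(k≤h : k ℕ.≤ h) →
    RightmostColumnRemovable (CellsOf (cells (s ▸ ee k≤h ▸ en)))
ee-removable {R} {h} {k} s k≤h =
  (suc h , height-cells (s ▸ ee k≤h ▸ en) , Extent-resp row (≐-sym rest) (height-cells (s ▸ en))) ,
  Connected-resp (≐-sym rest) (cells-connected s)
  where
  H = top s
  new = vertical (+ R) (+ H) (suc k)
  last : ∀ {a} → a ∈ new → column a ≡ + R
  last a∈ with ∈-vertical (+ R) (+ H) (suc k) a∈
  ... | _ , _ , refl = refl
  rest : withoutLast column (CellsOf (new ++ cells s)) ≐ CellsOf (cells s)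
  rest = withoutLast-++ column new (cells s) last (λ b∈ → InBox.right (cells-in-box s b∈)) (_ , here refl)

-- The obstruction to connectedness: a set closed under adjacency within `A` contains every cell
-- that a path in `A` can reach from it.
Closed : (Region) → Region → Set
Closed A B = ∀ a b → A a → A b → Adjacent a b → B a → B b

closed-star : ∀ {A B a b} → Closed A B → Star (λ a b → A a × A b × Adjacent a b) a b → B a → B b
closed-star closed ε               Ba = Ba
closed-star closed ((Aa , Ac , adj) ◅ path) Ba = closed-star closed path (closed _ _ Aa Ac adj Ba)

-- The cells added since the top row last grew: they meet the earlier ones
-- only along the top row.
shaft : ∀ {d R h} → Shape d R h → List Cell
shaft start          = []
shaft (s ▸ nn _)     = []
shaft (s ▸ en)       = []
shaft (s ▸ ne)       = []
shaft (s ▸ t@(ee _)) = added t (top s) ++ shaft s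
shaft (s ▸ se)       = shaft s
shaft (s ▸ t@es)     = added t (top s) ++ shaft s
shaft (s ▸ t@(ss _)) = added t (top s) ++ shaft s

adjacent-column : ∀ {a b} → Adjacent a b → column a ≤ column b + 1ℤ
adjacent-column {a} (d , refl) = ≤-by (along-≥-1 E d) (lem (column a) (along E (vec d)))
  where
  lem : ∀ x t → x + t + 1ℤ - x ≡ t - -1ℤ
  lem = solve-∀

adjacent-row : ∀ {a b} → Adjacent a b → row a ≤ row b + 1ℤ
adjacent-row {a} (d , refl) = ≤-by (along-≥-1 N d) (lem (row a) (along N (vec d)))
  where
  lem : ∀ x t → x + t + 1ℤ - x ≡ t - -1ℤ
  lem = solve-∀

-- The two edge properties carry the induction. An added column touches old cells only at the right
-- edge, an added row only at the bottom edge; below the top row these cells must already belong to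
-- the shaft for it to remain closed.
record Shaft {d R h} (s : Shape d R h) : Set where
  constructor shaft-properties
  field
    right-edge : ∀ {c} → c ∈ cells s → row c < + top s → + closed-right d R ≤ column c + 1ℤ → c ∈ shaft s
    closed     : ∀ {a b} → a ∈ shaft s → b ∈ cells s → row b < + top s → Adjacent a b → b ∈ shaft s
    off-left   : ∀ {c} → c ∈ shaft s → 0ℤ ≤ column c
    bottom-edge : d ≡ S → ∀ {c} → c ∈ cells s → row c ≤ + top s - + h → c ∈ shaft s

below-edge : ∀ H h {i} → + suc H - + suc h ≤ i → ¬ i ≤ + H - + suc h
below-edge H h le le′ = ℤₚ.<-irrefl refl (ℤₚ.<-≤-trans lower
    (subst (_≤ + H - + suc h) (suc-cancel H h) (ℤₚ.≤-trans le le′)))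
  where
  lower : + H - + suc h < + H - + h
  lower = <-by (n<suc h) (lem (+ H) (+ h) (+ suc h))
    where
    lem : ∀ H h h′ → H - h - (H - h′) ≡ h′ - h
    lem = solve-∀

module AddedColumn {R h : ℕ} (s : Shape E R h) (P : Shaft s) (m : ℕ) where
  open Shaft P

  new : List Cell
  new = vertical (+ R) (+ top s) m

  on-column : ∀ {a} → a ∈ new → column a ≡ + R
  on-column a∈ with ∈-vertical (+ R) (+ top s) m a∈
  ... | _ , _ , refl = refl

  right-edge′ : ∀ {c} → c ∈ new ++ cells s → row c < + top s → + suc R ≤ column c + 1ℤ → c ∈ new ++ shaft s
  right-edge′ {c} c∈ _ le with ∈-++⁻ new c∈
  ... | inj₁ c∈new = ∈-++⁺ˡ c∈new
  ... | inj₂ c∈s   = contradiction (InBox.right (cells-in-box s c∈s))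
    (ℤₚ.≤⇒≯ (≤-by (subst (_≤ column c + 1ℤ) (+suc R) le) (lem (column c) (+ R))))
    where
    lem : ∀ c R → c - R ≡ c + 1ℤ - (R + 1ℤ)
    lem = solve-∀

  closed′ : ∀ {a b} → a ∈ new ++ shaft s → b ∈ new ++ cells s → row b < + top s → Adjacent a b → b ∈ new ++ shaft s
  closed′ {a} {b} a∈ b∈ b-low adj with ∈-++⁻ new b∈ | ∈-++⁻ new a∈
  ... | inj₁ b∈new | _ = ∈-++⁺ˡ b∈new
  ... | inj₂ b∈s   | inj₁ a∈new = ∈-++⁺ʳ new (right-edge b∈s b-low
      (subst (_≤ column b + 1ℤ) (on-column a∈new) (adjacent-column {a} {b} adj)))
  ... | inj₂ b∈s   | inj₂ a∈shaft = ∈-++⁺ʳ new (closed a∈shaft b∈s b-low adj)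

  off-left′ : ∀ {c} → c ∈ new ++ shaft s → 0ℤ ≤ column c
  off-left′ c∈ with ∈-++⁻ new c∈
  ... | inj₁ c∈new   = subst (0ℤ ≤_) (sym (on-column c∈new)) (0≤+ R)
  ... | inj₂ c∈shaft = off-left c∈shaft

module AddedRow {R h : ℕ} (s : Shape S R h) (k : ℕ) where

  new : List Cell
  new = horizontal (+ R - + k) (+ top s - + suc h) (suc k)

  on-row : ∀ {a} → a ∈ new → row a ≡ + top s - + suc h
  on-row a∈ with ∈-horizontal (+ R - + k) (+ top s - + suc h) (suc k) a∈
  ... | _ , _ , refl = refl

  above-new : ∀ {a b} → a ∈ new → Adjacent a b → row b ≤ + top s - + h
  above-new {a} {b} a∈ adj = subst (λ r → row b ≤ r)
      (trans (cong (_+ 1ℤ) (on-row a∈)) (trans (cong (λ t → + top s - t + 1ℤ) (+suc h)) (lem (+ top s) (+ h))))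
    (adjacent-row {b} {a} (Adjacent-sym {a} {b} adj))
    where
    lem : ∀ H h → H - (h + 1ℤ) + 1ℤ ≡ H - h
    lem = solve-∀

  bottom-edge′ : ∀ {c} → c ∈ new ++ cells s → row c ≤ + top s - + suc h → c ∈ new
  bottom-edge′ c∈ le with ∈-++⁻ new c∈
  ... | inj₁ c∈new = c∈new
  ... | inj₂ c∈s   = contradiction le (below-edge (top s) h (InBox.below (cells-in-box s c∈s)))

shaft-ok : ∀ {d R h} (s : Shape d R h) → d ≢ N → Shaft s
shaft-ok start _ = shaft-properties (λ { (here refl) lt _ → contradiction lt (ℤₚ.<-irrefl refl) }) (λ ()) (λ ())
    (λ ())
shaft-ok (s ▸ nn _) d≢N = contradiction refl d≢N
shaft-ok (s ▸ en)   d≢N = contradiction refl d≢N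
shaft-ok (s ▸ ne {R}) _ = shaft-properties right-edge (λ ()) (λ ()) (λ ())
  where
  right-edge : ∀ {c} → c ∈ horizontal -1ℤ (+ top s) (suc (suc R)) ++ cells s → row c < + top s → + suc R ≤ column c +
      1ℤ → c ∈ []
  right-edge {c} c∈ lt le with ∈-++⁻ (horizontal -1ℤ (+ top s) (suc (suc R))) c∈
  ... | inj₂ c∈s = contradiction (InBox.right (cells-in-box s c∈s))
      (ℤₚ.≤⇒≯ (≤-by (subst (_≤ column c + 1ℤ) (+suc R) le) (lem (column c) (+ R))))
    where
    lem : ∀ c R → c - R ≡ c + 1ℤ - (R + 1ℤ)
    lem = solve-∀
  ... | inj₁ c∈new with ∈-horizontal -1ℤ (+ top s) (suc (suc R)) c∈new
  ...   | _ , _ , refl = contradiction lt (ℤₚ.<-irrefl refl)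
shaft-ok (s ▸ ee {k = k} _) _ = shaft-properties right-edge′ closed′ off-left′ (λ ())
  where open AddedColumn s (shaft-ok s (λ ())) (suc k)
shaft-ok (s ▸ se) _ = shaft-properties right-edge closed off-left (λ ())
  where open Shaft (shaft-ok s (λ ()))
shaft-ok (s ▸ es {h = h}) _ = shaft-properties right-edge′ closed′ off-left′ bottom
  where
  open AddedColumn s (shaft-ok s (λ ())) (suc (suc h))
  bottom : S ≡ S → ∀ {c} → c ∈ new ++ cells s → row c ≤ + top s - + suc h → c ∈ new ++ shaft s
  bottom _ c∈ le with ∈-++⁻ new c∈
  ... | inj₁ c∈new = ∈-++⁺ˡ c∈new
  ... | inj₂ c∈s   = contradiction le (below-edge (top s) h (InBox.below (cells-in-box s c∈s)))
shaft-ok (s ▸ ss {R} {h} {k} k≤R) _ = shaft-properties right-edge′ closed′ off-left′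
    (λ _ c∈ le → ∈-++⁺ˡ (bottom-edge′ c∈ le))
  where
  open Shaft (shaft-ok s (λ ()))
  open AddedRow s k
  right-edge′ : ∀ {c} → c ∈ new ++ cells s → row c < + top s → + suc R ≤ column c + 1ℤ → c ∈ new ++ shaft s
  right-edge′ c∈ lt le with ∈-++⁻ new c∈
  ... | inj₁ c∈new = ∈-++⁺ˡ c∈new
  ... | inj₂ c∈s   = ∈-++⁺ʳ new (right-edge c∈s lt le)
  closed′ : ∀ {a b} → a ∈ new ++ shaft s → b ∈ new ++ cells s → row b < + top s → Adjacent a b → b ∈ new ++ shaft s
  closed′ {a} {b} a∈ b∈ lt adj with ∈-++⁻ new b∈ | ∈-++⁻ new a∈
  ... | inj₁ b∈new | _            = ∈-++⁺ˡ b∈new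
  ... | inj₂ b∈s   | inj₁ a∈new   = ∈-++⁺ʳ new (bottom-edge refl b∈s (above-new {a} {b} a∈new adj))
  ... | inj₂ b∈s   | inj₂ a∈shaft = ∈-++⁺ʳ new (closed a∈shaft b∈s lt adj)
  off-left′ : ∀ {c} → c ∈ new ++ shaft s → 0ℤ ≤ column c
  off-left′ c∈ with ∈-++⁻ new c∈
  ... | inj₂ c∈shaft = off-left c∈shaft
  ... | inj₁ c∈new with ∈-horizontal (+ R - + k) (+ top s - + suc h) (suc k) c∈new
  ...   | t , _ , refl = ℤₚ.+-mono-≤ (0≤m-n (recompute-≤ k≤R)) (0≤+ t)

withoutLast⊆ : ∀ coord A → withoutLast coord A ⊆ᴿ A
withoutLast⊆ coord A c = proj₁

-- If removing the top row kept the width, cells would remain in the leftmost and in the rightmost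
-- column. The latter lies in the shaft; connectedness would place the former there too, but the
-- shaft avoids column -1.
en-not-top-removable : ∀ {R h} (s : Shape E R h) → ¬ TopRowRemovable (CellsOf (cells (s ▸ en)))
en-not-top-removable {R} s ((k , w , w′) , conn) = contradiction (ℤₚ.≤-trans (off-left a∈shaft) a≤) λ ()
  where
  open Shaft (shaft-ok s (λ ()))
  rest = removeTopRow (CellsOf (cells s))
  low : ∀ {c} → rest c → row c < + top s
  low (_ , _ , c′∈ , lt) = ℤₚ.<-≤-trans lt (suc≤⇒≤-1 (InBox.above (cells-in-box s c′∈)))
  reached = subregion-reaches column (withoutLast⊆ row (CellsOf (cells s))) w w′ (top-left∈ s) (top-right∈ s (λ ()))
  a = proj₁ (proj₁ reached)
  a∈ = proj₁ (proj₂ (proj₁ reached))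
  a≤ : column a ≤ -1ℤ
  a≤ = proj₂ (proj₂ (proj₁ reached))
  b = proj₁ (proj₂ reached)
  b∈ = proj₁ (proj₂ (proj₂ reached))
  b≥ : + R ≤ column b + 1ℤ
  b≥ = ≤-by (proj₂ (proj₂ (proj₂ reached))) (lem (+ R) (column b))
    where
    lem : ∀ R b → b + 1ℤ - R ≡ b - (R + -1ℤ)
    lem = solve-∀
  a∈shaft : a ∈ shaft s
  a∈shaft = closed-star {B = CellsOf (shaft s)} (λ _ _ _ Ay adj x∈ → closed x∈ (proj₁ Ay) (low Ay) adj)
      (conn b a b∈ a∈)
    (right-edge (proj₁ b∈) (low b∈) b≥)

-- The rows added since the rightmost column last grew downwards: they meet
-- the earlier cells only along that column.
keel : ∀ {R h} → Shape S R h → List Cell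
keel (s ▸ es)       = []
keel (s ▸ t@(ss _)) = added t (top s) ++ keel s

record Keel {R h} (s : Shape S R h) : Set where
  constructor keel-properties
  field
    bottom-edge : ∀ {c} → c ∈ cells s → column c < + R → row c ≤ + top s - + h → c ∈ keel s
    closed      : ∀ {a b} → a ∈ keel s → b ∈ cells s → column b < + R → Adjacent a b → b ∈ keel s
    off-top     : ∀ {c} → c ∈ keel s → row c < + top s

keel-ok : ∀ {R h} (s : Shape S R h) → Keel s
keel-ok (s ▸ es {R} {h}) = keel-properties bottom (λ ()) (λ ())
  where
  new = vertical (+ R) (+ top s) (suc (suc h))
  bottom : ∀ {c} → c ∈ new ++ cells s → column c < + R → row c ≤ + top s - + suc h → c ∈ []
  bottom c∈ lt le with ∈-++⁻ new c∈
  ... | inj₂ c∈s = contradiction le (below-edge (top s) h (InBox.below (cells-in-box s c∈s)))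
  ... | inj₁ c∈new with ∈-vertical (+ R) (+ top s) (suc (suc h)) c∈new
  ...   | _ , _ , refl = contradiction lt (ℤₚ.<-irrefl refl)
keel-ok (s ▸ ss {R} {h} {k} _) = keel-properties (λ c∈ _ le → ∈-++⁺ˡ (bottom-edge′ c∈ le)) closed′ off-top′
  where
  open Keel (keel-ok s)
  open AddedRow s k
  closed′ : ∀ {a b} → a ∈ new ++ keel s → b ∈ new ++ cells s → column b < + R → Adjacent a b → b ∈ new ++ keel s
  closed′ {a} {b} a∈ b∈ lt adj with ∈-++⁻ new b∈ | ∈-++⁻ new a∈
  ... | inj₁ b∈new | _           = ∈-++⁺ˡ b∈new
  ... | inj₂ b∈s   | inj₁ a∈new  = ∈-++⁺ʳ new (bottom-edge b∈s lt (above-new {a} {b} a∈new adj))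
  ... | inj₂ b∈s   | inj₂ a∈keel = ∈-++⁺ʳ new (closed a∈keel b∈s lt adj)
  off-top′ : ∀ {c} → c ∈ new ++ keel s → row c < + top s
  off-top′ c∈ with ∈-++⁻ new c∈
  ... | inj₂ c∈keel = off-top c∈keel
  ... | inj₁ c∈new  = subst (_< + top s) (sym (on-row c∈new))
      (<-by {0ℤ} {+ suc h} (ℤ.+<+ (s≤s z≤n)) (lem (+ top s) (+ suc h)))
    where
    lem : ∀ H h → H - (H - h) ≡ h - 0ℤ
    lem = solve-∀

-- The same argument with rows and columns exchanged: a cell left in the bottom row lies in the
-- keel, which would have to reach the top row.
se-not-right-removable : ∀ {R h} (s : Shape S R h) → ¬ RightmostColumnRemovable (CellsOf (cells (s ▸ se ▸ en)))
se-not-right-removable {R} {h} s ((k , w , w′) , conn) =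
    contradiction (ℤₚ.<-≤-trans (off-top b∈keel) b≥) (ℤₚ.<-irrefl refl)
  where
  open Keel (keel-ok s)
  rest = removeRightmostColumn (CellsOf (cells s))
  inner : ∀ {c} → rest c → column c < + R
  inner (_ , _ , c′∈ , lt) = ℤₚ.<-≤-trans lt (suc≤⇒≤-1 (InBox.right (cells-in-box s c′∈)))
  reached = subregion-reaches row (withoutLast⊆ column (CellsOf (cells s))) w w′ (bottom-right∈ s) (top-left∈ s)
  a = proj₁ (proj₁ reached)
  a∈ = proj₁ (proj₂ (proj₁ reached))
  a≤ : row a ≤ + top s - + h
  a≤ = proj₂ (proj₂ (proj₁ reached))
  b = proj₁ (proj₂ reached)
  b∈ = proj₁ (proj₂ (proj₂ reached))
  b≥ : + top s ≤ row b
  b≥ = proj₂ (proj₂ (proj₂ reached))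
  b∈keel : b ∈ keel s
  b∈keel = closed-star {B = CellsOf (keel s)} (λ _ _ _ Ay adj x∈ → closed x∈ (proj₁ Ay) (inner Ay) adj)
      (conn a b a∈ b∈)
    (bottom-edge (proj₁ a∈) (inner a∈) a≤)

-- Makes the sums over all widths and heights finite, and excludes area 1 where a box is known to be
-- larger.
area-bounds : ∀ {d R h} (s : Shape d R h) → suc (closed-right d R) ℕ.≤ area s × closed-height d h ℕ.≤ area s
area-bounds start = s≤s z≤n , s≤s z≤n
area-bounds (s ▸ t) = let right , height = area-bounds s in go t s right height
  where
  go : ∀ {d R h x d′ R′ h′ y} (t : Turn d R h x d′ R′ h′ y) (s : Shape d R h) → suc (closed-right d R) ℕ.≤ area s →
      closed-height d h ℕ.≤ area s →
    suc (closed-right d′ R′) ℕ.≤ cost t ℕ.+ area s × closed-height d′ h′ ℕ.≤ cost t ℕ.+ area s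
  go (nn {k = k} _) s r h = ℕₚ.≤-trans r (ℕₚ.m≤n+m _ (suc k)) , s≤s (ℕₚ.≤-trans h (ℕₚ.m≤n+m _ k))
  go en s r h = r , h
  go (ne {R}) s r h = ℕₚ.m≤m+n (suc (suc R)) _ , s≤s (ℕₚ.≤-trans h (ℕₚ.m≤n+m _ (suc R)))
  go (ee {k = k} _) s r h = s≤s (ℕₚ.≤-trans r (ℕₚ.m≤n+m _ k)) , ℕₚ.≤-trans h (ℕₚ.m≤n+m _ (suc k))
  go se s r h = r , h
  go (es {h = h₀}) s r h = s≤s (ℕₚ.≤-trans r (ℕₚ.m≤n+m _ (suc h₀))) , ℕₚ.m≤m+n (suc (suc h₀)) _
  go (ss {k = k} _) s r h = ℕₚ.≤-trans r (ℕₚ.m≤n+m _ (suc k)) , s≤s (ℕₚ.≤-trans h (ℕₚ.m≤n+m _ k))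

-- Walks as reversed trails

endpointFrom-∷ʳ : ∀ p w d → endpointFrom p (w ∷ʳ d) ≡ endpointFrom p w ⊞ vec d
endpointFrom-∷ʳ p []      d = refl
endpointFrom-∷ʳ p (e ∷ w) d = endpointFrom-∷ʳ (p ⊞ vec e) w d

sitesFrom-∷ʳ : ∀ p w d → sitesFrom p (w ∷ʳ d) ≡ sitesFrom p w ∷ʳ (endpointFrom p w ⊞ vec d)
sitesFrom-∷ʳ p []      d = refl
sitesFrom-∷ʳ p (e ∷ w) d = cong (p ∷_) (sitesFrom-∷ʳ (p ⊞ vec e) w d)

endpoint-reverse : ∀ w → endpoint (reverse w) ≡ pos w
endpoint-reverse []      = refl
endpoint-reverse (d ∷ w) = trans (cong endpoint (Listₚ.unfold-reverse d w))
  (trans (endpointFrom-∷ʳ origin (reverse w) d) (cong (_⊞ vec d) (endpoint-reverse w)))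

sites-reverse : ∀ w → sites (reverse w) ≡ reverse (visited w)
sites-reverse []      = refl
sites-reverse (d ∷ w) = begin
  sites (reverse (d ∷ w))                                 ≡⟨ cong sites (Listₚ.unfold-reverse d w) ⟩
  sites (reverse w ∷ʳ d)                                  ≡⟨ sitesFrom-∷ʳ origin (reverse w) d ⟩
  sites (reverse w) ∷ʳ (endpoint (reverse w) ⊞ vec d)     ≡⟨ cong₂ _∷ʳ_ (sites-reverse w)
      (cong (_⊞ vec d) (endpoint-reverse w)) ⟩
  reverse (visited w) ∷ʳ pos (d ∷ w)                      ≡⟨ sym (Listₚ.unfold-reverse (pos (d ∷ w)) (visited w)) ⟩
  reverse (visited (d ∷ w))                               ∎
  where open ≡-Reasoning

∈-sites⁺ : ∀ w {r} → r ∈ visited w → r ∈ sites (reverse w)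
∈-sites⁺ w {r} r∈ = subst (r ∈_) (sym (sites-reverse w)) (Anyₚ.reverse⁺ r∈)

∈-sites⁻ : ∀ w {r} → r ∈ sites (reverse w) → r ∈ visited w
∈-sites⁻ w {r} r∈ = Anyₚ.reverse⁻ (subst (r ∈_) (sites-reverse w) r∈)

trail-prudent : ∀ w → NeverTowardsOccupied (reverse w) → PrudentTrail w
trail-prudent []      _     = tt
trail-prudent (d ∷ w) never = trail-prudent w shorter , λ k 1≤k r∈ →
  never (reverse w) d [] (Listₚ.unfold-reverse d w) k 1≤k
    (subst (λ p → p ⊞ k ⊡ vec d ∈ sites (reverse w)) (sym (endpoint-reverse w)) (∈-sites⁺ w r∈))
  where
  shorter : NeverTowardsOccupied (reverse w)
  shorter before e after eq = never before e (after ∷ʳ d)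
    (trans (Listₚ.unfold-reverse d w) (trans (cong (_∷ʳ d) eq) (Listₚ.++-assoc before (e ∷ after) [ d ])))

prudent-suffix : ∀ ds {w} → PrudentTrail (ds ++ w) → PrudentTrail w
prudent-suffix []       p = p
prudent-suffix (_ ∷ ds) p = prudent-suffix ds (proj₁ p)

1⊡ : ∀ p → 1 ⊡ p ≡ p
1⊡ (x , y) = cong₂ _,_ (ℤₚ.*-identityˡ x) (ℤₚ.*-identityˡ y)

trail-self-avoiding : ∀ w → PrudentTrail w → Unique (visited w)
trail-self-avoiding []      _        = [] ∷ []
trail-self-avoiding (d ∷ w) (p , free) = All.tabulate (λ r∈ eq → free 1 ℕₚ.≤-refl
  (subst (_∈ visited w) (trans (sym eq) (cong (pos w ⊞_) (sym (1⊡ (vec d))))) r∈)) ∷ trail-self-avoiding w p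

reverse-unique : {A : Set} {xs : List A} → Unique xs → Unique (reverse xs)
reverse-unique []                   = []
reverse-unique {xs = x ∷ xs} (x∉ ∷ unique) = subst Unique (sym (Listₚ.unfold-reverse x xs))
  (Uniqueₚ.++⁺ (reverse-unique unique) ([] ∷ []) λ { (y∈ , here refl) → All.lookup x∉ (Anyₚ.reverse⁻ y∈) refl })

reverse-prudent : ∀ w → PrudentTrail w → Prudent (reverse w)
reverse-prudent w p = subst Unique (sym (sites-reverse w)) (reverse-unique (trail-self-avoiding w p)) , never
  where
  never : NeverTowardsOccupied (reverse w)
  never before d after eq k 1≤k r∈ = proj₂ suffix k 1≤k (∈-sites⁻ (reverse before)
      (subst₂ (λ p b → p ⊞ k ⊡ vec d ∈ sites b)
          (trans (cong endpoint (sym before≡)) (endpoint-reverse (reverse before))) (sym before≡) r∈))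
    where
    before≡ : reverse (reverse before) ≡ before
    before≡ = Listₚ.reverse-involutive before
    w≡ : w ≡ reverse after ++ d ∷ reverse before
    w≡ = begin
      w                                              ≡⟨ sym (Listₚ.reverse-involutive w) ⟩
      reverse (reverse w)                            ≡⟨ cong reverse eq ⟩
      reverse (before ++ d ∷ after)                  ≡⟨ Listₚ.reverse-++ before (d ∷ after) ⟩
      reverse (d ∷ after) ++ reverse before          ≡⟨ cong (_++ reverse before) (Listₚ.unfold-reverse d after) ⟩
      (reverse after ∷ʳ d) ++ reverse before         ≡⟨ Listₚ.++-assoc (reverse after) [ d ] (reverse before) ⟩
      reverse after ++ d ∷ reverse before            ∎
      where open ≡-Reasoning
    suffix : PrudentTrail (d ∷ reverse before)
    suffix = prudent-suffix (reverse after) (subst PrudentTrail w≡ p)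

edgesFrom : Point → Walk → List (Point × Point)
edgesFrom p []      = []
edgesFrom p (d ∷ w) = (p , p ⊞ vec d) ∷ edgesFrom (p ⊞ vec d) w

closedCurve-edges : ∀ p w o → zip (sitesFrom p w) (drop 1 (sitesFrom p w) ++ [ o ]) ≡ edgesFrom p w ++
    [ endpointFrom p w , o ]
closedCurve-edges p []          o = refl
closedCurve-edges p (d ∷ [])    o = refl
closedCurve-edges p (d ∷ e ∷ w) o = cong ((p , p ⊞ vec d) ∷_) (closedCurve-edges (p ⊞ vec d) (e ∷ w) o)

edgesFrom-∷ʳ : ∀ p w d → edgesFrom p (w ∷ʳ d) ≡ edgesFrom p w ∷ʳ (endpointFrom p w , endpointFrom p w ⊞ vec d)
edgesFrom-∷ʳ p []      d = refl
edgesFrom-∷ʳ p (e ∷ w) d = cong ((p , p ⊞ vec e) ∷_) (edgesFrom-∷ʳ (p ⊞ vec e) w d)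

total : Cell → List (Point × Point) → ℤ
total c ls = foldr _+_ 0ℤ (map (crossing c) ls)

total-∷ʳ : ∀ c ls e → total c (ls ∷ʳ e) ≡ total c ls + crossing c e
total-∷ʳ c []        e = trans (ℤₚ.+-identityʳ (crossing c e)) (sym (ℤₚ.+-identityˡ (crossing c e)))
total-∷ʳ c (e′ ∷ ls) e = trans (cong (_+_ (crossing c e′)) (total-∷ʳ c ls e))
    (sym (ℤₚ.+-assoc (crossing c e′) (total c ls) (crossing c e)))

total-edges : ∀ w c → total c (edgesFrom origin (reverse w)) ≡ winding w c
total-edges []      c = refl
total-edges (d ∷ w) c = begin
  total c (edgesFrom origin (reverse (d ∷ w)))   ≡⟨ cong (λ w → total c (edgesFrom origin w))
      (Listₚ.unfold-reverse d w) ⟩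
  total c (edgesFrom origin (reverse w ∷ʳ d))    ≡⟨ cong (total c) (edgesFrom-∷ʳ origin (reverse w) d) ⟩
  total c (edgesFrom origin (reverse w) ∷ʳ (endpoint (reverse w) , endpoint (reverse w) ⊞ vec d)) ≡⟨ total-∷ʳ c
      (edgesFrom origin (reverse w)) _ ⟩
  total c (edgesFrom origin (reverse w)) + crossing c (endpoint (reverse w) , endpoint (reverse w) ⊞ vec d)
    ≡⟨ cong₂ (λ s p → s + crossing c (p , p ⊞ vec d)) (total-edges w c) (endpoint-reverse w) ⟩
  winding (d ∷ w) c ∎
  where open ≡-Reasoning

winding-reverse : ∀ w c → windingNumber (reverse w) c ≡ winding w c + crossing c (pos w , origin)
winding-reverse w c = begin
  windingNumber (reverse w) c ≡⟨ cong (total c) (closedCurve-edges origin (reverse w) origin) ⟩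
  total c (edgesFrom origin (reverse w) ∷ʳ (endpoint (reverse w) , origin)) ≡⟨ total-∷ʳ c
      (edgesFrom origin (reverse w)) _ ⟩
  total c (edgesFrom origin (reverse w)) + crossing c (endpoint (reverse w) , origin)
    ≡⟨ cong₂ (λ s p → s + crossing c (p , origin)) (total-edges w c) (endpoint-reverse w) ⟩
  winding w c + crossing c (pos w , origin) ∎
  where open ≡-Reasoning

-- Duplicate-free lists with the same members are permutations of each other. An area given by an
-- arbitrary list can thus be compared with that of a shape.
HasCardinality-unique : {A : Set} {P : A → Set} {m n : ℕ} → HasCardinality P m → HasCardinality P n → m ≡ n
HasCardinality-unique (xs , ux , x∈ , refl) (ys , uy , y∈ , refl) =
  ↭-length (∼bag⇒↭ (unique∧set⇒bag ux uy (λ {a} →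
      mk⇔ (Equivalence.from (y∈ a) ∘ Equivalence.to (x∈ a)) (Equivalence.from (x∈ a) ∘ Equivalence.to (y∈ a)))))

-- Symmetries of the square

-- These two generate the symmetry group of the square. Each reverses orientation, so on closed
-- trails both change the sign of the winding number.
data Reflection : Set where
  vertically diagonally : Reflection

turn : Reflection → Direction → Direction
turn vertically N = S
turn vertically S = N
turn vertically E = E
turn vertically W = W
turn diagonally N = E
turn diagonally S = W
turn diagonally E = N
turn diagonally W = S

move : Reflection → Point → Point
move vertically (x , y) = x , - y
move diagonally (x , y) = y , x

-- A cell is named by its south-west corner, which a vertical reflection turns
-- into the north-west one.
move-cell : Reflection → Cell → Cell
move-cell vertically (x , y) = x , -1ℤ - y
move-cell diagonally (x , y) = y , x

turn-involutive : ∀ g d → turn g (turn g d) ≡ d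
turn-involutive vertically N = refl
turn-involutive vertically S = refl
turn-involutive vertically E = refl
turn-involutive vertically W = refl
turn-involutive diagonally N = refl
turn-involutive diagonally S = refl
turn-involutive diagonally E = refl
turn-involutive diagonally W = refl

move-injective : ∀ g {p r} → move g p ≡ move g r → p ≡ r
move-injective vertically eq = cong₂ _,_ (cong proj₁ eq) (ℤₚ.neg-injective (cong proj₂ eq))
move-injective diagonally eq = cong₂ _,_ (cong proj₂ eq) (cong proj₁ eq)

move-cell-involutive : ∀ g c → move-cell g (move-cell g c) ≡ c
move-cell-involutive vertically (x , y) = cong (_,_ x) (lem y)
  where
  lem : ∀ y → -1ℤ - (-1ℤ - y) ≡ y
  lem = solve-∀
move-cell-involutive diagonally c = refl

move-ray : ∀ g p k d → move g (p ⊞ k ⊡ vec d) ≡ move g p ⊞ k ⊡ vec (turn g d)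
move-ray vertically p k N = cong (_,_ _) (lem (proj₂ p) (+ k))
  where
  lem : ∀ y k → - (y + k * 1ℤ) ≡ - y + k * -1ℤ
  lem = solve-∀
move-ray vertically p k S = cong (_,_ _) (lem (proj₂ p) (+ k))
  where
  lem : ∀ y k → - (y + k * -1ℤ) ≡ - y + k * 1ℤ
  lem = solve-∀
move-ray vertically p k E = cong (_,_ _) (lem (proj₂ p) (+ k))
  where
  lem : ∀ y k → - (y + k * 0ℤ) ≡ - y + k * 0ℤ
  lem = solve-∀
move-ray vertically p k W = cong (_,_ _) (lem (proj₂ p) (+ k))
  where
  lem : ∀ y k → - (y + k * 0ℤ) ≡ - y + k * 0ℤ
  lem = solve-∀
move-ray diagonally p k N = refl
move-ray diagonally p k S = refl
move-ray diagonally p k E = refl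
move-ray diagonally p k W = refl

move-step : ∀ g p d → move g (p ⊞ vec d) ≡ move g p ⊞ vec (turn g d)
move-step g p d = subst₂ (λ r r′ → move g (p ⊞ r) ≡ move g p ⊞ r′) (1⊡ (vec d)) (1⊡ (vec (turn g d)))
    (move-ray g p 1 d)

reflect : Reflection → Trail → Trail
reflect g = map (turn g)

reflect-involutive : ∀ g w → reflect g (reflect g w) ≡ w
reflect-involutive g []      = refl
reflect-involutive g (d ∷ w) = cong₂ _∷_ (turn-involutive g d) (reflect-involutive g w)

pos-reflect : ∀ g w → pos (reflect g w) ≡ move g (pos w)
pos-reflect vertically []  = refl
pos-reflect diagonally []  = refl
pos-reflect g (d ∷ w) = trans (cong (_⊞ vec (turn g d)) (pos-reflect g w)) (sym (move-step g (pos w) d))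

visited-reflect : ∀ g w → visited (reflect g w) ≡ map (move g) (visited w)
visited-reflect vertically [] = refl
visited-reflect diagonally [] = refl
visited-reflect g (d ∷ w) = cong₂ _∷_ (pos-reflect g (d ∷ w)) (visited-reflect g w)

prudent-reflect : ∀ g w → PrudentTrail w → PrudentTrail (reflect g w)
prudent-reflect g []      _          = tt
prudent-reflect g (d ∷ w) (p , free) = prudent-reflect g w p , λ k 1≤k r∈ →
  let r , r∈w , eq = ∈-map⁻ (move g) (subst₂ _∈_
          (trans (cong (_⊞ k ⊡ vec (turn g d)) (pos-reflect g w)) (sym (move-ray g (pos w) k d)))
          (visited-reflect g w) r∈)
  in free k 1≤k (subst (_∈ visited w) (sym (move-injective g eq)) r∈w)

upward-flip : ∀ a b c → upward a (-1ℤ - b) (move-cell vertically c) ≡ upward a b c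
upward-flip a b (x , y) with b ℤₚ.≟ y | -1ℤ - b ℤₚ.≟ -1ℤ - y
... | yes _    | yes _ = refl
... | yes refl | no ≢  = contradiction refl ≢
... | no ≢     | yes eq = contradiction (minus-cancel -1ℤ eq) ≢
... | no _     | no _  = refl

crossing-flip : ∀ d c p → crossing (move-cell vertically c)
    (move vertically p , move vertically p ⊞ vec (turn vertically d)) ≡
  - crossing c (p , p ⊞ vec d)
crossing-flip N c p@(a , b) = begin
  crossing (move-cell vertically c) ((a , - b) , (a , - b) ⊞ vec S) ≡⟨ crossing-S (move-cell vertically c) (a , - b) ⟩
  - upward a (- b + -1ℤ) (move-cell vertically c)                   ≡⟨ cong
      (λ y → - upward a y (move-cell vertically c)) (ℤₚ.+-comm (- b) -1ℤ) ⟩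
  - upward a (-1ℤ - b) (move-cell vertically c)                     ≡⟨ cong -_
      (trans (upward-flip a b c) (sym (crossing-N c p))) ⟩
  - crossing c (p , p ⊞ vec N)                                      ∎
  where open ≡-Reasoning
crossing-flip S c p@(a , b) = begin
  crossing (move-cell vertically c) ((a , - b) , (a , - b) ⊞ vec N) ≡⟨ crossing-N (move-cell vertically c) (a , - b) ⟩
  upward a (- b) (move-cell vertically c)                           ≡⟨ cong
      (λ y → upward a y (move-cell vertically c)) (lem b) ⟩
  upward a (-1ℤ - (b + -1ℤ)) (move-cell vertically c)               ≡⟨ upward-flip a (b + -1ℤ) c ⟩
  upward a (b + -1ℤ) c                                              ≡⟨ sym (ℤₚ.neg-involutive (upward a (b + -1ℤ) c))
      ⟩
  - - upward a (b + -1ℤ) c                                          ≡⟨ cong -_ (sym (crossing-S c p)) ⟩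
  - crossing c (p , p ⊞ vec S)                                      ∎
  where
  open ≡-Reasoning
  lem : ∀ b → - b ≡ -1ℤ - (b + -1ℤ)
  lem = solve-∀
crossing-flip E c p = trans (crossing-⟂ E refl (move-cell vertically c) (move vertically p))
    (cong -_ (sym (crossing-⟂ E refl c p)))
crossing-flip W c p = trans (crossing-⟂ W refl (move-cell vertically c) (move vertically p))
    (cong -_ (sym (crossing-⟂ W refl c p)))

winding-flip : ∀ w c → winding (reflect vertically w) (move-cell vertically c) ≡ - winding w c
winding-flip []      c = refl
winding-flip (d ∷ w) c = trans
  (cong₂ _+_ (winding-flip w c) (trans (cong (λ p →
      crossing (move-cell vertically c) (p , p ⊞ vec (turn vertically d))) (pos-reflect vertically w))
    (crossing-flip d c (pos w))))
  (sym (ℤₚ.neg-distrib-+ (winding w c) (crossing c (pos w , pos w ⊞ vec d))))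

-- The net number of entries into the quadrant north-east of the centre of c
-- is the sum of the signed crossings of its two sides; it vanishes for a
-- closed walk, so that the two sides give opposite winding numbers.
quadrant : Cell → Point → ℤ
quadrant (x , y) (a , b) = if does (x ℤₚ.<? a) ∧ does (y ℤₚ.<? b) then 1ℤ else 0ℤ

quadrant-swap : ∀ c p → quadrant (move-cell diagonally c) (move diagonally p) ≡ quadrant c p
quadrant-swap (x , y) (a , b) with x ℤₚ.<? a | y ℤₚ.<? b
... | yes _ | yes _ = refl
... | yes _ | no _  = refl
... | no _  | yes _ = refl
... | no _  | no _  = refl

<+1⇒≤ : ∀ {i j} → i < j + 1ℤ → i ≤ j
<+1⇒≤ {i} {j} lt = ≤-by (ℤₚ.i<j⇒suc[i]≤j lt) (lem i j)
  where
  lem : ∀ i j → j - i ≡ j + 1ℤ - (1ℤ + i)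
  lem = solve-∀

quadrant-N : ∀ c a b → quadrant c (a , b + 1ℤ) ≡ quadrant c (a , b) + upward a b c
quadrant-N (x , y) a b with x ℤₚ.<? a
... | no _ = refl
... | yes _ with y ℤₚ.<? b + 1ℤ | y ℤₚ.<? b | b ℤₚ.≟ y
... | yes _  | yes y<b | yes refl = contradiction y<b (ℤₚ.<-irrefl refl)
... | yes _  | yes _   | no _     = refl
... | yes _  | no _    | yes _    = refl
... | yes lt | no y≮b  | no b≢y   = contradiction (ℤₚ.≤-antisym (ℤₚ.≮⇒≥ y≮b) (<+1⇒≤ lt)) b≢y
... | no ≮   | yes y<b | _        = contradiction (≤⇒<+1 (ℤₚ.<⇒≤ y<b)) ≮
... | no ≮   | no _    | yes refl = contradiction (≤⇒<+1 ℤₚ.≤-refl) ≮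
... | no _   | no _    | no _     = refl

quadrant-S : ∀ c a b → quadrant c (a , b + -1ℤ) ≡ quadrant c (a , b) - upward a (b + -1ℤ) c
quadrant-S c a b = begin
  quadrant c (a , b + -1ℤ) ≡⟨ lem (quadrant c (a , b + -1ℤ)) (upward a (b + -1ℤ) c) ⟩
  quadrant c (a , b + -1ℤ) + upward a (b + -1ℤ) c - upward a (b + -1ℤ) c ≡⟨ cong (_- upward a (b + -1ℤ) c)
      (sym (quadrant-N c a (b + -1ℤ))) ⟩
  quadrant c (a , b + -1ℤ + 1ℤ) - upward a (b + -1ℤ) c ≡⟨ cong (λ b′ → quadrant c (a , b′) - upward a (b + -1ℤ) c)
      (pred-suc b) ⟩
  quadrant c (a , b) - upward a (b + -1ℤ) c ∎
  where
  open ≡-Reasoning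
  lem : ∀ q u → q ≡ q + u - u
  lem = solve-∀

quadrant-vertical : ∀ d → d ⟂ E → ∀ c p → crossing c (p , p ⊞ vec d) ≡ quadrant c (p ⊞ vec d) - quadrant c p
quadrant-vertical N _ c p@(a , b) = trans (crossing-N c p) (trans (lem (quadrant c p) (upward a b c))
  (cong (_- quadrant c p) (trans (sym (quadrant-N c a b))
      (cong (λ x → quadrant c (x , b + 1ℤ)) (sym (ℤₚ.+-identityʳ a))))))
  where
  lem : ∀ q u → u ≡ q + u - q
  lem = solve-∀
quadrant-vertical S _ c p@(a , b) = trans (crossing-S c p) (trans (lem (quadrant c p) (upward a (b + -1ℤ) c))
  (cong (_- quadrant c p) (trans (sym (quadrant-S c a b))
      (cong (λ x → quadrant c (x , b + -1ℤ)) (sym (ℤₚ.+-identityʳ a))))))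
  where
  lem : ∀ q u → - u ≡ q - u - q
  lem = solve-∀
quadrant-vertical E ()
quadrant-vertical W ()

-- A vertical step crosses only the eastern side, a horizontal one only the
-- northern side.
crossing-diagonal : ∀ d c p → crossing (move-cell diagonally c)
    (move diagonally p , move diagonally p ⊞ vec (turn diagonally d)) +
  crossing c (p , p ⊞ vec d) ≡ quadrant c (p ⊞ vec d) - quadrant c p
crossing-diagonal N c p = trans (cong₂ _+_ (crossing-⟂ E refl (move-cell diagonally c) (move diagonally p))
    (quadrant-vertical N refl c p)) (ℤₚ.+-identityˡ _)
crossing-diagonal S c p = trans (cong₂ _+_ (crossing-⟂ W refl (move-cell diagonally c) (move diagonally p))
    (quadrant-vertical S refl c p)) (ℤₚ.+-identityˡ _)
crossing-diagonal E c p = trans (cong₂ _+_ (quadrant-vertical N refl (move-cell diagonally c) (move diagonally p))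
    (crossing-⟂ E refl c p))
  (trans (ℤₚ.+-identityʳ _) (cong₂ _-_ (quadrant-swap c (p ⊞ vec E)) (quadrant-swap c p)))
crossing-diagonal W c p = trans (cong₂ _+_ (quadrant-vertical S refl (move-cell diagonally c) (move diagonally p))
    (crossing-⟂ W refl c p))
  (trans (ℤₚ.+-identityʳ _) (cong₂ _-_ (quadrant-swap c (p ⊞ vec W)) (quadrant-swap c p)))

-- Summed over the steps, the changes of `quadrant` telescope, leaving a boundary term that vanishes
-- when the trail is closed.
winding-diagonal : ∀ w c → winding (reflect diagonally w) (move-cell diagonally c) + winding w c ≡
    quadrant c (pos w) - quadrant c origin
winding-diagonal []      c = sym (ℤₚ.+-inverseʳ (quadrant c origin))
winding-diagonal (d ∷ w) c = begin
  r + crossing c′ (pos (reflect diagonally w) , pos (reflect diagonally w) ⊞ vec (turn diagonally d)) +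
      (winding w c + k)
    ≡⟨ cong (λ p → r + crossing c′ (p , p ⊞ vec (turn diagonally d)) + (winding w c + k)) (pos-reflect diagonally w) ⟩
  r + k′ + (winding w c + k)                                    ≡⟨ lem r k′ (winding w c) k ⟩
  r + winding w c + (k′ + k)                                    ≡⟨ cong₂ _+_ (winding-diagonal w c)
      (crossing-diagonal d c (pos w)) ⟩
  quadrant c (pos w) - o + (quadrant c (pos (d ∷ w)) - quadrant c (pos w)) ≡⟨ lem′ (quadrant c (pos w)) o
      (quadrant c (pos (d ∷ w))) ⟩
  quadrant c (pos (d ∷ w)) - o                                  ∎
  where
  open ≡-Reasoning
  c′ = move-cell diagonally c
  r  = winding (reflect diagonally w) c′
  k  = crossing c (pos w , pos w ⊞ vec d)
  k′ = crossing c′ (move diagonally (pos w) , move diagonally (pos w) ⊞ vec (turn diagonally d))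
  o  = quadrant c origin
  lem : ∀ r k′ w k → r + k′ + (w + k) ≡ r + w + (k′ + k)
  lem = solve-∀
  lem′ : ∀ q o q′ → q - o + (q′ - q) ≡ q′ - o
  lem′ = solve-∀

winding-reflect : ∀ g w → pos w ≡ origin → ∀ c → winding (reflect g w) (move-cell g c) ≡ - winding w c
winding-reflect vertically w _      c = winding-flip w c
winding-reflect diagonally w closed c = begin
  winding (reflect diagonally w) c′                             ≡⟨ lem (winding (reflect diagonally w) c′)
      (winding w c) ⟩
  winding (reflect diagonally w) c′ + winding w c - winding w c ≡⟨ cong (_- winding w c) (winding-diagonal w c) ⟩
  quadrant c (pos w) - quadrant c origin - winding w c          ≡⟨ cong
      (λ p → quadrant c p - quadrant c origin - winding w c) closed ⟩
  quadrant c origin - quadrant c origin - winding w c           ≡⟨ lem′ (quadrant c origin) (winding w c) ⟩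
  - winding w c                                                 ∎
  where
  open ≡-Reasoning
  c′ = move-cell diagonally c
  lem : ∀ r w → r ≡ r + w - w
  lem = solve-∀
  lem′ : ∀ o w → o - o - w ≡ - w
  lem′ = solve-∀

-- Treats the closing edge as one more step, which makes the statements about closed trails
-- available for polygons.
closing-winding : ∀ d w → pos (d ∷ w) ≡ origin → ∀ c → windingNumber (reverse w) c ≡ winding (d ∷ w) c
closing-winding d w closed c = trans (winding-reverse w c)
    (cong (λ p → winding w c + crossing c (pos w , p)) (sym closed))

PolygonTrail : Trail → Set
PolygonTrail w = PrudentTrail w × 1 ℕ.< length w × ∃[ d ] pos (d ∷ w) ≡ origin

polygon⁺ : ∀ w → PolygonTrail w → PrudentPolygon (reverse w)
polygon⁺ w (p , long , d , closed) = reverse-prudent w p , subst (1 ℕ.<_) (sym (Listₚ.length-reverse w)) long ,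
  opp d , trans (endpoint-reverse w) (trans (sym (⊞-opp d (pos w))) (cong (_⊞ vec (opp d)) closed))

polygon⁻ : ∀ w → PrudentPolygon (reverse w) → PolygonTrail w
polygon⁻ w ((_ , never) , long , d , end) = trail-prudent w never , subst (1 ℕ.<_) (Listₚ.length-reverse w) long ,
  opp d , trans (cong (_⊞ vec (opp d)) (trans (sym (endpoint-reverse w)) end)) (⊞-opp d origin)

move-origin : ∀ g → move g origin ≡ origin
move-origin vertically = refl
move-origin diagonally = refl

polygon-reflect : ∀ g w → PolygonTrail w → PolygonTrail (reflect g w)
polygon-reflect g w (p , long , d , closed) = prudent-reflect g w p ,
    subst (1 ℕ.<_) (sym (Listₚ.length-map (turn g) w)) long ,
  turn g d , trans (pos-reflect g (d ∷ w)) (trans (cong (move g) closed) (move-origin g))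

enclosed-reflect : ∀ g w → PolygonTrail w → ∀ c → Enclosed (reverse w) c →
    Enclosed (reverse (reflect g w)) (move-cell g c)
enclosed-reflect g w polygon@(_ , _ , d , closed) c enclosed eq = enclosed (begin
  windingNumber (reverse w) c                       ≡⟨ closing-winding d w closed c ⟩
  winding (d ∷ w) c                                 ≡⟨ sym (ℤₚ.neg-involutive (winding (d ∷ w) c)) ⟩
  - - winding (d ∷ w) c                             ≡⟨ cong -_ (sym (winding-reflect g (d ∷ w) closed c)) ⟩
  - winding (turn g d ∷ reflect g w) (move-cell g c) ≡⟨ cong -_
      (sym (closing-winding (turn g d) (reflect g w) (proj₂ (proj₂ (proj₂ (polygon-reflect g w polygon))))
      (move-cell g c))) ⟩
  - windingNumber (reverse (reflect g w)) (move-cell g c) ≡⟨ cong -_ eq ⟩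
  0ℤ                                                ∎)
  where open ≡-Reasoning

area-reflect : ∀ g w {n} → PolygonTrail w → Area (Enclosed (reverse w)) n → Area (Enclosed (reverse (reflect g w))) n
area-reflect g w polygon (cs , unique , cs⇔ , len) = map (move-cell g) cs ,
  Uniqueₚ.map⁺ (λ {a} {b} eq → trans (sym (move-cell-involutive g a))
      (trans (cong (move-cell g) eq) (move-cell-involutive g b))) unique ,
  (λ c → mk⇔ (to c) (from c)) , trans (Listₚ.length-map (move-cell g) cs) len
  where
  to : ∀ c → c ∈ map (move-cell g) cs → Enclosed (reverse (reflect g w)) c
  to c c∈ with ∈-map⁻ (move-cell g) c∈
  ... | a , a∈ , refl = enclosed-reflect g w polygon a (Equivalence.to (cs⇔ a) a∈)
  from : ∀ c → Enclosed (reverse (reflect g w)) c → c ∈ map (move-cell g) cs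
  from c enclosed = subst (_∈ map (move-cell g) cs) (move-cell-involutive g c) (∈-map⁺ (move-cell g)
    (Equivalence.from (cs⇔ (move-cell g c)) (subst (λ w → Enclosed (reverse w) (move-cell g c))
        (reflect-involutive g w)
      (enclosed-reflect g (reflect g w) (polygon-reflect g w polygon) c enclosed))))

Counted : ℕ → Trail → Set
Counted n w = PolygonTrail w × Area (Enclosed (reverse w)) n

counted-reflect : ∀ g w {n} → Counted n w → Counted n (reflect g w)
counted-reflect g w (polygon , area) = polygon-reflect g w polygon , area-reflect g w polygon area

-- Here `e` points from the origin to the endpoint and `d` is the last step of the walk, which comes
-- first in a trail.
Signature : Direction → Direction → Trail → Set
Signature e d w = pos w ≡ origin ⊞ vec e × ∃[ w′ ] w ≡ d ∷ w′

signature-reflect : ∀ g {e d w} → Signature e d w → Signature (turn g e) (turn g d) (reflect g w)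
signature-reflect g {e} {d} (end , w′ , refl) =
  trans (pos-reflect g (d ∷ w′)) (trans (cong (move g) end)
      (trans (move-step g origin e) (cong (_⊞ vec (turn g e)) (move-origin g)))) ,
  reflect g w′ , refl

vec-injective : ∀ d e → origin ⊞ vec d ≡ origin ⊞ vec e → d ≡ e
vec-injective N N _ = refl
vec-injective S S _ = refl
vec-injective E E _ = refl
vec-injective W W _ = refl
vec-injective N S ()
vec-injective N E ()
vec-injective N W ()
vec-injective S N ()
vec-injective S E ()
vec-injective S W ()
vec-injective E N ()
vec-injective E S ()
vec-injective E W ()
vec-injective W N ()
vec-injective W S ()
vec-injective W E ()

signature-unique : ∀ {e d e′ d′ w} → Signature e d w → Signature e′ d′ w → e ≡ e′ × d ≡ d′
signature-unique (end , _ , refl) (end′ , _ , eq) = vec-injective _ _ (trans (sym end) end′) , Listₚ.∷-injectiveˡ eq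

two-back : ∀ e → origin ⊞ vec e ⊞ vec e ⊞ 2 ⊡ vec (opp e) ≡ origin
two-back N = refl
two-back S = refl
two-back E = refl
two-back W = refl

opp-involutive : ∀ d → opp (opp d) ≡ d
opp-involutive N = refl
opp-involutive S = refl
opp-involutive E = refl
opp-involutive W = refl

-- The last step neither starts at the origin nor points towards it.
signature : ∀ w → PolygonTrail w → ∃[ e ] ∃[ d ] d ⟂ e × Signature e d w
signature [] (_ , () , _)
signature (d ∷ w) ((p , free) , long , d₀ , closed) = go (⟂-axes (fwd e) e (fwd-⟂ e) d)
  where
  e = opp d₀
  end : pos (d ∷ w) ≡ origin ⊞ vec e
  end = trans (sym (⊞-opp d₀ (pos (d ∷ w)))) (cong (_⊞ vec e) closed)
  previous : pos w ≡ origin ⊞ vec e ⊞ vec (opp d)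
  previous = trans (sym (⊞-opp d (pos w))) (cong (_⊞ vec (opp d)) end)
  returned : ∀ w → PrudentTrail w → 1 ℕ.< length (d ∷ w) → pos w ≢ origin
  returned (d′ ∷ w) (_ , free) _ eq = free 1 ℕₚ.≤-refl (subst (_∈ visited w)
    (trans (sym eq) (cong (pos w ⊞_) (sym (1⊡ (vec d′))))) (origin∈visited w))
  returned [] _ (s≤s ()) _
  go : d ∈ e ∷ opp e ∷ fwd e ∷ opp (fwd e) ∷ [] → ∃[ e ] ∃[ d′ ] d′ ⟂ e × Signature e d′ (d ∷ w)
  go (here refl) = contradiction (trans previous (⊞-opp e origin)) (returned w p long)
  go (there (here refl)) = contradiction (origin∈visited w) λ o∈ → free 2 (s≤s z≤n)
    (subst (_∈ visited w) (sym (trans (cong (_⊞ 2 ⊡ vec (opp e))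
        (trans previous (cong (λ d → origin ⊞ vec e ⊞ vec d) (opp-involutive e)))) (two-back e))) o∈)
  go (there (there (here refl))) = e , d , fwd-⟂ e , end , w , refl
  go (there (there (there (here refl)))) = e , d , ⟂-opp (fwd e) e (fwd-⟂ e) , end , w , refl

multiplicity≢0 : ∀ as c → multiplicity as c ≢ 0ℤ → c ∈ as
multiplicity≢0 []             c ≢0 = contradiction refl ≢0
multiplicity≢0 ((a , b) ∷ as) (x , y) ≢0 with a ℤₚ.≟ x | b ℤₚ.≟ y
... | yes refl | yes refl = here refl
... | yes _    | no _     = there (multiplicity≢0 as (x , y) (≢0 ∘ trans (ℤₚ.+-identityˡ _)))
... | no _     | yes _    = there (multiplicity≢0 as (x , y) (≢0 ∘ trans (ℤₚ.+-identityˡ _)))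
... | no _     | no _     = there (multiplicity≢0 as (x , y) (≢0 ∘ trans (ℤₚ.+-identityˡ _)))

module _ {R h : ℕ} (s : Shape N R h) where

  closed-winding : ∀ c → windingNumber (reverse (close s)) c ≡ multiplicity (cells s) c
  closed-winding c = trans (winding-reverse (close s) c) (winding-close s c)

  enclosed-cells : Enclosed (reverse (close s)) ≐ CellsOf (cells s)
  enclosed-cells =
    (λ c enclosed → multiplicity≢0 (cells s) c λ eq → enclosed (trans (closed-winding c) eq)) ,
    (λ c c∈ eq → contradiction (trans (sym (multiplicity-∈ (cells-unique s) c∈)) (trans (sym (closed-winding c)) eq))
        λ ())

  close-polygon : PolygonTrail (close s)
  close-polygon = close-prudent s , long s , E , cong (_⊞ vec E) (pos-close s)
    where
    long : ∀ {R h} (s : Shape N R h) → 1 ℕ.< length (close s)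
    long s with top s in eq
    ... | suc H = s≤s (subst (1 ℕ.≤_) (sym (Listₚ.length-++ (replicate H S)))
        (ℕₚ.≤-trans (s≤s z≤n) (ℕₚ.m≤n+m (suc (length (at s 0))) (length (replicate H S)))))
    long (s ▸ nn _) | zero with () ← eq
    long (s ▸ en)   | zero with () ← eq

  -- Winding numbers are multiplicities in a list without repetitions, hence 0 or 1.
  close-ccw : CounterClockwise (reverse (close s))
  close-ccw c enclosed = trans (closed-winding c) (multiplicity-∈ (cells-unique s) (proj₁ enclosed-cells c enclosed))

  close-west : WestPolygon (reverse (close s))
  close-west = polygon⁺ (close s) close-polygon , trans (endpoint-reverse (close s)) (pos-close s) , close-ccw

  close-area : Area (Enclosed (reverse (close s))) (area s)
  close-area = cells s , cells-unique s , (λ c → mk⇔ (proj₂ enclosed-cells c) (proj₁ enclosed-cells c)) ,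
      length-cells s

-- Both turns onto the top side raise it, so it lies above the origin and the final descent is not
-- empty.
close-signature : ∀ {R h} (s : Shape N R h) → Signature W S (close s)
close-signature s with top s in eq | pos-close s
... | suc H | end = end , _ , refl
close-signature (s ▸ nn _) | zero | _ with () ← eq
close-signature (s ▸ en)   | zero | _ with () ← eq

signature-close : ∀ w → PolygonTrail w → Signature W S w → ClosedShape w
signature-close _ (p , _) (end , w′ , refl) = west-closed w′ p end

-- The last step is vertical. If it went north, the vertical reflection would be a closed shape,
-- counter-clockwise by itself; the given polygon would then have winding number -1 around the image
-- of its top-left cell.
west-shape : ∀ w → WestPolygon (reverse w) → ClosedShape w
west-shape w (polygon , end , ccw) with signature w (polygon⁻ w polygon)
... | e , d , d⟂e , sig with vec-injective e W (trans (sym (proj₁ sig)) (trans (sym (endpoint-reverse w)) end))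
west-shape w (polygon , end , ccw) | W , S , _ , sig | refl = signature-close w (polygon⁻ w polygon) sig
west-shape w (polygon , end , ccw) | W , E , () , _ | refl
west-shape w (polygon , end , ccw) | W , W , () , _ | refl
west-shape w (polygon , end , ccw) | W , N , _ , sig | refl
  with signature-close (reflect vertically w) (polygon-reflect vertically w (polygon⁻ w polygon))
      (signature-reflect vertically {W} {N} sig)
... | R , h , s , eq = contradiction (trans (sym winding≡)
    (ccw c′ λ eq → contradiction (trans (sym winding≡) eq) λ ())) λ ()
  where
  c = -1ℤ , + top s + -1ℤ
  c′ = move-cell vertically c
  w≡ : reflect vertically (close s) ≡ w
  w≡ = trans (cong (reflect vertically) (sym eq)) (reflect-involutive vertically w)
  closed : pos (E ∷ close s) ≡ origin
  closed = cong (_⊞ vec E) (pos-close s)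
  winding≡ : windingNumber (reverse w) c′ ≡ -1ℤ
  winding≡ = begin
    windingNumber (reverse w) c′                     ≡⟨ closing-winding E w
        (cong (_⊞ vec E) (trans (sym (endpoint-reverse w)) end)) c′ ⟩
    winding (E ∷ w) c′                               ≡⟨ cong (λ w → winding (E ∷ w) c′) (sym w≡) ⟩
    winding (reflect vertically (E ∷ close s)) c′    ≡⟨ winding-reflect vertically (E ∷ close s) closed c ⟩
    - winding (E ∷ close s) c                        ≡⟨ cong -_ (sym (closing-winding E (close s) closed c)) ⟩
    - windingNumber (reverse (close s)) c            ≡⟨ cong -_
        (trans (closed-winding s c) (multiplicity-∈ (cells-unique s) (top-left∈ s))) ⟩
    -1ℤ                                              ∎
    where open ≡-Reasoning

close-injective : ∀ {R h R′ h′} (s : Shape N R h) (s′ : Shape N R′ h′) → close s ≡ close s′ → marked s 0 ≡ marked s′ 0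
close-injective s s′ eq = at-injective s s′ z≤n z≤n
    (proj₂ (decomposition-unique (top s) (top s′) S S W W (at s 0) (at s′ 0) eq
  (close-inflates s) (close-inflates s′) (origin∈visited (at s 0)) (end s) (origin∈visited (at s′ 0)) (end s′)))
  where
  -- The descent ends at the ordinate of the origin, so the origin serves as the site bounding the
  -- slide.
  end : ∀ {R h} (s : Shape N R h) → along S (pos (close s)) ≤ along S origin
  end s = ℤₚ.≤-reflexive (cong (along S) (pos-close s))

walk : ∀ {R h} → Shape N R h → Walk
walk s = reverse (close s)

top-removable : ∀ {R h k} (s : Shape N R h) .(k≤R : k ℕ.≤ R) → Class𝒳 (walk (s ▸ nn k≤R))
top-removable s k≤R = close-west (s ▸ nn k≤R) ,
    TopRowRemovable-resp (≐-sym (enclosed-cells (s ▸ nn k≤R))) (nn-removable s k≤R)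

not-top-removable : ∀ {R h} (s : Shape E R h) → ¬ Class𝒳 (walk (s ▸ en))
not-top-removable s (_ , removable) = en-not-top-removable s
    (TopRowRemovable-resp (enclosed-cells (s ▸ en)) removable)

-- A shape on the top side ends with `nn`, giving class 𝒳, or with `en`. These are the right sides
-- for which `en` gives 𝒴; the remaining ones, reached by `se`, give 𝒵.
data RightGrown : ∀ {R h} → Shape E R h → Set where
  unit   : RightGrown start
  by-row : ∀ {R h} (s : Shape N R h) → RightGrown (s ▸ ne)
  by-column : ∀ {R h k} (s : Shape E R h) .(k≤h : k ℕ.≤ h) → RightGrown (s ▸ ee k≤h)

right-removable : ∀ {R h} {s : Shape E R h} → RightGrown s → Class𝒴 (walk (s ▸ en))
right-removable unit = close-west (start ▸ en) , inj₁ (close-area (start ▸ en))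
right-removable (by-row s) = close-west (s ▸ ne ▸ en) , inj₂ (not-top-removable (s ▸ ne) ,
  RightmostColumnRemovable-resp (≐-sym (enclosed-cells (s ▸ ne ▸ en))) (ne-removable s))
right-removable (by-column s k≤h) = close-west (s ▸ ee k≤h ▸ en) , inj₂ (not-top-removable (s ▸ ee k≤h) ,
  RightmostColumnRemovable-resp (≐-sym (enclosed-cells (s ▸ ee k≤h ▸ en))) (ee-removable s k≤h))

not-right-removable : ∀ {R h} (s : Shape S R h) → ¬ Class𝒴 (walk (s ▸ se ▸ en))
not-right-removable s (_ , inj₂ (_ , removable)) =
  se-not-right-removable s (RightmostColumnRemovable-resp (enclosed-cells (s ▸ se ▸ en)) removable)
-- Closed from the bottom side, a polygon has width at least 2, so it is not the unit square.
not-right-removable s (_ , inj₁ area₁) = contradiction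
  (subst (2 ℕ.≤_) (HasCardinality-unique (close-area (s ▸ se ▸ en)) area₁)
      (ℕₚ.≤-trans (s≤s (s≤s z≤n)) (proj₁ (area-bounds s)))) λ { (s≤s ()) }

top-removable-exclusive : ∀ {R h k} (s : Shape N R h) .(k≤R : k ℕ.≤ R) → ¬ Class𝒴 (walk (s ▸ nn k≤R))
top-removable-exclusive s k≤R (_ , inj₂ (not-X , _)) = not-X (top-removable s k≤R)
top-removable-exclusive {k = k} s k≤R (_ , inj₁ area₁) = contradiction
  (subst (2 ℕ.≤_) (HasCardinality-unique (close-area (s ▸ nn k≤R)) area₁)
      (s≤s (ℕₚ.≤-trans (ℕₚ.≤-trans (s≤s z≤n) (proj₁ (area-bounds s))) (ℕₚ.m≤n+m (area s) k))))
  λ { (s≤s ()) }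

below : ∀ {R h} (s : Shape S R h) → Class𝒵 (walk (s ▸ se ▸ en))
below s = close-west (s ▸ se ▸ en) , not-top-removable (s ▸ se) , not-right-removable s

sizes : ∀ {R h n i j} (s : Shape N R h) → Area (Enclosed (walk s)) n → Width (Enclosed (walk s)) i →
    Height (Enclosed (walk s)) j →
  area s ≡ n × suc R ≡ i × h ≡ j
sizes s a w h = HasCardinality-unique (close-area s) a ,
  Extent-unique column (width-cells s) (Extent-resp column (enclosed-cells s) w) ,
  Extent-unique row (height-cells s) (Extent-resp row (enclosed-cells s) h)

sizes⁻ : ∀ {R h} (s : Shape N R h) → Area (Enclosed (walk s)) (area s) × Width (Enclosed (walk s)) (suc R) ×
    Height (Enclosed (walk s)) h
sizes⁻ s = close-area s , Extent-resp column (≐-sym (enclosed-cells s)) (width-cells s) ,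
    Extent-resp row (≐-sym (enclosed-cells s)) (height-cells s)

west-walk : ∀ w → WestPolygon w → ∃[ R ] ∃[ h ] Σ[ s ∈ Shape N R h ] w ≡ walk s
west-walk w west with west-shape (reverse w) (subst WestPolygon (sym (Listₚ.reverse-involutive w)) west)
... | R , h , s , eq = R , h , s , trans (sym (Listₚ.reverse-involutive w)) (cong reverse eq)

-- Enumeration by area

-- L m lists the elements of weight m, each of which gains weight k.
shifted : {A : Set} → ℕ → (ℕ → List A) → ℕ → List A
shifted zero    L n       = L n
shifted (suc k) L zero    = []
shifted (suc k) L (suc n) = shifted k L n

module _ {A : Set} where

  ∈-shifted⁺ : ∀ k (L : ℕ → List A) {n a} → a ∈ L n → a ∈ shifted k L (k ℕ.+ n)
  ∈-shifted⁺ zero    L a∈ = a∈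
  ∈-shifted⁺ (suc k) L a∈ = ∈-shifted⁺ k L a∈

  ∈-shifted⁻ : ∀ k (L : ℕ → List A) n {a} → a ∈ shifted k L n → ∃[ m ] k ℕ.+ m ≡ n × a ∈ L m
  ∈-shifted⁻ zero    L n       a∈ = n , refl , a∈
  ∈-shifted⁻ (suc k) L (suc n) a∈ = let m , eq , a∈L = ∈-shifted⁻ k L n a∈ in m , cong suc eq , a∈L

  shifted-unique : ∀ k (L : ℕ → List A) n → (∀ m → Unique (L m)) → Unique (shifted k L n)
  shifted-unique zero    L n       unique = unique n
  shifted-unique (suc k) L zero    unique = []
  shifted-unique (suc k) L (suc n) unique = shifted-unique k L n unique

  restrict : ∀ {R} → (∀ k → .(k ℕ.≤ suc R) → List A) → ∀ k → .(k ℕ.≤ R) → List A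
  restrict f k k≤R = f k (ℕₚ.m≤n⇒m≤1+n k≤R)

  bounded : ∀ R → (∀ k → .(k ℕ.≤ R) → List A) → List A
  bounded zero    f = f 0 z≤n
  bounded (suc R) f = bounded R (restrict f) ++ f (suc R) ℕₚ.≤-refl

  ∈-bounded⁺ : ∀ R f k (k≤R : k ℕ.≤ R) {a} → a ∈ f k k≤R → a ∈ bounded R f
  ∈-bounded⁺ zero    f zero z≤n a∈ = a∈
  ∈-bounded⁺ (suc R) f k    k≤ a∈ with ℕₚ.m≤n⇒m<n∨m≡n k≤
  ... | inj₁ (s≤s k≤R) = ∈-++⁺ˡ (∈-bounded⁺ R (restrict f) k k≤R a∈)
  ... | inj₂ refl      = ∈-++⁺ʳ (bounded R (restrict f)) a∈

  ∈-bounded⁻ : ∀ R f {a} → a ∈ bounded R f → ∃[ k ] Σ[ k≤R ∈ k ℕ.≤ R ] a ∈ f k k≤R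
  ∈-bounded⁻ zero    f a∈ = 0 , z≤n , a∈
  ∈-bounded⁻ (suc R) f a∈ with ∈-++⁻ (bounded R (restrict f)) a∈
  ... | inj₁ a∈ˡ = let k , k≤R , a∈f = ∈-bounded⁻ R (restrict f) a∈ˡ in k , ℕₚ.m≤n⇒m≤1+n k≤R , a∈f
  ... | inj₂ a∈ʳ = suc R , ℕₚ.≤-refl , a∈ʳ

  bounded-unique : ∀ R f → (∀ k .(k≤R : k ℕ.≤ R) → Unique (f k k≤R)) →
    (∀ k k′ (k≤R : k ℕ.≤ R) (k′≤R : k′ ℕ.≤ R) {a} → a ∈ f k k≤R → a ∈ f k′ k′≤R → k ≡ k′) → Unique (bounded R f)
  bounded-unique zero    f unique _ = unique 0 z≤n
  bounded-unique (suc R) f unique separate = Uniqueₚ.++⁺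
    (bounded-unique R (restrict f) (λ k k≤R → unique k (ℕₚ.m≤n⇒m≤1+n k≤R))
      λ k k′ k≤R k′≤R → separate k k′ (ℕₚ.m≤n⇒m≤1+n k≤R) (ℕₚ.m≤n⇒m≤1+n k′≤R))
    (unique (suc R) ℕₚ.≤-refl)
    λ (a∈ˡ , a∈ʳ) → let k , k≤R , a∈f = ∈-bounded⁻ R (restrict f) a∈ˡ in
      ℕₚ.<⇒≢ (s≤s k≤R) (separate k (suc R) (ℕₚ.m≤n⇒m≤1+n k≤R) ℕₚ.≤-refl a∈f a∈ʳ)

guarded : {A : Set} → ℕ → ℕ → List A → List A
guarded b n xs = if n <ᵇ b then [] else xs

∈-guarded⁻ : ∀ {A : Set} b n {xs : List A} {a} → a ∈ guarded b n xs → a ∈ xs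
∈-guarded⁻ b n a∈ with n <ᵇ b
... | false = a∈

guarded-id : ∀ {A : Set} b n (xs : List A) → (∀ {a} → a ∈ xs → b ℕ.≤ n) → guarded b n xs ≡ xs
guarded-id b n xs bound with n <ᵇ b | ℕₚ.<ᵇ⇒< n b
guarded-id b n xs       bound | false | _   = refl
guarded-id b n []       bound | true  | _   = refl
guarded-id b n (x ∷ xs) bound | true  | n<b = contradiction (n<b tt) (ℕₚ.≤⇒≯ (bound (here refl)))

▸-injective : ∀ {d R h x d′ R′ h′ y} (t : Turn d R h x d′ R′ h′ y) {s s′ : Shape d R h} → s ▸ t ≡ s′ ▸ t → s ≡ s′
▸-injective t refl = refl

▸-exit : ∀ {d R h x x′ d′ R′ h′ y y′} {s s′ : Shape d R h} {t : Turn d R h x d′ R′ h′ y}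
    {t′ : Turn d R h x′ d′ R′ h′ y′} →
  s ▸ t ≡ s′ ▸ t′ → x ≡ x′
▸-exit refl = refl

turned : ∀ {d R h x d′ R′ h′ y} → Turn d R h x d′ R′ h′ y → (ℕ → List (Shape d R h)) → ℕ → List (Shape d′ R′ h′)
turned t L = shifted (cost t) λ m → map (_▸ t) (L m)

-- For the turns that leave a side straight outwards, which is possible at every position `k` up to
-- `B`. Their strips of k + 1 cells make up the finite geometric sums.
swept : ∀ {d R h d′ R′ h′} B → (∀ {k} → .(k ℕ.≤ B) → Turn d R h k d′ R′ h′ k) →
  (ℕ → List (Shape d R h)) → ℕ → List (Shape d′ R′ h′)
swept B t L n = bounded B λ k k≤B → turned (t k≤B) L n

module _ {d d′ : Direction} {R h R′ h′ : ℕ} (L : ℕ → List (Shape d R h)) where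

  ∈-turned⁺ : ∀ {x y n} (t : Turn d R h x d′ R′ h′ y) {s} → s ∈ L n → s ▸ t ∈ turned t L (cost t ℕ.+ n)
  ∈-turned⁺ t s∈ = ∈-shifted⁺ (cost t) (λ m → map (_▸ t) (L m)) (∈-map⁺ (_▸ t) s∈)

  ∈-turned⁻ : ∀ {x y} n (t : Turn d R h x d′ R′ h′ y) {s} → s ∈ turned t L n →
    ∃[ m ] cost t ℕ.+ m ≡ n × ∃[ s′ ] s′ ∈ L m × s ≡ s′ ▸ t
  ∈-turned⁻ n t s∈ = let m , eq , s∈L = ∈-shifted⁻ (cost t) (λ m → map (_▸ t) (L m)) n s∈ in m , eq , ∈-map⁻ (_▸ t) s∈L

  turned-unique : ∀ {x y} n (t : Turn d R h x d′ R′ h′ y) → (∀ m → Unique (L m)) → Unique (turned t L n)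
  turned-unique n t unique = shifted-unique (cost t) (λ m → map (_▸ t) (L m)) n λ m →
      Uniqueₚ.map⁺ (▸-injective t) (unique m)

  module _ (B : ℕ) (t : ∀ {k} → .(k ℕ.≤ B) → Turn d R h k d′ R′ h′ k) where

    ∈-swept⁺ : ∀ {k n} (k≤B : k ℕ.≤ B) {s} → s ∈ L n → s ▸ t k≤B ∈ swept B t L (cost (t k≤B) ℕ.+ n)
    ∈-swept⁺ {k} {n} k≤B s∈ = ∈-bounded⁺ B (λ _ l≤B → turned (t l≤B) L (cost (t k≤B) ℕ.+ n)) k k≤B
        (∈-turned⁺ (t k≤B) s∈)

    ∈-swept⁻ : ∀ n {s} → s ∈ swept B t L n →
      ∃[ k ] Σ[ k≤B ∈ k ℕ.≤ B ] ∃[ m ] cost (t k≤B) ℕ.+ m ≡ n × ∃[ s′ ] s′ ∈ L m × s ≡ s′ ▸ t k≤B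
    ∈-swept⁻ n s∈ =
      let k , k≤B , s∈k = ∈-bounded⁻ B (λ _ k≤B → turned (t k≤B) L n) s∈
      in k , k≤B , ∈-turned⁻ n (t k≤B) s∈k

    swept-unique : ∀ n → (∀ m → Unique (L m)) → Unique (swept B t L n)
    swept-unique n unique = bounded-unique B (λ _ k≤B → turned (t k≤B) L n) (λ _ k≤B → turned-unique n (t k≤B) unique)
      λ k k′ k≤B k′≤B s∈ s∈′ →
        let _ , _ , _ , _ , s≡ = ∈-turned⁻ n (t k≤B) s∈
            _ , _ , _ , _ , s≡′ = ∈-turned⁻ n (t k′≤B) s∈′
        in ▸-exit (trans (sym s≡) s≡′)

unit-shapes : ℕ → List (Shape E 0 0)
unit-shapes (suc zero) = [ start ]
unit-shapes _          = []

-- The guard in E-shapes only speeds up the evaluation of the coefficients.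
-- top-grown gives the class 𝒳, and right-grown and from-below give the classes
-- 𝒴 and 𝒵 once the shape is closed by a turn to the top.
N-shapes top-grown : ∀ R h → ℕ → List (Shape N R h)
E-shapes right-grown from-below : ∀ R h → ℕ → List (Shape E R h)
S-shapes : ∀ R h → ℕ → List (Shape S R h)

N-shapes R zero    n = []
N-shapes R (suc h) n = top-grown R (suc h) n ++ (map (_▸ en) (right-grown R h n) ++ map (_▸ en) (from-below R h n))

top-grown R zero    n = []
top-grown R (suc h) n = swept R nn (N-shapes R h) n

E-shapes R h n = guarded (R ℕ.+ suc h) n (right-grown R h n ++ from-below R h n)

right-grown zero    zero    n = unit-shapes n
right-grown zero    (suc h) n = []
right-grown (suc R) h       n = turned ne (N-shapes R h) n ++ swept h ee (E-shapes R h) n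

from-below zero    h n = []
from-below (suc R) h n = map (_▸ se) (S-shapes R h n)

S-shapes R zero    n = []
S-shapes R (suc h) n = turned es (E-shapes R h) n ++ swept R ss (S-shapes R h) n

data TopGrown : ∀ {R h} → Shape N R h → Set where
  by-row : ∀ {R h k} (s : Shape N R h) .(k≤R : k ℕ.≤ R) → TopGrown (s ▸ nn k≤R)

data FromBelow : ∀ {R h} → Shape E R h → Set where
  risen : ∀ {R h} (s : Shape S R h) → FromBelow (s ▸ se)

N-sound : ∀ R h n {s} → s ∈ N-shapes R h n → area s ≡ n
E-sound : ∀ R h n {s} → s ∈ E-shapes R h n → area s ≡ n
listed-sound : ∀ R h n {s} → s ∈ right-grown R h n ++ from-below R h n → area s ≡ n
S-sound : ∀ R h n {s} → s ∈ S-shapes R h n → area s ≡ n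
top-sound : ∀ R h n {s} → s ∈ top-grown R h n → TopGrown s × area s ≡ n
right-sound : ∀ R h n {s} → s ∈ right-grown R h n → RightGrown s × area s ≡ n
below-sound : ∀ R h n {s} → s ∈ from-below R h n → FromBelow s × area s ≡ n

N-sound R (suc h) n s∈ with ∈-++⁻ (top-grown R (suc h) n) s∈
... | inj₁ s∈top = proj₂ (top-sound R (suc h) n s∈top)
... | inj₂ s∈en with ∈-++⁻ (map (_▸ en) (right-grown R h n)) s∈en
...   | inj₁ s∈r with _ , s′∈ , refl ← ∈-map⁻ (_▸ en) s∈r = proj₂ (right-sound R h n s′∈)
...   | inj₂ s∈b with _ , s′∈ , refl ← ∈-map⁻ (_▸ en) s∈b = proj₂ (below-sound R h n s′∈)
E-sound R h n s∈ = listed-sound R h n (∈-guarded⁻ (R ℕ.+ suc h) n s∈)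
listed-sound R h n s∈ with ∈-++⁻ (right-grown R h n) s∈
... | inj₁ s∈r = proj₂ (right-sound R h n s∈r)
... | inj₂ s∈b = proj₂ (below-sound R h n s∈b)
S-sound R (suc h) n s∈ with ∈-++⁻ (turned es (E-shapes R h) n) s∈
... | inj₁ s∈es with m , refl , _ , s′∈ , refl ← ∈-turned⁻ (E-shapes R h) n es s∈es =
    cong (suc (suc h) ℕ.+_) (E-sound R h m s′∈)
... | inj₂ s∈ss with k , k≤R , m , refl , _ , s′∈ , refl ← ∈-swept⁻ (S-shapes R h) R ss n s∈ss =
    cong (suc k ℕ.+_) (S-sound R h m s′∈)
top-sound R (suc h) n s∈ with k , k≤R , m , refl , s′ , s′∈ , refl ← ∈-swept⁻ (N-shapes R h) R nn n s∈ =
  by-row s′ k≤R , cong (suc k ℕ.+_) (N-sound R h m s′∈)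
right-sound zero    zero    zero          ()
right-sound zero    zero    (suc zero)    (here refl) = unit , refl
right-sound zero    zero    (suc (suc _)) ()
right-sound zero    (suc h) n             ()
right-sound (suc R) h       n             s∈ with ∈-++⁻ (turned ne (N-shapes R h) n) s∈
... | inj₁ s∈ne with m , refl , s′ , s′∈ , refl ← ∈-turned⁻ (N-shapes R h) n ne s∈ne =
  by-row s′ , cong (suc (suc R) ℕ.+_) (N-sound R h m s′∈)
... | inj₂ s∈ee with k , k≤h , m , refl , s′ , s′∈ , refl ← ∈-swept⁻ (E-shapes R h) h ee n s∈ee =
  by-column s′ k≤h , cong (suc k ℕ.+_) (E-sound R h m s′∈)
below-sound (suc R) h n s∈ with s′ , s′∈ , refl ← ∈-map⁻ (_▸ se) s∈ = risen s′ , S-sound R h n s′∈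

-- The familiar bound for connected polyominoes, width + height - 1 at most the area; `closed-right`
-- is the width minus one. It shows that the guard in `E-shapes` discards nothing.
semiperimeter : ∀ {d R h} (s : Shape d R h) → closed-right d R ℕ.+ closed-height d h ℕ.≤ area s
semiperimeter start = s≤s z≤n
semiperimeter (s ▸ t) = go t (semiperimeter s)
  where
  go : ∀ {d R h x d′ R′ h′ y a} (t : Turn d R h x d′ R′ h′ y) → closed-right d R ℕ.+ closed-height d h ℕ.≤ a →
    closed-right d′ R′ ℕ.+ closed-height d′ h′ ℕ.≤ cost t ℕ.+ a
  go (nn {R} {h} {k} _) le = ℕₚ.≤-trans (ℕₚ.≤-reflexive (ℕₚ.+-suc R h)) (s≤s (ℕₚ.≤-trans le (ℕₚ.m≤n+m _ k)))
  go en                 le = le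
  go (ne {R} {h})       le = s≤s (ℕₚ.≤-trans (ℕₚ.≤-reflexive (ℕₚ.+-suc R h)) (s≤s (ℕₚ.≤-trans le (ℕₚ.m≤n+m _ R))))
  go (ee {k = k} _)     le = s≤s (ℕₚ.≤-trans le (ℕₚ.m≤n+m _ k))
  go se                 le = le
  go (es {R} {h})       le = s≤s (ℕₚ.≤-trans (ℕₚ.≤-reflexive (ℕₚ.+-suc R (suc h)))
      (s≤s (ℕₚ.≤-trans le (ℕₚ.m≤n+m _ h))))
  go (ss {R} {h} {k} _) le = ℕₚ.≤-trans (ℕₚ.≤-reflexive (ℕₚ.+-suc (suc R) (suc h)))
      (s≤s (ℕₚ.≤-trans le (ℕₚ.m≤n+m _ k)))

E-shapes≡ : ∀ R h n → E-shapes R h n ≡ right-grown R h n ++ from-below R h n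
E-shapes≡ R h n = guarded-id (R ℕ.+ suc h) n (right-grown R h n ++ from-below R h n)
  λ {s} s∈ → subst (R ℕ.+ suc h ℕ.≤_) (listed-sound R h n s∈) (semiperimeter s)

N-complete : ∀ {R h} (s : Shape N R h) → s ∈ N-shapes R h (area s)
E-complete : ∀ {R h} (s : Shape E R h) → s ∈ E-shapes R h (area s)
E-listed : ∀ {R h} (s : Shape E R h) → s ∈ right-grown R h (area s) ⊎ s ∈ from-below R h (area s)
S-complete : ∀ {R h} (s : Shape S R h) → s ∈ S-shapes R h (area s)
top-complete : ∀ {R h k} (s : Shape N R h) .(k≤R : k ℕ.≤ R) → s ▸ nn k≤R ∈ top-grown R (suc h) (suc k ℕ.+ area s)
right-complete : ∀ {R h} {s : Shape E R h} → RightGrown s → s ∈ right-grown R h (area s)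
below-complete : ∀ {R h} (s : Shape S R h) → s ▸ se ∈ from-below (suc R) h (area s)

N-complete (s ▸ nn k≤R) = ∈-++⁺ˡ (top-complete s k≤R)
N-complete {R} (_▸_ {h = h} s en) with E-listed s
... | inj₁ s∈ = ∈-++⁺ʳ (top-grown R (suc h) (area s)) (∈-++⁺ˡ (∈-map⁺ (_▸ en) s∈))
... | inj₂ s∈ = ∈-++⁺ʳ (top-grown R (suc h) (area s))
    (∈-++⁺ʳ (map (_▸ en) (right-grown R h (area s))) (∈-map⁺ (_▸ en) s∈))
E-complete {R} {h} s = subst (s ∈_) (sym (E-shapes≡ R h (area s)))
  ([ ∈-++⁺ˡ , ∈-++⁺ʳ (right-grown R h (area s)) ]′ (E-listed s))
E-listed start        = inj₁ (right-complete unit)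
E-listed (s ▸ ne)     = inj₁ (right-complete (by-row s))
E-listed (s ▸ ee k≤h) = inj₁ (right-complete (by-column s k≤h))
E-listed (s ▸ se)     = inj₂ (below-complete s)
S-complete (_▸_ {R = R} {h} s es) = ∈-++⁺ˡ (∈-turned⁺ (E-shapes R h) es (E-complete s))
S-complete (_▸_ {R = R} {h} {x = k} s (ss k≤R)) = ∈-++⁺ʳ (turned es (E-shapes R h) (suc k ℕ.+ area s))
  (∈-swept⁺ (S-shapes R h) R ss (recompute-≤ k≤R) (S-complete s))
top-complete {R} {h} s k≤R = ∈-swept⁺ (N-shapes R h) R nn (recompute-≤ k≤R) (N-complete s)
right-complete unit = here refl
right-complete (by-row {R} {h} s) = ∈-++⁺ˡ (∈-turned⁺ (N-shapes R h) ne (N-complete s))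
right-complete (by-column {R} {h} {k} s k≤h) = ∈-++⁺ʳ (turned ne (N-shapes R h) (suc k ℕ.+ area s))
  (∈-swept⁺ (E-shapes R h) h ee (recompute-≤ k≤h) (E-complete s))
below-complete s = ∈-map⁺ (_▸ se) (S-complete s)

right-or-below : ∀ {R h} {s : Shape E R h} → RightGrown s → FromBelow s → ⊥
right-or-below unit            ()
right-or-below (by-row _)      ()
right-or-below (by-column _ _) ()

N-unique : ∀ R h n → Unique (N-shapes R h n)
E-unique : ∀ R h n → Unique (E-shapes R h n)
S-unique : ∀ R h n → Unique (S-shapes R h n)
top-unique : ∀ R h n → Unique (top-grown R h n)
right-unique : ∀ R h n → Unique (right-grown R h n)
below-unique : ∀ R h n → Unique (from-below R h n)

N-unique R zero    n = []
N-unique R (suc h) n = Uniqueₚ.++⁺ (top-unique R (suc h) n)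
  (Uniqueₚ.++⁺ (Uniqueₚ.map⁺ (▸-injective en) (right-unique R h n))
      (Uniqueₚ.map⁺ (▸-injective en) (below-unique R h n)) separate)
  top-or-en
  where
  separate : ∀ {s} → s ∈ map (_▸ en) (right-grown R h n) × s ∈ map (_▸ en) (from-below R h n) → ⊥
  separate (s∈r , s∈b) with ∈-map⁻ (_▸ en) s∈r | ∈-map⁻ (_▸ en) s∈b
  ... | _ , s∈ , refl | _ , s∈′ , refl = right-or-below (proj₁ (right-sound R h n s∈)) (proj₁ (below-sound R h n s∈′))
  top-or-en : ∀ {s} → s ∈ top-grown R (suc h) n × s ∈ map (_▸ en) (right-grown R h n) ++
      map (_▸ en) (from-below R h n) → ⊥
  top-or-en (s∈t , s∈e) with proj₁ (top-sound R (suc h) n s∈t) | ∈-++⁻ (map (_▸ en) (right-grown R h n)) s∈e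
  ... | by-row _ _ | inj₁ s∈r with () ← proj₂ (proj₂ (∈-map⁻ (_▸ en) s∈r))
  ... | by-row _ _ | inj₂ s∈b with () ← proj₂ (proj₂ (∈-map⁻ (_▸ en) s∈b))
E-unique R h n = subst Unique (sym (E-shapes≡ R h n)) (Uniqueₚ.++⁺ (right-unique R h n) (below-unique R h n)
  λ (s∈r , s∈b) → right-or-below (proj₁ (right-sound R h n s∈r)) (proj₁ (below-sound R h n s∈b)))
S-unique R zero    n = []
S-unique R (suc h) n = Uniqueₚ.++⁺ (turned-unique (E-shapes R h) n es (E-unique R h))
    (swept-unique (S-shapes R h) R ss n (S-unique R h)) separate
  where
  separate : ∀ {s} → s ∈ turned es (E-shapes R h) n × s ∈ swept R ss (S-shapes R h) n → ⊥
  separate (s∈ , s∈′) with ∈-turned⁻ (E-shapes R h) n es s∈ | ∈-swept⁻ (S-shapes R h) R ss n s∈′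
  ... | _ , _ , _ , _ , refl | _ , _ , _ , _ , _ , _ , ()
top-unique R zero    n = []
top-unique R (suc h) n = swept-unique (N-shapes R h) R nn n (N-unique R h)
right-unique zero    zero    zero          = []
right-unique zero    zero    (suc zero)    = [] ∷ []
right-unique zero    zero    (suc (suc n)) = []
right-unique zero    (suc h) n             = []
right-unique (suc R) h       n             =
  Uniqueₚ.++⁺ (turned-unique (N-shapes R h) n ne (N-unique R h)) (swept-unique (E-shapes R h) h ee n (E-unique R h))
      separate
  where
  separate : ∀ {s} → s ∈ turned ne (N-shapes R h) n × s ∈ swept h ee (E-shapes R h) n → ⊥
  separate (s∈ , s∈′) with ∈-turned⁻ (N-shapes R h) n ne s∈ | ∈-swept⁻ (E-shapes R h) h ee n s∈′
  ... | _ , _ , _ , _ , refl | _ , _ , _ , _ , _ , _ , ()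
below-unique zero    h n = []
below-unique (suc R) h n = Uniqueₚ.map⁺ (▸-injective se) (S-unique R h n)

-- Formal power series

∑≤-cong : ∀ n {f g} → (∀ a → f a ≡ g a) → ∑≤ n f ≡ ∑≤ n g
∑≤-cong zero    f≡g = f≡g 0
∑≤-cong (suc n) f≡g = cong₂ _+_ (∑≤-cong n f≡g) (f≡g (suc n))

∑≤-zero : ∀ n {f} → (∀ a → f a ≡ 0ℤ) → ∑≤ n f ≡ 0ℤ
∑≤-zero zero    f≡0 = f≡0 0
∑≤-zero (suc n) f≡0 = cong₂ _+_ (∑≤-zero n f≡0) (f≡0 (suc n))

∑≤-suc : ∀ n f → ∑≤ (suc n) f ≡ f 0 + ∑≤ n (f ∘ suc)
∑≤-suc zero    f = refl
∑≤-suc (suc n) f = trans (cong (_+ f (suc (suc n))) (∑≤-suc n f))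
    (ℤₚ.+-assoc (f 0) (∑≤ n (f ∘ suc)) (f (suc (suc n))))

∑≤-first : ∀ n {f} → (∀ a → f (suc a) ≡ 0ℤ) → ∑≤ n f ≡ f 0
∑≤-first zero        f≡0 = refl
∑≤-first (suc n) {f} f≡0 = trans (∑≤-suc n f) (trans (cong (_+_ (f 0)) (∑≤-zero n f≡0)) (ℤₚ.+-identityʳ (f 0)))

∑≤-rest : ∀ n {f} → f 0 ≡ 0ℤ → ∑≤ (suc n) f ≡ ∑≤ n (f ∘ suc)
∑≤-rest n {f} f0≡0 = trans (∑≤-suc n f) (trans (cong (_+ ∑≤ n (f ∘ suc)) f0≡0) (ℤₚ.+-identityˡ (∑≤ n (f ∘ suc))))

∑≤-+ : ∀ n f g → ∑≤ n (λ a → f a + g a) ≡ ∑≤ n f + ∑≤ n g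
∑≤-+ zero    f g = refl
∑≤-+ (suc n) f g = trans (cong (_+ (f (suc n) + g (suc n))) (∑≤-+ n f g))
    (lem (∑≤ n f) (∑≤ n g) (f (suc n)) (g (suc n)))
  where
  lem : ∀ a b c d → a + b + (c + d) ≡ a + c + (b + d)
  lem = solve-∀

≈-trans : ∀ {F G H} → F ≈ G → G ≈ H → F ≈ H
≈-trans F≈G G≈H n i j = trans (F≈G n i j) (G≈H n i j)

⊗-congˡ : ∀ {F G} H → F ≈ G → F ⊗ H ≈ G ⊗ H
⊗-congˡ H F≈G n i j = ∑≤-cong n λ a → ∑≤-cong i λ b → ∑≤-cong j λ c → cong (_* H (n ∸ a) (i ∸ b) (j ∸ c)) (F≈G a b c)

-- Multiplication by a variable as an index shift, which reduces as soon as the exponent is known to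
-- be zero or a successor.
q· u· v· : Series → Series
q· F zero    i j = 0ℤ
q· F (suc n) i j = F n i j
u· F n zero    j = 0ℤ
u· F n (suc i) j = F n i j
v· F n i zero    = 0ℤ
v· F n i (suc j) = F n i j

q·-cong : ∀ {F G} → F ≈ G → q· F ≈ q· G
q·-cong F≈G zero    i j = refl
q·-cong F≈G (suc n) i j = F≈G n i j

u·-cong : ∀ {F G} → F ≈ G → u· F ≈ u· G
u·-cong F≈G n zero    j = refl
u·-cong F≈G n (suc i) j = F≈G n i j

v·-cong : ∀ {F G} → F ≈ G → v· F ≈ v· G
v·-cong F≈G n i zero    = refl
v·-cong F≈G n i (suc j) = F≈G n i j

q·-⊗ : ∀ F G → q· F ⊗ G ≈ q· (F ⊗ G)
q·-⊗ F G zero    i j = ∑≤-zero i λ b → ∑≤-zero j λ c → refl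
q·-⊗ F G (suc n) i j = ∑≤-rest n (∑≤-zero i λ b → ∑≤-zero j λ c → refl)

u·-⊗ : ∀ F G → u· F ⊗ G ≈ u· (F ⊗ G)
u·-⊗ F G n zero    j = ∑≤-zero n λ a → ∑≤-zero j λ c → refl
u·-⊗ F G n (suc i) j = ∑≤-cong n λ a → ∑≤-rest i (∑≤-zero j λ c → refl)

v·-⊗ : ∀ F G → v· F ⊗ G ≈ v· (F ⊗ G)
v·-⊗ F G n i zero    = ∑≤-zero n λ a → ∑≤-zero i λ b → refl
v·-⊗ F G n i (suc j) = ∑≤-cong n λ a → ∑≤-cong i λ b → ∑≤-rest j refl

one : Series
one = monomial 0 0 0

one-⊗ : ∀ F → one ⊗ F ≈ F
one-⊗ F n i j = trans (∑≤-first n λ a → ∑≤-zero i λ b → ∑≤-zero j λ c → refl)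
  (trans (∑≤-first i λ b → ∑≤-zero j λ c → refl)
    (trans (∑≤-first j λ c → refl) (ℤₚ.*-identityˡ (F n i j))))

q≈ : q ≈ q· one
q≈ zero    i j = refl
q≈ (suc n) i j = refl

u≈ : u ≈ u· one
u≈ zero    zero    j = refl
u≈ (suc n) zero    j = refl
u≈ zero    (suc i) j = refl
u≈ (suc n) (suc i) j = refl

v≈ : v ≈ v· one
v≈ zero    zero    zero    = refl
v≈ zero    zero    (suc j) = refl
v≈ zero    (suc i) zero    = refl
v≈ zero    (suc i) (suc j) = refl
v≈ (suc n) i       zero    = refl
v≈ (suc n) i       (suc j) = refl

q-⊗ : ∀ F → q ⊗ F ≈ q· F
q-⊗ F = ≈-trans (⊗-congˡ F q≈) (≈-trans (q·-⊗ one F) (q·-cong (one-⊗ F)))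

u-⊗ : ∀ F → u ⊗ F ≈ u· F
u-⊗ F = ≈-trans (⊗-congˡ F u≈) (≈-trans (u·-⊗ one F) (u·-cong (one-⊗ F)))

v-⊗ : ∀ F → v ⊗ F ≈ v· F
v-⊗ F = ≈-trans (⊗-congˡ F v≈) (≈-trans (v·-⊗ one F) (v·-cong (one-⊗ F)))

-- Summed downwards, because convolution with the geometric series meets the coefficients in this
-- order.
partial : ℕ → (ℕ → ℤ) → ℤ
partial zero    f = f 0
partial (suc n) f = f (suc n) + partial n f

geometric : Series → Series
geometric F n i j = partial n λ m → F m i j

∑≤-reverse : ∀ n f → ∑≤ n (λ a → f (n ∸ a)) ≡ partial n f
∑≤-reverse zero    f = refl
∑≤-reverse (suc n) f = trans (∑≤-suc n (λ a → f (suc n ∸ a))) (cong (_+_ (f (suc n))) (∑≤-reverse n f))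

geometric-⊗ : ∀ F → 1/⟨1-q⟩ ⊗ F ≈ geometric F
geometric-⊗ F n i j = trans (∑≤-cong n λ a → trans (∑≤-first i λ b → ∑≤-zero j λ c → refl)
    (trans (∑≤-first j λ c → refl) (ℤₚ.*-identityˡ (F (n ∸ a) i j))))
  (∑≤-reverse n λ m → F m i j)

qv-⊗ : ∀ F → q ⊗ v ⊗ F ≈ q· (v· F)
qv-⊗ F = ≈-trans (⊗-congˡ F (q-⊗ v)) (≈-trans (q·-⊗ v F) (q·-cong (v-⊗ F)))

qu-⊗ : ∀ F → q ⊗ u ⊗ F ≈ q· (u· F)
qu-⊗ F = ≈-trans (⊗-congˡ F (q-⊗ u)) (≈-trans (q·-⊗ u F) (q·-cong (u-⊗ F)))

quv-⊗ : ∀ F → q ⊗ u ⊗ v ⊗ F ≈ q· (u· (v· F))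
quv-⊗ F = ≈-trans (⊗-congˡ F (qu-⊗ v)) (≈-trans (q·-⊗ (u· v) F) (q·-cong (≈-trans (u·-⊗ v F) (u·-cong (v-⊗ F)))))

qv-geometric : ∀ F → q ⊗ v ⊗ 1/⟨1-q⟩ ⊗ F ≈ q· (v· (geometric F))
qv-geometric F = ≈-trans (⊗-congˡ F (qv-⊗ 1/⟨1-q⟩)) (≈-trans (q·-⊗ (v· 1/⟨1-q⟩) F)
  (q·-cong (≈-trans (v·-⊗ 1/⟨1-q⟩ F) (v·-cong (geometric-⊗ F)))))

quv-geometric : ∀ F → q ⊗ u ⊗ v ⊗ 1/⟨1-q⟩ ⊗ F ≈ q· (u· (v· (geometric F)))
quv-geometric F = ≈-trans (⊗-congˡ F (quv-⊗ 1/⟨1-q⟩)) (≈-trans (q·-⊗ (u· (v· 1/⟨1-q⟩)) F)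
  (q·-cong (≈-trans (u·-⊗ (v· 1/⟨1-q⟩) F) (u·-cong (≈-trans (v·-⊗ 1/⟨1-q⟩ F) (v·-cong (geometric-⊗ F)))))))

qvv-geometric : ∀ F → q ⊗ (v ⊗ v) ⊗ 1/⟨1-q⟩ ⊗ F ≈ q· (v· (v· (geometric F)))
qvv-geometric F = ≈-trans (⊗-congˡ F (≈-trans (⊗-congˡ 1/⟨1-q⟩ (≈-trans (q-⊗ (v ⊗ v)) (q·-cong (v-⊗ v))))
    (≈-trans (q·-⊗ (v· v) 1/⟨1-q⟩) (q·-cong (≈-trans (v·-⊗ v 1/⟨1-q⟩) (v·-cong (v-⊗ 1/⟨1-q⟩)))))))
  (≈-trans (q·-⊗ (v· (v· 1/⟨1-q⟩)) F) (q·-cong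
      (≈-trans (v·-⊗ (v· 1/⟨1-q⟩) F) (v·-cong (≈-trans (v·-⊗ 1/⟨1-q⟩ F) (v·-cong (geometric-⊗ F)))))))

-- The coefficients of q^k f(q). The substitutions u to qu and v to qv have this form once the
-- exponents of u and v are fixed.
delayed : ℕ → (ℕ → ℤ) → ℕ → ℤ
delayed k f n = if n <ᵇ k then 0ℤ else f (n ∸ k)

delayed-cong : ∀ k {f g} n → (∀ m → f m ≡ g m) → delayed k f n ≡ delayed k g n
delayed-cong k n f≡g with n <ᵇ k
... | true  = refl
... | false = f≡g (n ∸ k)

delayed-zero : ∀ k {f} n → (∀ m → f m ≡ 0ℤ) → delayed k f n ≡ 0ℤ
delayed-zero k n f≡0 with n <ᵇ k
... | true  = refl
... | false = f≡0 (n ∸ k)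

delayed-+ : ∀ k f g n → delayed k (λ m → f m + g m) n ≡ delayed k f n + delayed k g n
delayed-+ k f g n with n <ᵇ k
... | true  = refl
... | false = refl

partial-cong : ∀ n {f g} → (∀ m → f m ≡ g m) → partial n f ≡ partial n g
partial-cong zero    f≡g = f≡g 0
partial-cong (suc n) f≡g = cong₂ _+_ (f≡g (suc n)) (partial-cong n f≡g)

partial-- : ∀ n f g → partial n (λ m → f m - g m) ≡ partial n f - partial n g
partial-- zero    f g = refl
partial-- (suc n) f g = trans (cong (_+_ (f (suc n) - g (suc n))) (partial-- n f g))
    (lem (f (suc n)) (g (suc n)) (partial n f) (partial n g))
  where
  lem : ∀ a b c d → a - b + (c - d) ≡ a + c - (b + d)
  lem = solve-∀

partial-delay : ∀ k f n → partial n (delayed k f) ≡ partial n (delayed (suc k) f) + delayed k f n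
partial-delay k f zero    = sym (ℤₚ.+-identityˡ (delayed k f 0))
partial-delay k f (suc n) = trans (cong (_+_ (delayed k f (suc n))) (partial-delay k f n))
  (lem (delayed k f (suc n)) (partial n (delayed (suc k) f)) (delayed k f n))
  where
  lem : ∀ a b c → a + (b + c) ≡ c + b + a
  lem = solve-∀

-- (1 - qᵏ⁺¹) / (1 - q) = 1 + q + … + qᵏ.
window : ∀ k f n → partial n f ≡ partial n (delayed (suc k) f) + ∑≤ k λ t → delayed t f n
window zero    f n = partial-delay 0 f n
window (suc k) f n = trans (window k f n) (trans (cong (_+ ∑≤ k λ t → delayed t f n) (partial-delay (suc k) f n))
  (lem (partial n (delayed (suc (suc k)) f)) (delayed (suc k) f n) (∑≤ k λ t → delayed t f n)))
  where
  lem : ∀ a b c → a + b + c ≡ a + (c + b)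
  lem = solve-∀

-- Dividing f - q^(k+1) f by 1 - q leaves (1 + q + ... + q^k) f: the difference quotients in the
-- functional equations are the finite sums over strips.
partial-window : ∀ k f g n → (∀ m → g m ≡ delayed (suc k) f m) → partial n (λ m → f m - g m) ≡ ∑≤ k λ t →
    delayed t f n
partial-window k f g n g≡ = trans (partial-- n f g) (trans (cong₂ _-_ (window k f n) (partial-cong n g≡))
  (lem (partial n (delayed (suc k) f)) (∑≤ k λ t → delayed t f n)))
  where
  lem : ∀ a b → a + b - a ≡ b
  lem = solve-∀

partial-zero : ∀ n {f} → (∀ m → f m ≡ 0ℤ) → partial n f ≡ 0ℤ
partial-zero zero    f≡0 = f≡0 0
partial-zero (suc n) f≡0 = cong₂ _+_ (f≡0 (suc n)) (partial-zero n f≡0)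

length-shifted : {A : Set} → ∀ k (L : ℕ → List A) n → + length (shifted k L n) ≡ delayed k (λ m → + length (L m)) n
length-shifted zero    L n       = refl
length-shifted (suc k) L zero    = refl
length-shifted (suc k) L (suc n) = length-shifted k L n

length-bounded : {A : Set} → ∀ R (f : ∀ k → .(k ℕ.≤ R) → List A) g →
    (∀ k .(k≤R : k ℕ.≤ R) → + length (f k k≤R) ≡ g k) →
  + length (bounded R f) ≡ ∑≤ R g
length-bounded zero    f g eq = eq 0 z≤n
length-bounded (suc R) f g eq = trans (cong +_ (Listₚ.length-++ (bounded R (restrict f))))
  (cong₂ _+_ (length-bounded R (restrict f) g λ k k≤R → eq k (ℕₚ.m≤n⇒m≤1+n k≤R)) (eq (suc R) ℕₚ.≤-refl))

length-turned : ∀ {d R h x d′ R′ h′ y} (t : Turn d R h x d′ R′ h′ y) L n →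
  + length (turned t L n) ≡ delayed (cost t) (λ m → + length (L m)) n
length-turned t L n = trans (length-shifted (cost t) (λ m → map (_▸ t) (L m)) n)
  (delayed-cong (cost t) n λ m → cong +_ (Listₚ.length-map (_▸ t) (L m)))

length-swept : ∀ {d R h d′ R′ h′} B (t : ∀ {k} → .(k ℕ.≤ B) → Turn d R h k d′ R′ h′ k) L n →
  (∀ k .(k≤B : k ℕ.≤ B) → cost (t k≤B) ≡ suc k) →
  + length (swept B t L n) ≡ ∑≤ B λ k → delayed (suc k) (λ m → + length (L m)) n
length-swept B t L n cost≡ = length-bounded B (λ _ k≤B → turned (t k≤B) L n)
    (λ k → delayed (suc k) (λ m → + length (L m)) n)
  λ k k≤B → trans (length-turned (t k≤B) L n) (cong (λ c → delayed c (λ m → + length (L m)) n) (cost≡ k k≤B))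

-- The functional equations

-- A shape on the top side with indices `R` and `h` closes to a polygon of width R + 1 and height h.
-- In the last two lists the closing `en` supplies the additional unit of height.
X-walks Y-walks Z-walks : ℕ → ℕ → ℕ → List Walk
X-walks n zero    h       = []
X-walks n (suc R) h       = map walk (top-grown R h n)
Y-walks n zero    j       = []
Y-walks n (suc h) zero    = []
Y-walks n (suc h) (suc R) = map (λ s → walk (s ▸ en)) (right-grown R h n)
Z-walks n R       zero    = []
Z-walks n R       (suc h) = map (λ s → walk (s ▸ en)) (from-below R h n)

X-series Y-series Z-series : Series
X-series n i j = + length (X-walks n i j)
Y-series n i j = + length (Y-walks n i j)
Z-series n i j = + length (Z-walks n i j)

length-X : ∀ R h n → X-series n (suc R) h ≡ + length (top-grown R h n)
length-X R h n = cong +_ (Listₚ.length-map walk (top-grown R h n))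

length-Y : ∀ R h n → Y-series n (suc h) (suc R) ≡ + length (right-grown R h n)
length-Y R h n = cong +_ (Listₚ.length-map (λ s → walk (s ▸ en)) (right-grown R h n))

length-Z : ∀ R h n → Z-series n R (suc h) ≡ + length (from-below R h n)
length-Z R h n = cong +_ (Listₚ.length-map (λ s → walk (s ▸ en)) (from-below R h n))

-- Shapes on the top side are the polygons of all three classes. In the same way, right sides
-- correspond to 𝒴 and 𝒵 through `en`, and bottom sides to 𝒵 through `se` and `en`.
length-N : ∀ R h n → + length (N-shapes R h n) ≡ X-series n (suc R) h + (Y-series n h (suc R) + Z-series n R h)
length-N R zero    n = refl
length-N R (suc h) n = trans (cong +_ (Listₚ.length-++ (top-grown R (suc h) n)))
  (cong₂ _+_ (sym (length-X R (suc h) n)) (trans (cong +_ (Listₚ.length-++ (map (_▸ en) (right-grown R h n))))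
    (cong₂ _+_ (trans (cong +_ (Listₚ.length-map (_▸ en) (right-grown R h n))) (sym (length-Y R h n)))
      (trans (cong +_ (Listₚ.length-map (_▸ en) (from-below R h n))) (sym (length-Z R h n))))))

length-E : ∀ R h n → + length (E-shapes R h n) ≡ Y-series n (suc h) (suc R) + Z-series n R (suc h)
length-E R h n = trans (cong +_ (trans (cong length (E-shapes≡ R h n)) (Listₚ.length-++ (right-grown R h n))))
    (sym (cong₂ _+_ (length-Y R h n) (length-Z R h n)))

length-S : ∀ R h n → + length (S-shapes R h n) ≡ Z-series n (suc R) (suc h)
length-S R h n = sym (trans (length-Z (suc R) h n) (cong +_ (Listₚ.length-map (_▸ se) (S-shapes R h n))))

delayed-N : ∀ R h k n → delayed k (λ m → + length (N-shapes R h m)) n ≡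
  delayed k (λ m → X-series m (suc R) h) n + (delayed k (λ m → Y-series m h (suc R)) n +
      delayed k (λ m → Z-series m R h) n)
delayed-N R h k n = trans (delayed-cong k n (length-N R h))
  (trans (delayed-+ k (λ m → X-series m (suc R) h) (λ m → Y-series m h (suc R) + Z-series m R h) n)
    (cong (_+_ (delayed k (λ m → X-series m (suc R) h) n))
        (delayed-+ k (λ m → Y-series m h (suc R)) (λ m → Z-series m R h) n)))

delayed-E : ∀ R h k n → delayed k (λ m → + length (E-shapes R h m)) n ≡
  delayed k (λ m → Y-series m (suc h) (suc R)) n + delayed k (λ m → Z-series m R (suc h)) n
delayed-E R h k n = trans (delayed-cong k n (length-E R h))
    (delayed-+ k (λ m → Y-series m (suc h) (suc R)) (λ m → Z-series m R (suc h)) n)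

-- The final `nn` adds a row of k + 1 cells to a polygon of any class and the same width. One of
-- these cells is absorbed in `suc n`, leaving a delay by `k`.
X-step : ∀ n R h → X-series (suc n) (suc R) (suc h) ≡
  ∑≤ R (λ k → delayed k (λ m → X-series m (suc R) h) n) +
      (∑≤ R (λ k → delayed k (λ m → Y-series m h (suc R)) n) + ∑≤ R (λ k → delayed k (λ m → Z-series m R h) n))
X-step n R h = trans (length-X R (suc h) (suc n)) (trans (length-swept R nn (N-shapes R h) (suc n) (λ _ _ → refl))
  (trans (∑≤-cong R λ k → delayed-N R h k n)
    (trans (∑≤-+ R (λ k → delayed k (λ m → X-series m (suc R) h) n)
        (λ k → delayed k (λ m → Y-series m h (suc R)) n + delayed k (λ m → Z-series m R h) n))
      (cong (_+_ (∑≤ R (λ k → delayed k (λ m → X-series m (suc R) h) n)))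
        (∑≤-+ R (λ k → delayed k (λ m → Y-series m h (suc R)) n) (λ k → delayed k (λ m → Z-series m R h) n))))))

-- Before `en` comes either `ne`, adding a full row of R + 2 cells to a polygon of any class, or
-- `ee`, adding a column of k + 1 cells to one of 𝒴 or 𝒵.
Y-step : ∀ n h R → Y-series (suc n) (suc h) (suc (suc R)) ≡
  delayed (suc R) (λ m → X-series m (suc R) h) n +
      (delayed (suc R) (λ m → Y-series m h (suc R)) n + delayed (suc R) (λ m → Z-series m R h) n) +
  (∑≤ h (λ k → delayed k (λ m → Y-series m (suc h) (suc R)) n) +
      ∑≤ h (λ k → delayed k (λ m → Z-series m R (suc h)) n))
Y-step n h R = trans (length-Y (suc R) h (suc n))
    (trans (cong +_ (Listₚ.length-++ (turned ne (N-shapes R h) (suc n))))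
  (cong₂ _+_ (trans (length-turned ne (N-shapes R h) (suc n)) (delayed-N R h (suc R) n))
    (trans (length-swept h ee (E-shapes R h) (suc n) (λ _ _ → refl)) (trans (∑≤-cong h λ k → delayed-E R h k n)
      (∑≤-+ h (λ k → delayed k (λ m → Y-series m (suc h) (suc R)) n)
          (λ k → delayed k (λ m → Z-series m R (suc h)) n))))))

-- The bottom side was entered either by `es`, with a full column of h + 2 cells beside a polygon of
-- 𝒴 or 𝒵, or by `ss`, with a row of k + 1 cells below one of 𝒵.
Z-step : ∀ n R h → Z-series (suc n) (suc R) (suc (suc h)) ≡
  delayed (suc h) (λ m → Y-series m (suc h) (suc R)) n + delayed (suc h) (λ m → Z-series m R (suc h)) n +
      ∑≤ R (λ k → delayed k (λ m → Z-series m (suc R) (suc h)) n)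
Z-step n R h = trans (sym (length-S R (suc h) (suc n)))
    (trans (cong +_ (Listₚ.length-++ (turned es (E-shapes R h) (suc n))))
  (cong₂ _+_ (trans (length-turned es (E-shapes R h) (suc n)) (delayed-E R h (suc h) n))
    (trans (length-swept R ss (S-shapes R h) (suc n) (λ _ _ → refl))
        (∑≤-cong R λ k → delayed-cong k n (length-S R h)))))

X-small : ∀ R h → X-series 0 (suc R) (suc h) ≡ 0ℤ
X-small R h = trans (length-X R (suc h) 0) (trans (length-swept R nn (N-shapes R h) 0 (λ _ _ → refl))
    (∑≤-zero R λ _ → refl))

X-empty : ∀ n i → X-series n i 0 ≡ 0ℤ
X-empty n zero    = refl
X-empty n (suc R) = refl

Y-empty : ∀ n i → Y-series n i 0 ≡ 0ℤ
Y-empty n zero    = refl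
Y-empty n (suc h) = refl

Y-small : ∀ h R → Y-series 0 (suc h) (suc R) ≡ 0ℤ
Y-small zero    zero    = refl
Y-small (suc h) zero    = refl
Y-small h       (suc R) = trans (length-Y (suc R) h 0)
    (trans (length-swept h ee (E-shapes R h) 0 (λ _ _ → refl)) (∑≤-zero h λ _ → refl))

Y-unit : ∀ n h → Y-series (suc n) (suc h) 1 ≡ v n h 1
Y-unit zero    zero    = refl
Y-unit (suc n) zero    = refl
Y-unit zero    (suc h) = refl
Y-unit (suc n) (suc h) = refl

Z-empty : ∀ n j → Z-series n 0 j ≡ 0ℤ
Z-empty n zero    = refl
Z-empty n (suc h) = refl

Z-small : ∀ R h → Z-series 0 (suc R) (suc h) ≡ 0ℤ
Z-small R zero    = refl
Z-small R (suc h) = trans (sym (length-S R (suc h) 0))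
    (trans (length-swept R ss (S-shapes R h) 0 (λ _ _ → refl)) (∑≤-zero R λ _ → refl))

partial-none : ∀ (f : ℕ → ℤ) n → partial n (λ m → f m - f m) ≡ 0ℤ
partial-none f n = partial-zero n λ m → ℤₚ.+-inverseʳ (f m)

delay-index : ∀ {k k′} → k ≡ k′ → ∀ f n → delayed k f n ≡ delayed k′ f n
delay-index refl f n = refl

X-equation : X-series ≈ q ⊗ v ⊗ 1/⟨1-q⟩ ⊗ (X-series ⊖ X-series ⟨q^ 1 u,q^ 0 v⟩)
  ⊕ q ⊗ v ⊗ 1/⟨1-q⟩ ⊗ (Y-series ⟨q^ 0 v,q^ 0 u⟩ ⊖ Y-series ⟨q^ 0 v,q^ 1 u⟩)
  ⊕ q ⊗ u ⊗ v ⊗ 1/⟨1-q⟩ ⊗ (Z-series ⊖ q ⊗ Z-series ⟨q^ 1 u,q^ 0 v⟩)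
X-equation n i j = trans (coefficients n i j)
    (sym (cong₂ _+_ (cong₂ _+_ (qv-geometric _ n i j) (qv-geometric _ n i j)) (quv-geometric _ n i j)))
  where
  T₁ = q· (v· (geometric (X-series ⊖ X-series ⟨q^ 1 u,q^ 0 v⟩)))
  T₂ = q· (v· (geometric (Y-series ⟨q^ 0 v,q^ 0 u⟩ ⊖ Y-series ⟨q^ 0 v,q^ 1 u⟩)))
  T₃ = q· (u· (v· (geometric (Z-series ⊖ q ⊗ Z-series ⟨q^ 1 u,q^ 0 v⟩))))
  coefficients : ∀ n i j → X-series n i j ≡ T₁ n i j + T₂ n i j + T₃ n i j
  coefficients zero    zero    j       = refl
  coefficients zero    (suc R) zero    = refl
  coefficients zero    (suc R) (suc h) = X-small R h
  coefficients (suc n) i       zero    = trans (X-empty (suc n) i) (u-zero i)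
    where
    u-zero : ∀ i → 0ℤ ≡ 0ℤ + 0ℤ + T₃ (suc n) i zero
    u-zero zero    = refl
    u-zero (suc R) = refl
  -- At u^0 the substitution of qu for u changes nothing, so the differences vanish.
  coefficients (suc n) zero    (suc h) = sym (cong₂ (λ a b → a + b + 0ℤ) (partial-none (λ _ → 0ℤ) n)
      (partial-none (λ m → Y-series m h 0) n))
  coefficients (suc n) (suc R) (suc h) = trans (X-step n R h)
      (trans (sym (ℤₚ.+-assoc ΣX ΣY ΣZ)) (sym (cong₂ _+_ (cong₂ _+_
      (partial-window R (λ m → X-series m (suc R) h) (λ m → (X-series ⟨q^ 1 u,q^ 0 v⟩) m (suc R) h) n λ m →
          delay-index (trans (ℕₚ.+-identityʳ (suc R ℕ.+ 0)) (ℕₚ.+-identityʳ (suc R))) (λ m → X-series m (suc R) h) m)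
      (partial-window R (λ m → Y-series m h (suc R)) (λ m → (Y-series ⟨q^ 0 v,q^ 1 u⟩) m (suc R) h) n λ m →
          delay-index (ℕₚ.+-identityʳ (suc R)) (λ m → Y-series m h (suc R)) m))
      (partial-window R (λ m → Z-series m R h) (λ m → (q ⊗ Z-series ⟨q^ 1 u,q^ 0 v⟩) m R h) n later))))
    where
    ΣX = ∑≤ R (λ k → delayed k (λ m → X-series m (suc R) h) n)
    ΣY = ∑≤ R (λ k → delayed k (λ m → Y-series m h (suc R)) n)
    ΣZ = ∑≤ R (λ k → delayed k (λ m → Z-series m R h) n)
    -- In 𝒵 the variable u marks the width minus 1, so qu supplies only q^R; the additional factor q
    -- completes the delay by R + 1.
    later : ∀ m → (q ⊗ Z-series ⟨q^ 1 u,q^ 0 v⟩) m R h ≡ delayed (suc R) (λ m → Z-series m R h) m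
    later zero    = q-⊗ (Z-series ⟨q^ 1 u,q^ 0 v⟩) zero R h
    later (suc m) = trans (q-⊗ (Z-series ⟨q^ 1 u,q^ 0 v⟩) (suc m) R h)
        (delay-index (trans (ℕₚ.+-identityʳ (R ℕ.+ 0)) (ℕₚ.+-identityʳ R)) (λ m → Z-series m R h) m)

Y-equation : Y-series ≈ q ⊗ u ⊗ v
  ⊕ q ⊗ v ⊗ 1/⟨1-q⟩ ⊗ (Y-series ⊖ Y-series ⟨q^ 1 u,q^ 0 v⟩)
  ⊕ q ⊗ (v ⊗ v) ⊗ 1/⟨1-q⟩ ⊗ (Z-series ⟨q^ 0 v,q^ 0 u⟩ ⊖ Z-series ⟨q^ 0 v,q^ 1 u⟩)
  ⊕ q ⊗ u ⊗ v ⊗ (X-series ⟨q^ 1 v,q^ 0 u⟩ ⊕ Y-series ⟨q^ 0 u,q^ 1 v⟩ ⊕ q ⊗ v ⊗ Z-series ⟨q^ 1 v,q^ 0 u⟩)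
Y-equation n i j = trans (coefficients n i j)
    (sym (cong₂ _+_ (cong₂ _+_ (cong₂ _+_ (qu-⊗ v n i j) (qv-geometric _ n i j)) (qvv-geometric _ n i j))
    (quv-⊗ _ n i j)))
  where
  F = X-series ⟨q^ 1 v,q^ 0 u⟩ ⊕ Y-series ⟨q^ 0 u,q^ 1 v⟩ ⊕ q ⊗ v ⊗ Z-series ⟨q^ 1 v,q^ 0 u⟩
  T₁ = q· (v· (geometric (Y-series ⊖ Y-series ⟨q^ 1 u,q^ 0 v⟩)))
  T₂ = q· (v· (v· (geometric (Z-series ⟨q^ 0 v,q^ 0 u⟩ ⊖ Z-series ⟨q^ 0 v,q^ 1 u⟩))))
  T₃ = q· (u· (v· F))
  total-of : ℕ → ℕ → ℕ → ℤ
  total-of n i j = q· (u· v) n i j + T₁ n i j + T₂ n i j + T₃ n i j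
  T₁-flat : ∀ n i → T₁ (suc n) i 1 ≡ 0ℤ
  T₁-flat n i = partial-zero n λ m → cong₂ _-_ (Y-empty m i) (delayed-zero (1 ℕ.* i ℕ.+ 0 ℕ.* 0) m λ m → Y-empty m i)
  T₃-flat : ∀ n h → F n h 0 ≡ 0ℤ
  T₃-flat n h = cong₂ _+_ (cong₂ _+_ (delayed-zero (1 ℕ.* 0 ℕ.+ 0 ℕ.* h) n λ _ → refl)
      (delayed-zero (0 ℕ.* h ℕ.+ 1 ℕ.* 0) n λ m → Y-empty m h))
    (trans (qv-⊗ (Z-series ⟨q^ 1 v,q^ 0 u⟩) n h 0) (q-zero n))
    where
    q-zero : ∀ n → q· (v· (Z-series ⟨q^ 1 v,q^ 0 u⟩)) n h 0 ≡ 0ℤ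
    q-zero zero    = refl
    q-zero (suc n) = refl
  row-term : ∀ n h R → F n h (suc R) ≡
    delayed (suc R) (λ m → X-series m (suc R) h) n +
        (delayed (suc R) (λ m → Y-series m h (suc R)) n + delayed (suc R) (λ m → Z-series m R h) n)
  row-term n h R = trans (cong₂ _+_ (cong₂ _+_
      (delay-index (trans (ℕₚ.+-identityʳ (suc R ℕ.+ 0)) (ℕₚ.+-identityʳ (suc R))) (λ m → X-series m (suc R) h) n)
      (delay-index (ℕₚ.+-identityʳ (suc R)) (λ m → Y-series m h (suc R)) n))
      (trans (qv-⊗ (Z-series ⟨q^ 1 v,q^ 0 u⟩) n h (suc R)) (later n)))
    (ℤₚ.+-assoc (delayed (suc R) (λ m → X-series m (suc R) h) n) _ _)
    where
    -- The factor qv corrects both exponents for the index of 𝒵 being the width minus 1.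
    later : ∀ n → q· (v· (Z-series ⟨q^ 1 v,q^ 0 u⟩)) n h (suc R) ≡ delayed (suc R) (λ m → Z-series m R h) n
    later zero    = refl
    later (suc m) = delay-index (trans (ℕₚ.+-identityʳ (R ℕ.+ 0)) (ℕₚ.+-identityʳ R)) (λ m → Z-series m R h) m
  coefficients : ∀ n i j → Y-series n i j ≡ total-of n i j
  coefficients zero    zero    j       = refl
  coefficients zero    (suc h) zero    = refl
  coefficients zero    (suc h) (suc R) = Y-small h R
  coefficients (suc n) zero    zero    = refl
  coefficients (suc n) (suc h) zero    = sym (cong (λ a → a + 0ℤ + 0ℤ + 0ℤ) (v≈ n h 0))
  coefficients (suc n) zero (suc zero) = sym (cong (λ a → 0ℤ + a + 0ℤ + 0ℤ) (T₁-flat n 0))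
  coefficients (suc n) zero (suc (suc R)) = sym (cong₂ (λ a b → 0ℤ + a + b + 0ℤ)
    (partial-zero n λ m → cong (_-_ 0ℤ) (delayed-zero (1 ℕ.* 0 ℕ.+ 0 ℕ.* suc R) {λ _ → 0ℤ} m λ _ → refl))
    (partial-zero n λ m → cong (_-_ 0ℤ) (delayed-zero (0 ℕ.* R ℕ.+ 1 ℕ.* 0) {λ _ → 0ℤ} m λ _ → refl)))
  -- At width 1 the other terms would need polygons of width 0; only the unit square remains.
  coefficients (suc n) (suc h) (suc zero) = trans (Y-unit n h)
      (trans (lem (v n h 1)) (sym (cong₂ (λ a b → v n h 1 + a + 0ℤ + b) (T₁-flat n (suc h)) (T₃-flat n h))))
    where
    lem : ∀ a → a ≡ a + 0ℤ + 0ℤ + 0ℤ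
    lem = solve-∀
  coefficients (suc n) (suc h) (suc (suc R)) =
      trans (Y-step n h R) (trans (lem Row ΣY ΣZ) (sym (cong₂ _+_ (cong₂ _+_ (cong₂ _+_ (v-high n h)
      (partial-window h (λ m → Y-series m (suc h) (suc R)) (λ m → (Y-series ⟨q^ 1 u,q^ 0 v⟩) m (suc h) (suc R)) n λ m
          →
        delay-index (trans (ℕₚ.+-identityʳ (suc h ℕ.+ 0)) (ℕₚ.+-identityʳ (suc h))) (λ m → Y-series m (suc h) (suc R))
            m))
      (partial-window h (λ m → Z-series m R (suc h)) (λ m → (Z-series ⟨q^ 0 v,q^ 1 u⟩) m (suc h) R) n λ m →
        delay-index (ℕₚ.+-identityʳ (suc h)) (λ m → Z-series m R (suc h)) m))
      (row-term n h R))))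
    where
    Row = delayed (suc R) (λ m → X-series m (suc R) h) n +
        (delayed (suc R) (λ m → Y-series m h (suc R)) n + delayed (suc R) (λ m → Z-series m R h) n)
    ΣY = ∑≤ h (λ k → delayed k (λ m → Y-series m (suc h) (suc R)) n)
    ΣZ = ∑≤ h (λ k → delayed k (λ m → Z-series m R (suc h)) n)
    lem : ∀ r y z → r + (y + z) ≡ 0ℤ + y + z + r
    lem = solve-∀
    v-high : ∀ n h → v n h (suc (suc R)) ≡ 0ℤ
    v-high zero    zero    = refl
    v-high zero    (suc h) = refl
    v-high (suc n) h       = refl

Z-equation : Z-series ≈ q ⊗ v ⊗ 1/⟨1-q⟩ ⊗ (Z-series ⊖ Z-series ⟨q^ 1 u,q^ 0 v⟩)
  ⊕ q ⊗ v ⊗ Y-series ⟨q^ 1 v,q^ 0 u⟩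
  ⊕ q ⊗ u ⊗ v ⊗ Z-series ⟨q^ 0 u,q^ 1 v⟩
Z-equation n i j = trans (coefficients n i j)
    (sym (cong₂ _+_ (cong₂ _+_ (qv-geometric _ n i j) (qv-⊗ _ n i j)) (quv-⊗ _ n i j)))
  where
  T₁ = q· (v· (geometric (Z-series ⊖ Z-series ⟨q^ 1 u,q^ 0 v⟩)))
  T₂ = q· (v· (Y-series ⟨q^ 1 v,q^ 0 u⟩))
  T₃ = q· (u· (v· (Z-series ⟨q^ 0 u,q^ 1 v⟩)))
  coefficients : ∀ n i j → Z-series n i j ≡ T₁ n i j + T₂ n i j + T₃ n i j
  coefficients zero    zero    j       = Z-empty 0 j
  coefficients zero    (suc R) zero    = refl
  coefficients zero    (suc R) (suc h) = Z-small R h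
  coefficients (suc n) zero    zero    = refl
  coefficients (suc n) (suc R) zero    = refl
  coefficients (suc n) zero    (suc h) = trans (Z-empty (suc n) (suc h)) (sym (cong₂ (λ a b → a + b + 0ℤ)
    (partial-zero n λ m → cong₂ _-_ (Z-empty m h) (delayed-zero (1 ℕ.* 0 ℕ.+ 0 ℕ.* h) m λ m → Z-empty m h))
    (delayed-zero (1 ℕ.* h ℕ.+ 0 ℕ.* 0) n λ m → Y-empty m h)))
  -- Polygons of 𝒵 have height at least 2, so both sides vanish.
  coefficients (suc n) (suc R) (suc zero) = sym (cong₂ _+_ (cong₂ _+_
    (partial-zero n λ m → cong (_-_ 0ℤ) (delayed-zero (1 ℕ.* suc R ℕ.+ 0 ℕ.* 0) {λ _ → 0ℤ} m λ _ → refl))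
    (delayed-zero (1 ℕ.* 0 ℕ.+ 0 ℕ.* suc R) {λ _ → 0ℤ} n λ _ → refl))
    (delayed-zero (0 ℕ.* R ℕ.+ 1 ℕ.* 0) {λ _ → 0ℤ} n λ _ → refl))
  coefficients (suc n) (suc R) (suc (suc h)) = trans (Z-step n R h) (trans (lem DY DZ ΣZ) (sym (cong₂ _+_ (cong₂ _+_
      (partial-window R (λ m → Z-series m (suc R) (suc h)) (λ m → (Z-series ⟨q^ 1 u,q^ 0 v⟩) m (suc R) (suc h)) n λ m
          →
        delay-index (trans (ℕₚ.+-identityʳ (suc R ℕ.+ 0)) (ℕₚ.+-identityʳ (suc R))) (λ m → Z-series m (suc R) (suc h))
            m)
      (delay-index (trans (ℕₚ.+-identityʳ (suc h ℕ.+ 0)) (ℕₚ.+-identityʳ (suc h))) (λ m → Y-series m (suc h) (suc R))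
          n))
      (delay-index (ℕₚ.+-identityʳ (suc h)) (λ m → Z-series m R (suc h)) n))))
    where
    DY = delayed (suc h) (λ m → Y-series m (suc h) (suc R)) n
    DZ = delayed (suc h) (λ m → Z-series m R (suc h)) n
    ΣZ = ∑≤ R (λ k → delayed k (λ m → Z-series m (suc R) (suc h)) n)
    lem : ∀ a b c → a + b + c ≡ c + a + b
    lem = solve-∀

-- The series count the three classes

marked-injective : ∀ {d R h} {s s′ : Shape d R h} {k k′} → marked s k ≡ marked s′ k′ → s ≡ s′
marked-injective refl = refl

walk-injective : ∀ {R h} {s s′ : Shape N R h} → walk s ≡ walk s′ → s ≡ s′
walk-injective {s = s} {s′} eq = marked-injective (close-injective s s′ (Listₚ.reverse-injective eq))

West : ℕ → Walk → Set
West n w = WestPolygon w × Area (Enclosed w) n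

X-sizes Y-sizes Z-sizes : ∀ {R h} → Shape N R h → Walk → Set
X-sizes {R} {h} s = 𝒳 (area s) (suc R) h
Y-sizes {R} {h} s = 𝒴 (area s) h (suc R)
Z-sizes {R} {h} s = 𝒵 (area s) R h

top-grown-X : ∀ {R h} {s : Shape N R h} → TopGrown s → X-sizes s (walk s)
top-grown-X (by-row s k≤R) = top-removable s k≤R , sizes⁻ (s ▸ nn k≤R)

right-grown-Y : ∀ {R h} {s : Shape E R h} → RightGrown s → Y-sizes (s ▸ en) (walk (s ▸ en))
right-grown-Y {s = s} grown = let area , width , height = sizes⁻ (s ▸ en) in right-removable grown , area , height , width

from-below-Z : ∀ {R h} {s : Shape E R h} → FromBelow s → Z-sizes (s ▸ en) (walk (s ▸ en))
from-below-Z (risen s) = below s , sizes⁻ (s ▸ se ▸ en)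

X-sound : ∀ n i j {w} → w ∈ X-walks n i j → 𝒳 n i j w
X-sound n (suc R) h w∈ =
  let s , s∈ , w≡ = ∈-map⁻ walk w∈
      grown , area≡ = top-sound R h n s∈
  in subst₂ (λ n w → 𝒳 n (suc R) h w) area≡ (sym w≡) (top-grown-X grown)

Y-sound : ∀ n i j {w} → w ∈ Y-walks n i j → 𝒴 n i j w
Y-sound n (suc h) (suc R) w∈ =
  let s , s∈ , w≡ = ∈-map⁻ (λ s → walk (s ▸ en)) w∈
      grown , area≡ = right-sound R h n s∈
  in subst₂ (λ n w → 𝒴 n (suc h) (suc R) w) area≡ (sym w≡) (right-grown-Y grown)

Z-sound : ∀ n i j {w} → w ∈ Z-walks n i j → 𝒵 n i j w
Z-sound n R (suc h) w∈ =
  let s , s∈ , w≡ = ∈-map⁻ (λ s → walk (s ▸ en)) w∈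
      rises , area≡ = below-sound R h n s∈
  in subst₂ (λ n w → 𝒵 n R (suc h) w) area≡ (sym w≡) (from-below-Z rises)

X-shape∈ : ∀ {R h} (s : Shape N R h) → Class𝒳 (walk s) → walk s ∈ X-walks (area s) (suc R) h
X-shape∈ (s ▸ nn k≤R) _     = ∈-map⁺ walk (top-complete s k≤R)
X-shape∈ (s ▸ en)     class = contradiction class (not-top-removable s)

Y-shape∈ : ∀ {R h} (s : Shape N R h) → Class𝒴 (walk s) → walk s ∈ Y-walks (area s) h (suc R)
Y-shape∈ (s ▸ nn k≤R)      class = contradiction class (top-removable-exclusive s k≤R)
Y-shape∈ (start ▸ en)      _     = ∈-map⁺ (λ s → walk (s ▸ en)) (right-complete unit)
Y-shape∈ (s ▸ ne ▸ en)     _     = ∈-map⁺ (λ s → walk (s ▸ en)) (right-complete (by-row s))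
Y-shape∈ (s ▸ ee k≤h ▸ en) _     = ∈-map⁺ (λ s → walk (s ▸ en)) (right-complete (by-column s k≤h))
Y-shape∈ (s ▸ se ▸ en)     class = contradiction class (not-right-removable s)

Z-shape∈ : ∀ {R h} (s : Shape N R h) → ¬ Class𝒳 (walk s) → ¬ Class𝒴 (walk s) → walk s ∈ Z-walks (area s) R h
Z-shape∈ (s ▸ nn k≤R)      not-X _     = contradiction (top-removable s k≤R) not-X
Z-shape∈ (start ▸ en)      _     not-Y = contradiction (right-removable unit) not-Y
Z-shape∈ (s ▸ ne ▸ en)     _     not-Y = contradiction (right-removable (by-row s)) not-Y
Z-shape∈ (s ▸ ee k≤h ▸ en) _     not-Y = contradiction (right-removable (by-column s k≤h)) not-Y
Z-shape∈ (s ▸ se ▸ en)     _     _     = ∈-map⁺ (λ s → walk (s ▸ en)) (below-complete s)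

-- The sizes are kept as equations, because they come from uniqueness of cardinalities and extents;
-- matching on them identifies the indices of the lists.
record WestShape (n i j : ℕ) (w : Walk) : Set where
  constructor west-shape-of
  field
    {right}  : ℕ
    shape    : Shape N right j
    walk≡    : walk shape ≡ w
    area≡    : area shape ≡ n
    width≡   : suc right ≡ i

west-sized : ∀ {n i j w} → West n w → Width (Enclosed w) i → Height (Enclosed w) j → WestShape n i j w
west-sized {n} {i} {j} {w} (west , covers) width height =
  let R , h , s , w≡ = west-walk w west
      n≡ , i≡ , j≡ = sizes s (subst (λ w → Area (Enclosed w) n) w≡ covers)
          (subst (λ w → Width (Enclosed w) i) w≡ width) (subst (λ w → Height (Enclosed w) j) w≡ height)
  in package s (sym w≡) n≡ i≡ j≡
  where
  package : ∀ {n i j w R h} (s : Shape N R h) → walk s ≡ w → area s ≡ n → suc R ≡ i → h ≡ j → WestShape n i j w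
  package s w≡ n≡ i≡ refl = west-shape-of s w≡ n≡ i≡

X-all : ∀ n i j {w} → 𝒳 n i j w → w ∈ X-walks n i j
X-all n i j {w} (class , area , width , height) = from (west-sized (proj₁ class , area) width height) class
  where
  from : WestShape n i j w → Class𝒳 w → w ∈ X-walks n i j
  from (west-shape-of s refl refl refl) = X-shape∈ s

Y-all : ∀ n i j {w} → 𝒴 n i j w → w ∈ Y-walks n i j
Y-all n i j {w} (class , area , height , width) = from (west-sized (proj₁ class , area) width height) class
  where
  from : WestShape n j i w → Class𝒴 w → w ∈ Y-walks n i j
  from (west-shape-of s refl refl refl) = Y-shape∈ s

Z-all : ∀ n i j {w} → 𝒵 n i j w → w ∈ Z-walks n i j
Z-all n i j {w} ((west , not-X , not-Y) , area , width , height) =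
    from (west-sized (west , area) width height) not-X not-Y
  where
  from : WestShape n (suc i) j w → ¬ Class𝒳 w → ¬ Class𝒴 w → w ∈ Z-walks n i j
  from (west-shape-of s refl refl refl) = Z-shape∈ s

X-unique : ∀ n i j → Unique (X-walks n i j)
X-unique n zero    j = []
X-unique n (suc R) h = Uniqueₚ.map⁺ walk-injective (top-unique R h n)

Y-unique : ∀ n i j → Unique (Y-walks n i j)
Y-unique n zero    j       = []
Y-unique n (suc h) zero    = []
Y-unique n (suc h) (suc R) = Uniqueₚ.map⁺ (▸-injective en ∘ walk-injective) (right-unique R h n)

Z-unique : ∀ n i j → Unique (Z-walks n i j)
Z-unique n R zero    = []
Z-unique n R (suc h) = Uniqueₚ.map⁺ (▸-injective en ∘ walk-injective) (below-unique R h n)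

X-GF : IsGF₃ 𝒳 X-series
X-GF n i j = _ , (X-walks n i j , X-unique n i j , (λ w → mk⇔ (X-sound n i j) (X-all n i j)) , refl) , refl

Y-GF : IsGF₃ 𝒴 Y-series
Y-GF n i j = _ , (Y-walks n i j , Y-unique n i j , (λ w → mk⇔ (Y-sound n i j) (Y-all n i j)) , refl) , refl

Z-GF : IsGF₃ 𝒵 Z-series
Z-GF n i j = _ , (Z-walks n i j , Z-unique n i j , (λ w → mk⇔ (Z-sound n i j) (Z-all n i j)) , refl) , refl

-- Specialisation at u = v = 1

west-bounds : ∀ {n i j w} → West n w → Width (Enclosed w) i → Height (Enclosed w) j → i ℕ.≤ n × j ℕ.≤ n
west-bounds west width height = from (west-sized west width height)
  where
  from : ∀ {n i j w} → WestShape n i j w → i ℕ.≤ n × j ℕ.≤ n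
  from (west-shape-of s _ refl refl) = area-bounds s

sum-square : (ℕ → ℕ → ℕ → ℤ) → ℕ → ℤ
sum-square F n = ∑≤ n λ i → ∑≤ n λ j → F n i j

-- The area itself serves as the bound B, since neither index exceeds it.
outside-zero : ∀ (walks : ℕ → ℕ → ℕ → List Walk) →
  (∀ n i j {w} → w ∈ walks n i j → i ℕ.≤ n × j ℕ.≤ n) →
      SpecialisesAt11 (λ n i j → + length (walks n i j)) (sum-square λ n i j → + length (walks n i j))
outside-zero walks bounds n = n , (λ i j → empty i j) , refl
  where
  empty : ∀ i j → n ℕ.< i ⊎ n ℕ.< j → + length (walks n i j) ≡ 0ℤ
  empty i j out with walks n i j | bounds n i j
  ... | []    | _ = refl
  ... | w ∷ _ | b with b (here refl) | out
  ...   | i≤n , _   | inj₁ n<i = contradiction n<i (ℕₚ.≤⇒≯ i≤n)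
  ...   | _   , j≤n | inj₂ n<j = contradiction n<j (ℕₚ.≤⇒≯ j≤n)

X-bounds : ∀ n i j {w} → w ∈ X-walks n i j → i ℕ.≤ n × j ℕ.≤ n
X-bounds n i j w∈ = let class , area , width , height = X-sound n i j w∈ in west-bounds (proj₁ class , area) width height

Y-bounds : ∀ n i j {w} → w ∈ Y-walks n i j → i ℕ.≤ n × j ℕ.≤ n
Y-bounds n i j w∈ =
  let class , area , height , width = Y-sound n i j w∈
      j≤n , i≤n = west-bounds (proj₁ class , area) width height
  in i≤n , j≤n

Z-bounds : ∀ n i j {w} → w ∈ Z-walks n i j → i ℕ.≤ n × j ℕ.≤ n
Z-bounds n i j w∈ =
  let class , area , width , height = Z-sound n i j w∈
      i<n , j≤n = west-bounds (proj₁ class , area) width height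
  in ℕₚ.<⇒≤ i<n , j≤n

square : (ℕ → ℕ → ℕ → List Walk) → ℕ → List Walk
square walks n = bounded n λ i _ → bounded n λ j _ → walks n i j

∈-square⁺ : ∀ walks n i j {w} → i ℕ.≤ n × j ℕ.≤ n → w ∈ walks n i j → w ∈ square walks n
∈-square⁺ walks n i j (i≤n , j≤n) w∈ = ∈-bounded⁺ n (λ i _ → bounded n λ j _ → walks n i j) i i≤n
    (∈-bounded⁺ n (λ j _ → walks n i j) j j≤n w∈)

∈-square⁻ : ∀ walks n {w} → w ∈ square walks n → ∃[ i ] ∃[ j ] w ∈ walks n i j
∈-square⁻ walks n w∈ =
  let i , _ , w∈i = ∈-bounded⁻ n (λ i _ → bounded n λ j _ → walks n i j) w∈
      j , _ , w∈j = ∈-bounded⁻ n (λ j _ → walks n i j) w∈i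
  in i , j , w∈j

square-unique : ∀ walks n → (∀ n i j → Unique (walks n i j)) →
  (∀ i j i′ j′ {w} → w ∈ walks n i j → w ∈ walks n i′ j′ → i ≡ i′ × j ≡ j′) → Unique (square walks n)
square-unique walks n unique separate = bounded-unique n _
  (λ i _ → bounded-unique n _ (λ j _ → unique n i j) λ j j′ _ _ w∈ w∈′ → proj₂ (separate i j i j′ w∈ w∈′))
  λ i i′ _ _ w∈ w∈′ →
    let j , _ , w∈j = ∈-bounded⁻ n (λ j _ → walks n i j) w∈
        j′ , _ , w∈j′ = ∈-bounded⁻ n (λ j _ → walks n i′ j) w∈′
    in proj₁ (separate i j i′ j′ w∈j w∈j′)

length-square : ∀ walks n → + length (square walks n) ≡ sum-square (λ n i j → + length (walks n i j)) n
length-square walks n = length-bounded n (λ i _ → bounded n λ j _ → walks n i j) _ λ i _ →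
    length-bounded n (λ j _ → walks n i j) _ λ j _ → refl

west-walks : ℕ → List Walk
west-walks n = square X-walks n ++ square Y-walks n ++ square Z-walks n

walk∈west-walks : ∀ {R h} (s : Shape N R h) → walk s ∈ west-walks (area s)
walk∈west-walks {R} {h} (s ▸ nn k≤R) = let t = s ▸ nn k≤R ; n = area t in
  ∈-++⁺ˡ (∈-square⁺ X-walks n (suc R) h (area-bounds t) (∈-map⁺ walk (top-complete s k≤R)))
walk∈west-walks {R} {suc h} (s ▸ en) = by-kind (E-listed s)
  where
  n = area s
  right≤ = proj₁ (area-bounds (s ▸ en))
  height≤ = proj₂ (area-bounds (s ▸ en))
  by-kind : s ∈ right-grown R h n ⊎ s ∈ from-below R h n → walk (s ▸ en) ∈ west-walks n
  by-kind (inj₁ s∈) = ∈-++⁺ʳ (square X-walks n)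
      (∈-++⁺ˡ (∈-square⁺ Y-walks n (suc h) (suc R) (height≤ , right≤) (∈-map⁺ (λ s → walk (s ▸ en)) s∈)))
  by-kind (inj₂ s∈) = ∈-++⁺ʳ (square X-walks n)
      (∈-++⁺ʳ (square Y-walks n) (∈-square⁺ Z-walks n R (suc h) (ℕₚ.<⇒≤ right≤ , height≤)
      (∈-map⁺ (λ s → walk (s ▸ en)) s∈)))

west-walks-sound : ∀ n {w} → w ∈ west-walks n → West n w
west-walks-sound n {w} w∈ = [ from-X , (λ w∈YZ → [ from-Y , from-Z ]′ (∈-++⁻ (square Y-walks n) w∈YZ)) ]′
    (∈-++⁻ (square X-walks n) w∈)
  where
  from-X : w ∈ square X-walks n → West n w
  from-X w∈ = let i , j , w∈ = ∈-square⁻ X-walks n w∈ ; class , area , _ = X-sound n i j w∈ in proj₁ class , area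
  from-Y : w ∈ square Y-walks n → West n w
  from-Y w∈ = let i , j , w∈ = ∈-square⁻ Y-walks n w∈ ; class , area , _ = Y-sound n i j w∈ in proj₁ class , area
  from-Z : w ∈ square Z-walks n → West n w
  from-Z w∈ = let i , j , w∈ = ∈-square⁻ Z-walks n w∈ ; class , area , _ = Z-sound n i j w∈ in proj₁ class , area

-- Not immediate from the definitions: 𝒴 contains the unit square by decree, so that it has to be
-- checked not to lie in 𝒳.
X-Y-exclusive : ∀ {w} → Class𝒳 w → Class𝒴 w → ⊥
X-Y-exclusive {w} class-X class-Y =
  let _ , _ , s , w≡ = west-walk w (proj₁ class-X)
  in at-shape s (subst Class𝒳 w≡ class-X) (subst Class𝒴 w≡ class-Y)
  where
  at-shape : ∀ {R h} (s : Shape N R h) → Class𝒳 (walk s) → Class𝒴 (walk s) → ⊥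
  at-shape (s ▸ nn k≤R) _       class-Y = top-removable-exclusive s k≤R class-Y
  at-shape (s ▸ en)     class-X _       = not-top-removable s class-X

west-walks-unique : ∀ n → Unique (west-walks n)
west-walks-unique n = Uniqueₚ.++⁺ (square-unique X-walks n X-unique X-separate)
  (Uniqueₚ.++⁺ (square-unique Y-walks n Y-unique Y-separate) (square-unique Z-walks n Z-unique Z-separate) Y-or-Z)
      X-or-YZ
  where
  X-separate : ∀ i j i′ j′ {w} → w ∈ X-walks n i j → w ∈ X-walks n i′ j′ → i ≡ i′ × j ≡ j′
  X-separate i j i′ j′ w∈ w∈′ =
    let _ , _ , width , height = X-sound n i j w∈ ; _ , _ , width′ , height′ = X-sound n i′ j′ w∈′
    in Extent-unique column width width′ , Extent-unique row height height′
  Y-separate : ∀ i j i′ j′ {w} → w ∈ Y-walks n i j → w ∈ Y-walks n i′ j′ → i ≡ i′ × j ≡ j′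
  Y-separate i j i′ j′ w∈ w∈′ =
    let _ , _ , height , width = Y-sound n i j w∈ ; _ , _ , height′ , width′ = Y-sound n i′ j′ w∈′
    in Extent-unique row height height′ , Extent-unique column width width′
  Z-separate : ∀ i j i′ j′ {w} → w ∈ Z-walks n i j → w ∈ Z-walks n i′ j′ → i ≡ i′ × j ≡ j′
  Z-separate i j i′ j′ w∈ w∈′ =
    let _ , _ , width , height = Z-sound n i j w∈ ; _ , _ , width′ , height′ = Z-sound n i′ j′ w∈′
    in ℕₚ.suc-injective (Extent-unique column width width′) , Extent-unique row height height′
  Y-or-Z : ∀ {w} → w ∈ square Y-walks n × w ∈ square Z-walks n → ⊥
  Y-or-Z (w∈Y , w∈Z) =
    let i , j , w∈ = ∈-square⁻ Y-walks n w∈Y ; i′ , j′ , w∈′ = ∈-square⁻ Z-walks n w∈Z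
    in proj₂ (proj₂ (proj₁ (Z-sound n i′ j′ w∈′))) (proj₁ (Y-sound n i j w∈))
  X-or-Y : ∀ {w} → w ∈ square X-walks n → w ∈ square Y-walks n → ⊥
  X-or-Y w∈X w∈Y =
    let i , j , w∈ = ∈-square⁻ X-walks n w∈X ; i′ , j′ , w∈′ = ∈-square⁻ Y-walks n w∈Y
    in X-Y-exclusive (proj₁ (X-sound n i j w∈)) (proj₁ (Y-sound n i′ j′ w∈′))
  X-or-Z : ∀ {w} → w ∈ square X-walks n → w ∈ square Z-walks n → ⊥
  X-or-Z w∈X w∈Z =
    let i , j , w∈ = ∈-square⁻ X-walks n w∈X ; i′ , j′ , w∈′ = ∈-square⁻ Z-walks n w∈Z
    in proj₁ (proj₂ (proj₁ (Z-sound n i′ j′ w∈′))) (proj₁ (X-sound n i j w∈))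
  X-or-YZ : ∀ {w} → w ∈ square X-walks n × w ∈ square Y-walks n ++ square Z-walks n → ⊥
  X-or-YZ (w∈X , w∈YZ) = [ X-or-Y w∈X , X-or-Z w∈X ]′ (∈-++⁻ (square Y-walks n) w∈YZ)

length-west-walks : ∀ n → + length (west-walks n) ≡ sum-square X-series n + sum-square Y-series n +
    sum-square Z-series n
length-west-walks n = begin
  + length (west-walks n) ≡⟨ cong +_ (trans (Listₚ.length-++ (square X-walks n))
      (cong (length (square X-walks n) ℕ.+_) (Listₚ.length-++ (square Y-walks n)))) ⟩
  + length (square X-walks n) + (+ length (square Y-walks n) + + length (square Z-walks n))
    ≡⟨ cong₂ _+_ (length-square X-walks n) (cong₂ _+_ (length-square Y-walks n) (length-square Z-walks n)) ⟩
  sum-square X-series n + (sum-square Y-series n + sum-square Z-series n) ≡⟨ sym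
      (ℤₚ.+-assoc (sum-square X-series n) (sum-square Y-series n) (sum-square Z-series n)) ⟩
  sum-square X-series n + sum-square Y-series n + sum-square Z-series n ∎
  where open ≡-Reasoning

-- The eight symmetric copies

turns : List Reflection → Direction → Direction
turns []       d = d
turns (g ∷ gs) d = turn g (turns gs d)

reflects unreflects : List Reflection → Trail → Trail
reflects []       w = w
reflects (g ∷ gs) w = reflect g (reflects gs w)
unreflects []       w = w
unreflects (g ∷ gs) w = unreflects gs (reflect g w)

unreflects-reflects : ∀ gs w → unreflects gs (reflects gs w) ≡ w
unreflects-reflects []       w = refl
unreflects-reflects (g ∷ gs) w = trans (cong (unreflects gs) (reflect-involutive g (reflects gs w)))
    (unreflects-reflects gs w)

reflects-unreflects : ∀ gs w → reflects gs (unreflects gs w) ≡ w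
reflects-unreflects []       w = refl
reflects-unreflects (g ∷ gs) w = trans (cong (reflect g) (reflects-unreflects gs (reflect g w)))
    (reflect-involutive g w)

counted-reflects : ∀ gs w {n} → Counted n w → Counted n (reflects gs w)
counted-reflects []       w counted = counted
counted-reflects (g ∷ gs) w counted = counted-reflect g (reflects gs w) (counted-reflects gs w counted)

counted-unreflects : ∀ gs w {n} → Counted n w → Counted n (unreflects gs w)
counted-unreflects []       w counted = counted
counted-unreflects (g ∷ gs) w counted = counted-unreflects gs (reflect g w) (counted-reflect g w counted)

signature-reflects : ∀ gs e d w → Signature e d w → Signature (turns gs e) (turns gs d) (reflects gs w)
signature-reflects []       e d w sig = sig
signature-reflects (g ∷ gs) e d w sig = signature-reflect g {turns gs e} {turns gs d}
    (signature-reflects gs e d w sig)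

signature-unreflects : ∀ gs e d w → Signature (turns gs e) (turns gs d) w → Signature e d (unreflects gs w)
signature-unreflects []       e d w sig = sig
signature-unreflects (g ∷ gs) e d w sig = signature-unreflects gs e d (reflect g w)
  (subst₂ (λ e d → Signature e d (reflect g w)) (turn-involutive g (turns gs e)) (turn-involutive g (turns gs d))
    (signature-reflect g {turn g (turns gs e)} {turn g (turns gs d)} sig))

-- Reflections, applied from right to left, taking the signature (e , d) to
-- (W , S); meaningless unless d ⟂ e.
to-west : Direction → Direction → List Reflection
to-west W N = vertically ∷ []
to-west S W = diagonally ∷ []
to-west S E = vertically ∷ diagonally ∷ []
to-west N W = diagonally ∷ vertically ∷ []
to-west N E = vertically ∷ diagonally ∷ vertically ∷ []
to-west E S = diagonally ∷ vertically ∷ diagonally ∷ []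
to-west E N = vertically ∷ diagonally ∷ vertically ∷ diagonally ∷ []
to-west _ _ = []

signatures : List (Direction × Direction)
signatures = (W , S) ∷ (W , N) ∷ (S , W) ∷ (S , E) ∷ (N , W) ∷ (N , E) ∷ (E , S) ∷ (E , N) ∷ []

open DecMembership (≡-dec _≟ᵈ_ _≟ᵈ_) using () renaming (_∈?_ to _∈ˢ?_)

abstract
  signatures-complete : ∀ d e → d ⟂ e → (e , d) ∈ signatures
  signatures-complete = from-yes (∀-direction? λ d → ∀-direction? λ e → (d ⟂? e) →-dec ((e , d) ∈ˢ? signatures))

  signatures-unique : Unique signatures
  signatures-unique = from-yes (unique? (≡-dec _≟ᵈ_ _≟ᵈ_) signatures)

  to-west-turns : All (λ (e , d) → turns (to-west e d) e ≡ W × turns (to-west e d) d ≡ S) signatures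
  to-west-turns = from-yes (All.all? (λ (e , d) → (turns (to-west e d) e ≟ᵈ W) ×-dec (turns (to-west e d) d ≟ᵈ S))
      signatures)

-- The inverse of the symmetry that brings this signature to (W , S), hence a map from the polygons
-- ending at (-1 , 0) by a step south onto those of signature (e , d). Different signatures make the
-- eight images disjoint.
image : Direction × Direction → Walk → Walk
image (e , d) w = reverse (unreflects (to-west e d) (reverse w))

image-injective : ∀ σ {w w′} → image σ w ≡ image σ w′ → w ≡ w′
image-injective (e , d) {w} {w′} eq = Listₚ.reverse-injective
    (trans (sym (reflects-unreflects (to-west e d) (reverse w)))
  (trans (cong (reflects (to-west e d)) (Listₚ.reverse-injective eq))
      (reflects-unreflects (to-west e d) (reverse w′))))

polygons : ℕ → List Walk
polygons n = concat (map (λ σ → map (image σ) (west-walks n)) signatures)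

west-image : ∀ n σ {w} → σ ∈ signatures → w ∈ west-walks n →
  Counted n (reverse (image σ w)) × Signature (proj₁ σ) (proj₂ σ) (reverse (image σ w))
west-image n (e , d) {w} σ∈ w∈ =
  let west , area≡ = west-walks-sound n w∈
      _ , _ , s , w≡ = west-walk w west
  in from-shape s (trans (cong reverse w≡) (Listₚ.reverse-involutive (close s))) (counted west area≡)
  where
  gs = to-west e d
  western = All.lookup to-west-turns σ∈
  counted : WestPolygon w → Area (Enclosed w) n → Counted n (reverse w)
  counted west covers = polygon⁻ (reverse w) (subst PrudentPolygon (sym (Listₚ.reverse-involutive w)) (proj₁ west)) ,
    subst (λ w → Area (Enclosed w) n) (sym (Listₚ.reverse-involutive w)) covers
  from-shape : ∀ {R h} (s : Shape N R h) → reverse w ≡ close s → Counted n (reverse w) →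
    Counted n (reverse (image (e , d) w)) × Signature e d (reverse (image (e , d) w))
  from-shape s w≡ counted = subst (λ t → Counted n t × Signature e d t)
      (sym (Listₚ.reverse-involutive (unreflects gs (reverse w))))
    ( counted-unreflects gs (reverse w) counted
    , signature-unreflects gs e d (reverse w)
        (subst₂ (λ e d → Signature e d (reverse w)) (sym (proj₁ western)) (sym (proj₂ western))
            (subst (Signature W S) (sym w≡) (close-signature s))))

∈-polygons⁻ : ∀ n {w} → w ∈ polygons n → ∃[ σ ] σ ∈ signatures × ∃[ w′ ] w′ ∈ west-walks n × w ≡ image σ w′
∈-polygons⁻ n w∈ with ∈-concat⁻′ (map (λ σ → map (image σ) (west-walks n)) signatures) w∈
... | ws , w∈ws , ws∈ with ∈-map⁻ (λ σ → map (image σ) (west-walks n)) ws∈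
... | σ , σ∈ , refl = σ , σ∈ , ∈-map⁻ (image σ) w∈ws

counted⇒𝒫 : ∀ n w → Counted n (reverse w) → 𝒫 n w
counted⇒𝒫 n w (polygon , area) = subst (𝒫 n) (Listₚ.reverse-involutive w) (polygon⁺ (reverse w) polygon , area)

𝒫⇒counted : ∀ n w → 𝒫 n w → Counted n (reverse w)
𝒫⇒counted n w p = let polygon , covers = subst (𝒫 n) (sym (Listₚ.reverse-involutive w)) p in polygon⁻ (reverse w) polygon , covers

polygons-sound : ∀ n {w} → w ∈ polygons n → 𝒫 n w
polygons-sound n {w} w∈ =
  let σ , σ∈ , w′ , w′∈ , w≡ = ∈-polygons⁻ n w∈
  in subst (𝒫 n) (sym w≡) (counted⇒𝒫 n (image σ w′) (proj₁ (west-image n σ σ∈ w′∈)))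

polygons-complete : ∀ n w → 𝒫 n w → w ∈ polygons n
polygons-complete n w p =
  let counted = 𝒫⇒counted n w p
      e , d , d⟂e , sig = signature (reverse w) (proj₁ counted)
  in with-signature counted e d d⟂e sig
  where
  with-signature : Counted n (reverse w) → ∀ e d → d ⟂ e → Signature e d (reverse w) → w ∈ polygons n
  with-signature counted e d d⟂e sig = from-shape (signature-close t (proj₁ counted′) sig′)
    where
    σ = (e , d)
    σ∈ = signatures-complete d e d⟂e
    gs = to-west e d
    t = reflects gs (reverse w)
    counted′ = counted-reflects gs (reverse w) counted
    western = All.lookup to-west-turns σ∈
    sig′ : Signature W S t
    sig′ = subst₂ (λ e d → Signature e d t) (proj₁ western) (proj₂ western)
        (signature-reflects gs e d (reverse w) sig)
    from-shape : ClosedShape t → w ∈ polygons n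
    from-shape (R , h , s , t≡) = subst (_∈ polygons n) image≡
      (∈-concat⁺′ (∈-map⁺ (image σ) s∈) (∈-map⁺ (λ σ → map (image σ) (west-walks n)) σ∈))
      where
      s∈ : walk s ∈ west-walks n
      s∈ = subst (λ n → walk s ∈ west-walks n)
          (HasCardinality-unique (close-area s) (subst (λ t → Area (Enclosed (reverse t)) n) t≡ (proj₂ counted′)))
          (walk∈west-walks s)
      image≡ : image σ (walk s) ≡ w
      image≡ = trans (cong (λ t → reverse (unreflects gs t)) (trans (Listₚ.reverse-involutive (close s)) (sym t≡)))
        (trans (cong reverse (unreflects-reflects gs (reverse w))) (Listₚ.reverse-involutive w))

images-disjoint : ∀ n {σ τ} → σ ∈ signatures → τ ∈ signatures → σ ≢ τ →
  ∀ {w} → w ∈ map (image σ) (west-walks n) × w ∈ map (image τ) (west-walks n) → ⊥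
images-disjoint n {σ} {τ} σ∈ τ∈ σ≢τ {w} (w∈σ , w∈τ) =
  let a , a∈ , w≡a = ∈-map⁻ (image σ) w∈σ
      b , b∈ , w≡b = ∈-map⁻ (image τ) w∈τ
      e≡ , d≡ = signature-unique {w = reverse w}
        (subst (λ w → Signature (proj₁ σ) (proj₂ σ) (reverse w)) (sym w≡a) (proj₂ (west-image n σ σ∈ a∈)))
        (subst (λ w → Signature (proj₁ τ) (proj₂ τ) (reverse w)) (sym w≡b) (proj₂ (west-image n τ τ∈ b∈)))
  in σ≢τ (cong₂ _,_ e≡ d≡)

images-unique : ∀ n σs → (∀ {σ} → σ ∈ σs → σ ∈ signatures) → Unique σs →
    Unique (concat (map (λ σ → map (image σ) (west-walks n)) σs))
images-unique n []       _   _              = []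
images-unique n (σ ∷ σs) σs⊆ (σ∉ ∷ unique) = Uniqueₚ.++⁺ (Uniqueₚ.map⁺ (image-injective σ) (west-walks-unique n))
  (images-unique n σs (σs⊆ ∘ there) unique) disjoint
  where
  disjoint : ∀ {w} → w ∈ map (image σ) (west-walks n) × w ∈ concat (map (λ σ → map (image σ) (west-walks n)) σs) → ⊥
  disjoint (w∈σ , w∈σs) with ∈-concat⁻′ (map (λ σ → map (image σ) (west-walks n)) σs) w∈σs
  ... | ws , w∈ws , ws∈ with ∈-map⁻ (λ σ → map (image σ) (west-walks n)) ws∈
  ... | τ , τ∈ , refl = images-disjoint n (σs⊆ (here refl)) (σs⊆ (there τ∈)) (All.lookup σ∉ τ∈) (w∈σ , w∈ws)

polygons-unique : ∀ n → Unique (polygons n)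
polygons-unique n = images-unique n signatures id signatures-unique

length-images : {A B C : Set} (f : A → B → C) (bs : List B) (as : List A) →
    length (concat (map (λ a → map (f a) bs) as)) ≡ length as ℕ.* length bs
length-images f bs []       = refl
length-images f bs (a ∷ as) = trans (Listₚ.length-++ (map (f a) bs))
    (cong₂ ℕ._+_ (Listₚ.length-map (f a) bs) (length-images f bs as))

-- Defined by the formula to be proved; the content lies in `PA-GF`, which counts the polygons as
-- eight disjoint copies of `west-walks`.
PA-series : ℕ → ℤ
PA-series n = + 8 * (sum-square X-series n + sum-square Y-series n + sum-square Z-series n)

PA-GF : IsGF₁ 𝒫 PA-series
PA-GF n = _ , (polygons n , polygons-unique n , (λ w → mk⇔ (polygons-sound n) (polygons-complete n w)) , refl) ,
    (begin
  + 8 * (sum-square X-series n + sum-square Y-series n + sum-square Z-series n) ≡⟨ cong (_*_ (+ 8))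
      (sym (length-west-walks n)) ⟩
  + 8 * + length (west-walks n)                            ≡⟨ sym (ℤₚ.pos-* 8 (length (west-walks n))) ⟩
  + (8 ℕ.* length (west-walks n))                          ≡⟨ cong +_
      (sym (length-images image (west-walks n) signatures)) ⟩
  + length (polygons n)                                    ∎)
  where open ≡-Reasoning

proposition2 : Σ[ X ∈ Series ] Σ[ Y ∈ Series ] Σ[ Z ∈ Series ] Σ[ PA ∈ (ℕ → ℤ) ]
    IsGF₃ 𝒳 X × IsGF₃ 𝒴 Y × IsGF₃ 𝒵 Z × IsGF₁ 𝒫 PA ×
    (X ≈ q ⊗ v ⊗ 1/⟨1-q⟩ ⊗ (X ⊖ X ⟨q^ 1 u,q^ 0 v⟩)
    ⊕ q ⊗ v ⊗ 1/⟨1-q⟩ ⊗ (Y ⟨q^ 0 v,q^ 0 u⟩ ⊖ Y ⟨q^ 0 v,q^ 1 u⟩)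
    ⊕ q ⊗ u ⊗ v ⊗ 1/⟨1-q⟩ ⊗ (Z ⊖ q ⊗ Z ⟨q^ 1 u,q^ 0 v⟩)) ×
    (Y ≈ q ⊗ u ⊗ v
    ⊕ q ⊗ v ⊗ 1/⟨1-q⟩ ⊗ (Y ⊖ Y ⟨q^ 1 u,q^ 0 v⟩)
    ⊕ q ⊗ (v ⊗ v) ⊗ 1/⟨1-q⟩ ⊗ (Z ⟨q^ 0 v,q^ 0 u⟩ ⊖ Z ⟨q^ 0 v,q^ 1 u⟩)
    ⊕ q ⊗ u ⊗ v ⊗ (X ⟨q^ 1 v,q^ 0 u⟩ ⊕ Y ⟨q^ 0 u,q^ 1 v⟩ ⊕ q ⊗ v ⊗ Z ⟨q^ 1 v,q^ 0 u⟩)) ×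
    (Z ≈ q ⊗ v ⊗ 1/⟨1-q⟩ ⊗ (Z ⊖ Z ⟨q^ 1 u,q^ 0 v⟩)
    ⊕ q ⊗ v ⊗ Y ⟨q^ 1 v,q^ 0 u⟩
    ⊕ q ⊗ u ⊗ v ⊗ Z ⟨q^ 0 u,q^ 1 v⟩) ×
    (Σ[ X₁ ∈ (ℕ → ℤ) ] Σ[ Y₁ ∈ (ℕ → ℤ) ] Σ[ Z₁ ∈ (ℕ → ℤ) ]
    SpecialisesAt11 X X₁ × SpecialisesAt11 Y Y₁ × SpecialisesAt11 Z Z₁ ×
    (∀ n → PA n ≡ + 8 * (X₁ n + Y₁ n + Z₁ n))) ×
    applyUpTo (λ n → PA (suc n)) 10 ≡
    + 8 ∷ + 16 ∷ + 40 ∷ + 96 ∷ + 232 ∷ + 560 ∷ + 1336 ∷ + 3176 ∷ + 7480 ∷ + 17528 ∷ []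
proposition2 =
  X-series , Y-series , Z-series , PA-series , X-GF , Y-GF , Z-GF , PA-GF , X-equation , Y-equation , Z-equation ,
  (sum-square X-series , sum-square Y-series , sum-square Z-series ,
   outside-zero X-walks X-bounds , outside-zero Y-walks Y-bounds , outside-zero Z-walks Z-bounds , λ _ → refl) ,
  -- The ten coefficients are obtained by evaluating the enumeration of shapes.
  refl
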